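{- Let $\mathbb{A}$ be the adeles of $\mathbf{Q}$, $Y_\mathbf{Q}=\mathbf{Q}^\times\backslash\mathbb{A}$ with its quotient topology and the multiplication induced from $\mathbb{A}$, and $C_\mathbf{Q}=\mathbf{Q}^\times\backslash\mathbb{A}^\times$ the idele class group. Fix a prime $p$ and let $\mathcal F_p\subset Y_\mathbf{Q}$ be the set of classes $[a]$ of adeles $a$ with $a_p=0$, $a_v\in\mathbf{Z}_v^\times$ for every finite place $v\neq p$, and $a_\infty\in\mathbf{R}^\times$; it is a topological group under multiplication of classes, with neutral element $[e_p]$, where $(e_p)_p=0$ and $(e_p)_v=1$ for $v\neq p$. Let $\iota_p:\mathbf{Q}_p^\times\to C_\mathbf{Q}$ be induced by sending $x$ to the idele with component $x$ at $p$ and $1$ elsewhere. Then $u\mapsto[u\,e_p]$ induces a canonical isomorphism of topological groups \[ C_\mathbf{Q}/\iota_p(\mathbf{Q}_p^\times)\xrightarrow{\ \sim\ }\mathcal F_p. \]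
   Formalization: F_p carries the quotient topology from the space of normalized adeles (a subspace of the adeles), not the subspace topology of Y_Q; the latter is indiscrete by strong approximation away from p, while C_Q/ι_p(Q_p^×) is nontrivial and Hausdorff, so the claim would fail. -}

module Defs where

open import Algebra.Bundles using (CommutativeRing; AbelianGroup; Group)
open import Algebra.Morphism.Structures using (IsGroupHomomorphism; IsGroupIsomorphism)
open import Algebra.Structures using (IsAbelianGroup)
import Algebra.Definitions.RawSemiring as RawExp
import Algebra.Properties.AbelianGroup as AbelianGroupProperties
import Algebra.Properties.CommutativeSemigroup as CommutativeSemigroupProperties
import Algebra.Properties.Semiring.Exp as Exp
import Data.Integer as ℤ
open ℤ using (ℤ; +_; ∣_∣)
import Data.Integer.Properties as ℤₚ
import Data.Integer.Divisibility.Signed as ℤ∣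
open import Data.List using (List; []; _∷_; _++_)
open import Data.List.Membership.Propositional using (_∈_; _∉_)
open import Data.List.Membership.Propositional.Properties using (∈-++⁺ˡ; ∈-++⁺ʳ)
open import Data.List.Relation.Unary.Any using (here; there)
import Data.Nat as ℕ
open ℕ using (ℕ; zero; suc)
import Data.Nat.Properties as ℕₚ
open import Data.Nat.Divisibility using (_∣_; _∤_; _∣?_; divides; ∣⇒≤; m∣m*n; ∣-trans; _∣0)
open import Data.Nat.Primality using (Prime; prime?; euclidsLemma; prime⇒nonZero; prime⇒nonTrivial)
open import Data.Product using (Σ; ∃; ∃₂; _×_; _,_; proj₁; proj₂; uncurry)
open import Data.Product.Relation.Binary.Pointwise.NonDependent using (×-setoid)
open import Data.Rational using (ℚ; mkℚ; 0ℚ; 1ℚ; ½; _+_; _*_; _-_; -_; _<_; _≤_; _⊔_; _⊓_; ↥_; ↧_; ↧ₙ_)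
  renaming (∣_∣ to ∣_∣ℚ)
import Data.Rational as ℚ
import Data.Rational.Properties as ℚₚ
open import Data.Rational.Solver using (module +-*-Solver)
import Data.Rational.Unnormalised as ℚᵘ
import Data.Rational.Unnormalised.Properties as ℚᵘₚ
open import Data.Sum using (_⊎_; inj₁; inj₂)
open import Data.Unit using (⊤; tt)
open import Function using (_∘_; id)
open import Function.Definitions using (Congruent; Inverseᵇ)
open import Level using (Level; 0ℓ) renaming (suc to lsuc; _⊔_ to _⊔ˡ_)
open import Relation.Binary using (Setoid; IsEquivalence; Rel; _Respects_; _⇒_)
import Relation.Binary.Construct.On as On
open import Relation.Binary.PropositionalEquality
  using (_≡_; _≢_; refl; sym; trans; cong; cong₂; subst; module ≡-Reasoning)
open import Relation.Nullary using (¬_; Dec; yes; no; contradiction)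
open import Relation.Nullary.Decidable using (recompute)
open import Relation.Unary using (Pred; _≐_)

open RawExp ℚ.+-*-rawSemiring using () renaming (_^_ to _^ℚ_)

record AbsoluteValue : Set where
  field
    ∥_∥         : ℚ → ℚ
    nonNeg      : ∀ x → 0ℚ ≤ ∥ x ∥
    definite    : ∀ x → ∥ x ∥ ≡ 0ℚ → x ≡ 0ℚ
    ∥0∥≡0       : ∥ 0ℚ ∥ ≡ 0ℚ
    ∥-x∥≡∥x∥    : ∀ x → ∥ - x ∥ ≡ ∥ x ∥
    ∥xy∥≡∥x∥∥y∥ : ∀ x y → ∥ x * y ∥ ≡ ∥ x ∥ * ∥ y ∥
    triangle    : ∀ x y → ∥ x + y ∥ ≤ ∥ x ∥ + ∥ y ∥

archimedean : AbsoluteValue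
archimedean = record
  { ∥_∥         = ∣_∣ℚ
  ; nonNeg      = ℚₚ.0≤∣p∣
  ; definite    = ℚₚ.∣p∣≡0⇒p≡0
  ; ∥0∥≡0       = refl
  ; ∥-x∥≡∥x∥    = ℚₚ.∣-p∣≡∣p∣
  ; ∥xy∥≡∥x∥∥y∥ = ℚₚ.∣p*q∣≡∣p∣*∣q∣
  ; triangle    = ℚₚ.∣p+q∣≤∣p∣+∣q∣
  }

-- `multiplicity p k n` counts how often p divides n, up to k times. For
-- p ≥ 2 and n ≢ 0 the bound k = n used in `ord` is never reached.
multiplicity : ℕ → ℕ → ℕ → ℕ
multiplicity p zero    n = 0
multiplicity p (suc k) n with p ∣? n
... | yes (divides m _) = suc (multiplicity p k m)
... | no  _             = 0

ord : ℕ → ℕ → ℕ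
ord p n = multiplicity p n n

fromℕ : ℕ → ℚ
fromℕ n = (+ n) ℚ./ 1

1/ℕ : (p : ℕ) .{{_ : ℕ.NonZero p}} → ℚ
1/ℕ p = ℚ.1/_ (fromℕ p) {{ℚₚ.pos⇒nonZero (fromℕ p) {{ℚₚ.normalize-pos p 1}}}}

padicℕ : (p : ℕ) .{{_ : ℕ.NonZero p}} → ℕ → ℚ
padicℕ p zero    = 0ℚ
padicℕ p (suc n) = 1/ℕ p ^ℚ ord p (suc n)

-- |a/b|ₚ = |a|ₚ · p^(ord b)
padic∣_∣ : (p : ℕ) .{{_ : ℕ.NonZero p}} → ℚ → ℚ
padic∣ p ∣ x = padicℕ p ∣ ↥ x ∣ * fromℕ p ^ℚ ord p (↧ₙ x)

module PAdicProperties (p : ℕ) (p-prime : Prime p) where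

  instance
    p≢0 : ℕ.NonZero p
    p≢0 = prime⇒nonZero p-prime

  instance
    P-positive : ℚ.Positive (fromℕ p)
    P-positive = ℚₚ.normalize-pos p 1

    P-nonZero : ℚ.NonZero (fromℕ p)
    P-nonZero = ℚₚ.pos⇒nonZero (fromℕ p)

    π-positive : ℚ.Positive (1/ℕ p)
    π-positive = ℚₚ.1/pos⇒pos (fromℕ p)

  π P : ℚ
  π = 1/ℕ p
  P = fromℕ p

  N : ℕ → ℚ
  N = padicℕ p

  open Exp (CommutativeRing.semiring ℚₚ.+-*-commutativeRing) using (^-homo-*)

  π·P≡1 : π * P ≡ 1ℚ
  π·P≡1 = ℚₚ.*-inverseˡ P

  1≤P : 1ℚ ≤ P
  1≤P = ℚₚ.toℚᵘ-cancel-≤ (ℚᵘₚ.≤-respʳ-≃ (ℚᵘₚ.≃-sym (ℚₚ.toℚᵘ-fromℚᵘ (ℚᵘ.mkℚᵘ (+ p) 0)))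
          (ℚᵘ.*≤* (ℤₚ.*-monoʳ-≤-nonNeg (+ 1) (ℤ.+≤+ (ℕ.>-nonZero⁻¹ p)))))

  π≤1 : π ≤ 1ℚ
  π≤1 = begin
    π      ≡⟨ ℚₚ.*-identityʳ π ⟨
    π * 1ℚ ≤⟨ ℚₚ.*-monoˡ-≤-nonNeg π {{ℚₚ.pos⇒nonNeg π}} 1≤P ⟩
    π * P  ≡⟨ π·P≡1 ⟩
    1ℚ     ∎
    where open ℚₚ.≤-Reasoning

  ^-pos : ∀ x .{{_ : ℚ.Positive x}} k → ℚ.Positive (x ^ℚ k)
  ^-pos x zero    = _
  ^-pos x (suc k) = ℚₚ.pos*pos⇒pos x (x ^ℚ k) {{^-pos x k}}

  π^≤1 : ∀ k → π ^ℚ k ≤ 1ℚ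
  π^≤1 zero    = ℚₚ.≤-refl
  π^≤1 (suc k) = begin
    π * π ^ℚ k ≤⟨ ℚₚ.*-monoˡ-≤-nonNeg π {{ℚₚ.pos⇒nonNeg π}} (π^≤1 k) ⟩
    π * 1ℚ     ≡⟨ ℚₚ.*-identityʳ π ⟩
    π          ≤⟨ π≤1 ⟩
    1ℚ         ∎
    where open ℚₚ.≤-Reasoning

  π^-antitone : ∀ {j k} → j ℕ.≤ k → π ^ℚ k ≤ π ^ℚ j
  π^-antitone {k = k} ℕ.z≤n = π^≤1 k
  π^-antitone (ℕ.s≤s j≤k) = ℚₚ.*-monoˡ-≤-nonNeg π {{ℚₚ.pos⇒nonNeg π}} (π^-antitone j≤k)

  π^·P^≡1 : ∀ k → π ^ℚ k * P ^ℚ k ≡ 1ℚ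
  π^·P^≡1 zero    = refl
  π^·P^≡1 (suc k) = begin
    (π * π ^ℚ k) * (P * P ^ℚ k)   ≡⟨ solve 4 (λ a b c d → (a :* b) :* (c :* d) := (a :* c) :* (b :* d)) refl π (π ^ℚ k) P (P ^ℚ k) ⟩
    (π * P) * (π ^ℚ k * P ^ℚ k)   ≡⟨ cong₂ _*_ π·P≡1 (π^·P^≡1 k) ⟩
    1ℚ                            ∎
    where
    open ≡-Reasoning
    open +-*-Solver

  multiplicity-spec : ∀ k n → n ≢ 0 → n ℕ.≤ k → ∃ λ m → n ≡ p ℕ.^ multiplicity p k n ℕ.* m × p ∤ m
  multiplicity-spec zero    n n≢0 n≤0 = contradiction (ℕₚ.n≤0⇒n≡0 n≤0) n≢0
  multiplicity-spec (suc k) n n≢0 n≤k with p ∣? n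
  ... | no p∤n = n , sym (ℕₚ.*-identityˡ n) , p∤n
  ... | yes (divides q refl) with multiplicity-spec k q q≢0 q≤k
    where
    q≢0 : q ≢ 0
    q≢0 refl = n≢0 refl
    instance
      _ = ℕ.≢-nonZero q≢0
    q≤k : q ℕ.≤ k
    q≤k = ℕ.s≤s⁻¹ (ℕₚ.≤-trans (ℕₚ.m<m*n q p (ℕ.nonTrivial⇒n>1 p {{prime⇒nonTrivial p-prime}})) n≤k)
  ...   | m , q≡ , p∤m = m , eq , p∤m
    where
    e : ℕ
    e = multiplicity p k q
    eq : q ℕ.* p ≡ p ℕ.* p ℕ.^ e ℕ.* m
    eq = trans (ℕₚ.*-comm q p) (trans (cong (p ℕ.*_) q≡) (sym (ℕₚ.*-assoc p (p ℕ.^ e) m)))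

  ord-spec : ∀ n → n ≢ 0 → ∃ λ m → n ≡ p ℕ.^ ord p n ℕ.* m × p ∤ m
  ord-spec n n≢0 = multiplicity-spec n n n≢0 ℕₚ.≤-refl

  p^·-unique : ∀ j k m n → p ∤ m → p ∤ n → p ℕ.^ j ℕ.* m ≡ p ℕ.^ k ℕ.* n → j ≡ k
  p^·-unique zero    zero    m n p∤m p∤n eq = refl
  p^·-unique zero    (suc k) m n p∤m p∤n eq = contradiction
    (divides (p ℕ.^ k ℕ.* n)
      (trans (sym (ℕₚ.*-identityˡ m)) (trans eq (trans (ℕₚ.*-assoc p _ n) (ℕₚ.*-comm p _))))) p∤m
  p^·-unique (suc j) zero    m n p∤m p∤n eq = contradiction
    (divides (p ℕ.^ j ℕ.* m)
      (trans (sym (ℕₚ.*-identityˡ n)) (trans (sym eq) (trans (ℕₚ.*-assoc p _ m) (ℕₚ.*-comm p _))))) p∤n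
  p^·-unique (suc j) (suc k) m n p∤m p∤n eq = cong suc (p^·-unique j k m n p∤m p∤n
    (ℕₚ.*-cancelˡ-≡ _ _ p (trans (sym (ℕₚ.*-assoc p _ m)) (trans eq (ℕₚ.*-assoc p _ n)))))

  N-p^ : ∀ k m → p ∤ m → N (p ℕ.^ k ℕ.* m) ≡ π ^ℚ k
  N-p^ k m p∤m = go (p ℕ.^ k ℕ.* m) refl
    where
    instance
      _ = ℕₚ.m^n≢0 p k
    go : ∀ n → n ≡ p ℕ.^ k ℕ.* m → N n ≡ π ^ℚ k
    go zero    eq = contradiction (subst (p ∣_) (sym (ℕₚ.m*n≡0⇒m≡0 m (p ℕ.^ k) (trans (ℕₚ.*-comm m (p ℕ.^ k)) (sym eq)))) (p ∣0)) p∤m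
    go (suc n) eq with ord-spec (suc n) (λ ())
    ... | m′ , eq′ , p∤m′ =
      cong (π ^ℚ_) (p^·-unique (ord p (suc n)) k m′ m p∤m′ p∤m (trans (sym eq′) eq))

  N-mult : ∀ a b → N (a ℕ.* b) ≡ N a * N b
  N-mult zero    b       = sym (ℚₚ.*-zeroˡ (N b))
  N-mult (suc a) zero    = trans (cong N (ℕₚ.*-zeroʳ a)) (sym (ℚₚ.*-zeroʳ (N (suc a))))
  N-mult (suc a) (suc b) with ord-spec (suc a) (λ ()) | ord-spec (suc b) (λ ())
  ... | m , a≡ , p∤m | n , b≡ , p∤n = begin
    N (suc a ℕ.* suc b)                  ≡⟨ cong N (cong₂ ℕ._*_ a≡ b≡) ⟩
    N (p ℕ.^ j ℕ.* m ℕ.* (p ℕ.^ k ℕ.* n)) ≡⟨ cong N (ℕₚ.[m*n]*[o*p]≡[m*o]*[n*p] (p ℕ.^ j) m (p ℕ.^ k) n) ⟩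
    N (p ℕ.^ j ℕ.* p ℕ.^ k ℕ.* (m ℕ.* n)) ≡⟨ cong (λ e → N (e ℕ.* (m ℕ.* n))) (ℕₚ.^-distribˡ-+-* p j k) ⟨
    N (p ℕ.^ (j ℕ.+ k) ℕ.* (m ℕ.* n))     ≡⟨ N-p^ (j ℕ.+ k) (m ℕ.* n) p∤mn ⟩
    π ^ℚ (j ℕ.+ k)                       ≡⟨ ^-homo-* π j k ⟩
    π ^ℚ j * π ^ℚ k                      ∎
    where
    open ≡-Reasoning
    j k : ℕ
    j = ord p (suc a)
    k = ord p (suc b)
    p∤mn : p ∤ m ℕ.* n
    p∤mn p∣mn with euclidsLemma m n p-prime p∣mn
    ... | inj₁ p∣m = p∤m p∣m
    ... | inj₂ p∣n = p∤n p∣n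

  N-positive : ∀ n .{{_ : ℕ.NonZero n}} → ℚ.Positive (N n)
  N-positive (suc n) = ^-pos π (ord p (suc n))

  0≤N : ∀ n → 0ℚ ≤ N n
  0≤N zero    = ℚₚ.≤-refl
  0≤N (suc n) = ℚₚ.<⇒≤ (ℚₚ.positive⁻¹ (N (suc n)) {{N-positive (suc n)}})

  N≤1 : ∀ n → N n ≤ 1ℚ
  N≤1 zero    = ℚ.*≤* (ℤ.+≤+ ℕ.z≤n)
  N≤1 (suc n) = π^≤1 (ord p (suc n))

  N≤π^ : ∀ k n → p ℕ.^ k ∣ n → N n ≤ π ^ℚ k
  N≤π^ k n (divides q refl) = begin
    N (q ℕ.* p ℕ.^ k)    ≡⟨ N-mult q (p ℕ.^ k) ⟩
    N q * N (p ℕ.^ k)    ≡⟨ cong (λ e → N q * N e) (ℕₚ.*-identityʳ (p ℕ.^ k)) ⟨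
    N q * N (p ℕ.^ k ℕ.* 1) ≡⟨ cong (N q *_) (N-p^ k 1 (λ p∣1 → ℕₚ.<⇒≱ (ℕ.nonTrivial⇒n>1 p {{prime⇒nonTrivial p-prime}}) (∣⇒≤ p∣1))) ⟩
    N q * π ^ℚ k         ≤⟨ ℚₚ.*-monoʳ-≤-nonNeg (π ^ℚ k) {{ℚₚ.pos⇒nonNeg (π ^ℚ k) {{^-pos π k}}}} (N≤1 q) ⟩
    1ℚ * π ^ℚ k          ≡⟨ ℚₚ.*-identityˡ _ ⟩
    π ^ℚ k               ∎
    where open ℚₚ.≤-Reasoning

  p^ord∣ : ∀ n .{{_ : ℕ.NonZero n}} → p ℕ.^ ord p n ∣ n
  p^ord∣ n with ord-spec n (ℕ.≢-nonZero⁻¹ n)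
  ... | m , eq , _ = divides m (trans eq (ℕₚ.*-comm _ m))

  N-ultra-≤ : ∀ a b .{{_ : ℕ.NonZero ∣ a ∣}} .{{_ : ℕ.NonZero ∣ b ∣}} →
              ord p ∣ a ∣ ℕ.≤ ord p ∣ b ∣ → N ∣ a ℤ.+ b ∣ ≤ N ∣ a ∣
  N-ultra-≤ a b a≤b = ℚₚ.≤-trans (N≤π^ k ∣ a ℤ.+ b ∣ div) (ℚₚ.≤-reflexive (sym (Nπ ∣ a ∣)))
    where
    k l : ℕ
    k = ord p ∣ a ∣
    l = ord p ∣ b ∣
    Nπ : ∀ n .{{_ : ℕ.NonZero n}} → N n ≡ π ^ℚ ord p n
    Nπ (suc n) = refl
    p^k∣p^ : (p ℕ.^ k) ∣ (p ℕ.^ l)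
    p^k∣p^ = divides (p ℕ.^ (l ℕ.∸ k)) (trans (cong (p ℕ.^_) (sym (ℕₚ.m∸n+n≡m a≤b))) (ℕₚ.^-distribˡ-+-* p (l ℕ.∸ k) k))
    div : (p ℕ.^ k) ∣ (∣ a ℤ.+ b ∣)
    div = ℤ∣.∣⇒∣ᵤ (ℤ∣.∣m∣n⇒∣m+n {+ (p ℕ.^ k)} {a} {b} (ℤ∣.∣ᵤ⇒∣ (p^ord∣ ∣ a ∣)) (ℤ∣.∣ᵤ⇒∣ (∣-trans p^k∣p^ (p^ord∣ ∣ b ∣))))

  N-ultra : ∀ a b → N ∣ a ℤ.+ b ∣ ≤ N ∣ a ∣ ⊔ N ∣ b ∣
  N-ultra a b with a ℤ.≟ (+ 0) | b ℤ.≟ (+ 0)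
  ... | yes refl | _ = ℚₚ.≤-trans (ℚₚ.≤-reflexive (cong (λ c → N ∣ c ∣) (ℤₚ.+-identityˡ b))) (ℚₚ.p≤q⊔p (N 0) (N ∣ b ∣))
  ... | no _ | yes refl = ℚₚ.≤-trans (ℚₚ.≤-reflexive (cong (λ c → N ∣ c ∣) (ℤₚ.+-identityʳ a))) (ℚₚ.p≤p⊔q (N ∣ a ∣) (N 0))
  ... | no a≢0 | no b≢0 with ℕₚ.≤-total (ord p ∣ a ∣) (ord p ∣ b ∣)
  ...   | inj₁ a≤b = ℚₚ.≤-trans (N-ultra-≤ a b {{ℕ.≢-nonZero (a≢0 ∘ ℤₚ.∣i∣≡0⇒i≡0)}} {{ℕ.≢-nonZero (b≢0 ∘ ℤₚ.∣i∣≡0⇒i≡0)}} a≤b) (ℚₚ.p≤p⊔q (N ∣ a ∣) (N ∣ b ∣))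
  ...   | inj₂ b≤a = ℚₚ.≤-trans
    (ℚₚ.≤-trans (ℚₚ.≤-reflexive (cong (λ c → N ∣ c ∣) (ℤₚ.+-comm a b)))
      (N-ultra-≤ b a {{ℕ.≢-nonZero (b≢0 ∘ ℤₚ.∣i∣≡0⇒i≡0)}} {{ℕ.≢-nonZero (a≢0 ∘ ℤₚ.∣i∣≡0⇒i≡0)}} b≤a))
    (ℚₚ.p≤q⊔p (N ∣ a ∣) (N ∣ b ∣))

  ∥_∥ₚ : ℚ → ℚ
  ∥ x ∥ₚ = padic∣ p ∣ x

  ∥x∥·N↧x : ∀ x → ∥ x ∥ₚ * N (↧ₙ x) ≡ N ∣ ↥ x ∣
  ∥x∥·N↧x (mkℚ n d-1 _) = begin
    N ∣ n ∣ * P ^ℚ o * π ^ℚ o     ≡⟨ solve 3 (λ a b c → a :* b :* c := a :* (c :* b)) refl (N ∣ n ∣) (P ^ℚ o) (π ^ℚ o) ⟩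
    N ∣ n ∣ * (π ^ℚ o * P ^ℚ o)   ≡⟨ cong (N ∣ n ∣ *_) (π^·P^≡1 o) ⟩
    N ∣ n ∣ * 1ℚ                  ≡⟨ ℚₚ.*-identityʳ _ ⟩
    N ∣ n ∣                       ∎
    where
    open ≡-Reasoning
    open +-*-Solver
    o : ℕ
    o = ord p (suc d-1)

  *-cancelʳ : ∀ z .{{_ : ℚ.Positive z}} {x y} → x * z ≡ y * z → x ≡ y
  *-cancelʳ z eq = ℚₚ.≤-antisym (ℚₚ.*-cancelʳ-≤-pos z (ℚₚ.≤-reflexive eq))
                                (ℚₚ.*-cancelʳ-≤-pos z (ℚₚ.≤-reflexive (sym eq)))

  ∥∥-fraction : ∀ x (n : ℤ) (d : ℕ) → ↥ x ℤ.* (+ d) ≡ n ℤ.* ↧ x → ∥ x ∥ₚ * N d ≡ N ∣ n ∣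
  ∥∥-fraction x n d eq = *-cancelʳ (N (↧ₙ x)) {{N-positive (↧ₙ x)}} (begin
    ∥ x ∥ₚ * N d * N (↧ₙ x)       ≡⟨ solve 3 (λ a b c → a :* b :* c := a :* c :* b) refl ∥ x ∥ₚ (N d) (N (↧ₙ x)) ⟩
    ∥ x ∥ₚ * N (↧ₙ x) * N d       ≡⟨ cong (_* N d) (∥x∥·N↧x x) ⟩
    N ∣ ↥ x ∣ * N d               ≡⟨ N-mult ∣ ↥ x ∣ d ⟨
    N (∣ ↥ x ∣ ℕ.* d)             ≡⟨ cong N (ℤₚ.abs-* (↥ x) (+ d)) ⟨
    N ∣ ↥ x ℤ.* (+ d) ∣           ≡⟨ cong (λ c → N ∣ c ∣) eq ⟩
    N ∣ n ℤ.* ↧ x ∣               ≡⟨ cong N (ℤₚ.abs-* n (↧ x)) ⟩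
    N (∣ n ∣ ℕ.* ↧ₙ x)            ≡⟨ N-mult ∣ n ∣ (↧ₙ x) ⟩
    N ∣ n ∣ * N (↧ₙ x)            ∎)
    where
    open ≡-Reasoning
    open +-*-Solver

  ↥↧-toℚᵘ : ∀ x {n d-1} → ℚ.toℚᵘ x ℚᵘ.≃ ℚᵘ.mkℚᵘ n d-1 → ↥ x ℤ.* (+ suc d-1) ≡ n ℤ.* ↧ x
  ↥↧-toℚᵘ (mkℚ _ _ _) (ℚᵘ.*≡* eq) = eq

  ∥∥-mult : ∀ x y → ∥ x * y ∥ₚ ≡ ∥ x ∥ₚ * ∥ y ∥ₚ
  ∥∥-mult x@(mkℚ a b-1 _) y@(mkℚ c d-1 _) =
    *-cancelʳ (N b * N d) {{ℚₚ.pos*pos⇒pos (N b) {{N-positive b}} (N d) {{N-positive d}}}} (begin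
      ∥ x * y ∥ₚ * (N b * N d)           ≡⟨ cong (∥ x * y ∥ₚ *_) (N-mult b d) ⟨
      ∥ x * y ∥ₚ * N (b ℕ.* d)           ≡⟨ ∥∥-fraction (x * y) (a ℤ.* c) (b ℕ.* d) (↥↧-toℚᵘ (x * y) (ℚₚ.toℚᵘ-homo-* x y)) ⟩
      N ∣ a ℤ.* c ∣                      ≡⟨ cong N (ℤₚ.abs-* a c) ⟩
      N (∣ a ∣ ℕ.* ∣ c ∣)                ≡⟨ N-mult ∣ a ∣ ∣ c ∣ ⟩
      N ∣ a ∣ * N ∣ c ∣                  ≡⟨ cong₂ _*_ (∥x∥·N↧x x) (∥x∥·N↧x y) ⟨
      ∥ x ∥ₚ * N b * (∥ y ∥ₚ * N d)      ≡⟨ solve 4 (λ e f g h → e :* f :* (g :* h) := e :* g :* (f :* h)) refl ∥ x ∥ₚ (N b) ∥ y ∥ₚ (N d) ⟩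
      ∥ x ∥ₚ * ∥ y ∥ₚ * (N b * N d)      ∎)
    where
    open ≡-Reasoning
    open +-*-Solver
    b d : ℕ
    b = suc b-1
    d = suc d-1

  ∥∥-nonNeg : ∀ x → 0ℚ ≤ ∥ x ∥ₚ
  ∥∥-nonNeg x@record{} = ℚₚ.nonNegative⁻¹ ∥ x ∥ₚ {{ℚₚ.nonNeg*nonNeg⇒nonNeg
    (N ∣ ↥ x ∣) {{ℚ.nonNegative (0≤N ∣ ↥ x ∣)}} (P ^ℚ ord p (↧ₙ x)) {{ℚₚ.pos⇒nonNeg (P ^ℚ ord p (↧ₙ x)) {{^-pos P (ord p (↧ₙ x))}}}}}}

  ∥∥-definite : ∀ x → ∥ x ∥ₚ ≡ 0ℚ → x ≡ 0ℚ
  ∥∥-definite x eq = ℚₚ.↥p≡0⇒p≡0 x (go (↥ x) (trans (sym (∥x∥·N↧x x)) (trans (cong (_* N (↧ₙ x)) eq) (ℚₚ.*-zeroˡ (N (↧ₙ x))))))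
    where
    go : ∀ n → N ∣ n ∣ ≡ 0ℚ → n ≡ (+ 0)
    go n N≡0 with n ℤ.≟ (+ 0)
    ... | yes n≡0 = n≡0
    ... | no  n≢0 = contradiction (sym N≡0)
      (ℚₚ.<⇒≢ (ℚₚ.positive⁻¹ (N ∣ n ∣) {{N-positive ∣ n ∣ {{ℕ.≢-nonZero (n≢0 ∘ ℤₚ.∣i∣≡0⇒i≡0)}}}}))

  ∥∥-neg : ∀ x → ∥ - x ∥ₚ ≡ ∥ x ∥ₚ
  ∥∥-neg (mkℚ ℤ.-[1+ _ ] _ _)  = refl
  ∥∥-neg (mkℚ (+ zero) _ _)    = refl
  ∥∥-neg (mkℚ ℤ.+[1+ _ ] _ _)  = refl

  ultrametric : ∀ x y → padic∣ p ∣ (x + y) ≤ padic∣ p ∣ x ⊔ padic∣ p ∣ y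
  ultrametric x@(mkℚ a b-1 _) y@(mkℚ c d-1 _) =
    ℚₚ.*-cancelʳ-≤-pos (N b * N d) {{bd-positive}} (begin
      ∥ x + y ∥ₚ * (N b * N d)                          ≡⟨ cong (∥ x + y ∥ₚ *_) (N-mult b d) ⟨
      ∥ x + y ∥ₚ * N (b ℕ.* d)                          ≡⟨ ∥∥-fraction (x + y) (a ℤ.* (+ d) ℤ.+ c ℤ.* (+ b)) (b ℕ.* d) (↥↧-toℚᵘ (x + y) (ℚₚ.toℚᵘ-homo-+ x y)) ⟩
      N ∣ a ℤ.* (+ d) ℤ.+ c ℤ.* (+ b) ∣                 ≤⟨ N-ultra (a ℤ.* (+ d)) (c ℤ.* (+ b)) ⟩
      N ∣ a ℤ.* (+ d) ∣ ⊔ N ∣ c ℤ.* (+ b) ∣             ≡⟨ cong₂ _⊔_ (cong N (ℤₚ.abs-* a (+ d))) (cong N (ℤₚ.abs-* c (+ b))) ⟩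
      N (∣ a ∣ ℕ.* d) ⊔ N (∣ c ∣ ℕ.* b)                 ≡⟨ cong₂ _⊔_ (N-mult ∣ a ∣ d) (N-mult ∣ c ∣ b) ⟩
      N ∣ a ∣ * N d ⊔ N ∣ c ∣ * N b                     ≡⟨ cong₂ (λ e f → e * N d ⊔ f * N b) (∥x∥·N↧x x) (∥x∥·N↧x y) ⟨
      ∥ x ∥ₚ * N b * N d ⊔ ∥ y ∥ₚ * N d * N b           ≡⟨ cong₂ _⊔_ (ℚₚ.*-assoc ∥ x ∥ₚ (N b) (N d))
                                                              (trans (ℚₚ.*-assoc ∥ y ∥ₚ (N d) (N b)) (cong (∥ y ∥ₚ *_) (ℚₚ.*-comm (N d) (N b)))) ⟩
      ∥ x ∥ₚ * (N b * N d) ⊔ ∥ y ∥ₚ * (N b * N d)       ≡⟨ ℚₚ.*-distribʳ-⊔-nonNeg (N b * N d) {{ℚₚ.pos⇒nonNeg (N b * N d) {{bd-positive}}}} ∥ x ∥ₚ ∥ y ∥ₚ ⟨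
      (∥ x ∥ₚ ⊔ ∥ y ∥ₚ) * (N b * N d)                   ∎)
    where
    open ℚₚ.≤-Reasoning
    b d : ℕ
    b = suc b-1
    d = suc d-1
    bd-positive : ℚ.Positive (N b * N d)
    bd-positive = ℚₚ.pos*pos⇒pos (N b) {{N-positive b}} (N d) {{N-positive d}}

  x⊔y≤x+y : ∀ {x y} → 0ℚ ≤ x → 0ℚ ≤ y → x ⊔ y ≤ x + y
  x⊔y≤x+y {x} {y} 0≤x 0≤y = ℚₚ.⊔-lub
    (ℚₚ.≤-trans (ℚₚ.≤-reflexive (sym (ℚₚ.+-identityʳ x))) (ℚₚ.+-monoʳ-≤ x 0≤y))
    (ℚₚ.≤-trans (ℚₚ.≤-reflexive (sym (ℚₚ.+-identityˡ y))) (ℚₚ.+-monoˡ-≤ y 0≤x))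

  absoluteValue : AbsoluteValue
  absoluteValue = record
    { ∥_∥         = padic∣ p ∣
    ; nonNeg      = ∥∥-nonNeg
    ; definite    = ∥∥-definite
    ; ∥0∥≡0       = ℚₚ.*-zeroˡ (P ^ℚ ord p 1)
    ; ∥-x∥≡∥x∥    = ∥∥-neg
    ; ∥xy∥≡∥x∥∥y∥ = ∥∥-mult
    ; triangle    = λ x y → ℚₚ.≤-trans (ultrametric x y) (x⊔y≤x+y (∥∥-nonNeg x) (∥∥-nonNeg y))
    }

  ∥x∥≤1 : ∀ x → p ∤ ↧ₙ x → padic∣ p ∣ x ≤ 1ℚ
  ∥x∥≤1 x p∤d = begin
    ∥ x ∥ₚ                 ≡⟨ ℚₚ.*-identityʳ ∥ x ∥ₚ ⟨
    ∥ x ∥ₚ * 1ℚ            ≡⟨ cong (∥ x ∥ₚ *_) (N-p^ 0 (↧ₙ x) p∤d) ⟨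
    ∥ x ∥ₚ * N (1 ℕ.* ↧ₙ x) ≡⟨ cong (λ e → ∥ x ∥ₚ * N e) (ℕₚ.*-identityˡ (↧ₙ x)) ⟩
    ∥ x ∥ₚ * N (↧ₙ x)      ≡⟨ ∥x∥·N↧x x ⟩
    N ∣ ↥ x ∣              ≤⟨ N≤1 ∣ ↥ x ∣ ⟩
    1ℚ                     ∎
    where open ℚₚ.≤-Reasoning

private
  x≡x-y+y : ∀ x y → x ≡ x - y + y
  x≡x-y+y = solve 2 (λ a b → a := a :- b :+ b) refl
    where open +-*-Solver

  +-interchange : ∀ a b c d → a - b + (c - d) ≡ a + c - (b + d)
  +-interchange = solve 4 (λ a b c d → (a :- b) :+ (c :- d) := (a :+ c) :- (b :+ d)) refl
    where open +-*-Solver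

  product-difference : ∀ a b c d → a * (c - d) + d * (a - b) ≡ a * c - b * d
  product-difference = solve 4 (λ a b c d → a :* (c :- d) :+ d :* (a :- b) := a :* c :- b :* d) refl
    where open +-*-Solver

  neg-difference : ∀ a b → - (a - b) ≡ b - a
  neg-difference = solve 2 (λ a b → :- (a :- b) := b :- a) refl
    where open +-*-Solver

  difference-of-negs : ∀ a b → - (a - b) ≡ - a - - b
  difference-of-negs = solve 2 (λ a b → :- (a :- b) := (:- a) :- (:- b)) refl
    where open +-*-Solver

  difference-trans : ∀ a b c → a - b + (b - c) ≡ a - c
  difference-trans = solve 3 (λ a b c → (a :- b) :+ (b :- c) := a :- c) refl
    where open +-*-Solver

module Completion (A : AbsoluteValue) where

  open AbsoluteValue A

  IsCauchy : (ℕ → ℚ) → Set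
  IsCauchy s = ∀ ε → 0ℚ < ε → ∃ λ N → ∀ m n → N ℕ.≤ m → N ℕ.≤ n → ∥ s m - s n ∥ < ε

  record Carrier : Set where
    constructor mkCauchy
    field
      seq    : ℕ → ℚ
      cauchy : IsCauchy seq

  open Carrier public

  infix 4 _≈_

  record _≈_ (x y : Carrier) : Set where
    constructor mk≈
    field
      close : ∀ ε → 0ℚ < ε → ∃ λ N → ∀ n → N ℕ.≤ n → ∥ seq x n - seq y n ∥ < ε

  open _≈_ public

  -- The strict inequality |x| < r between the extended absolute value of x
  -- and a rational number
  ∥_∥<_ : Carrier → ℚ → Set
  ∥ x ∥< r = ∃ λ δ → δ < r × ∃ λ N → ∀ n → N ℕ.≤ n → ∥ seq x n ∥ ≤ δ

  Null : (ℕ → ℕ → ℚ) → Set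
  Null s = ∀ ε → 0ℚ < ε → ∃ λ N → ∀ m n → N ℕ.≤ m → N ℕ.≤ n → ∥ s m n ∥ < ε

  Bounded : (ℕ → ℕ → ℚ) → Set
  Bounded s = ∃₂ λ B N → ∀ m n → N ℕ.≤ m → N ℕ.≤ n → ∥ s m n ∥ ≤ B

  ½-pos : ∀ {ε} → 0ℚ < ε → 0ℚ < ½ * ε
  ½-pos {ε} 0<ε = ℚₚ.positive⁻¹ (½ * ε) {{ℚₚ.pos*pos⇒pos ½ ε {{ℚ.positive 0<ε}}}}

  ½+½ : ∀ ε → ½ * ε + ½ * ε ≡ ε
  ½+½ ε = trans (sym (ℚₚ.*-distribʳ-+ ε ½ ½)) (ℚₚ.*-identityˡ ε)

  null-ext : ∀ {s t} → (∀ m n → s m n ≡ t m n) → Null s → Null t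
  null-ext {s} {t} s≡t s-null ε 0<ε with s-null ε 0<ε
  ... | N , small = N , λ m n N≤m N≤n → subst (λ q → ∥ q ∥ < ε) (s≡t m n) (small m n N≤m N≤n)

  null-0 : Null (λ _ _ → 0ℚ)
  null-0 ε 0<ε = 0 , λ _ _ _ _ → subst (_< ε) (sym ∥0∥≡0) 0<ε

  null-+ : ∀ {s t} → Null s → Null t → Null (λ m n → s m n + t m n)
  null-+ {s} {t} s-null t-null ε 0<ε
    with s-null (½ * ε) (½-pos 0<ε) | t-null (½ * ε) (½-pos 0<ε)
  ... | M , small-s | N , small-t = M ℕ.⊔ N , λ m n ≤m ≤n → begin-strict
    ∥ s m n + t m n ∥      ≤⟨ triangle (s m n) (t m n) ⟩
    ∥ s m n ∥ + ∥ t m n ∥  <⟨ ℚₚ.+-mono-<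
        (small-s m n (ℕₚ.≤-trans (ℕₚ.m≤m⊔n M N) ≤m) (ℕₚ.≤-trans (ℕₚ.m≤m⊔n M N) ≤n))
        (small-t m n (ℕₚ.≤-trans (ℕₚ.m≤n⊔m M N) ≤m) (ℕₚ.≤-trans (ℕₚ.m≤n⊔m M N) ≤n)) ⟩
    ½ * ε + ½ * ε          ≡⟨ ½+½ ε ⟩
    ε                      ∎
    where open ℚₚ.≤-Reasoning

  null-neg : ∀ {s} → Null s → Null (λ m n → - s m n)
  null-neg {s} s-null ε 0<ε with s-null ε 0<ε
  ... | N , small = N , λ m n ≤m ≤n → subst (_< ε) (sym (∥-x∥≡∥x∥ (s m n))) (small m n ≤m ≤n)

  null-* : ∀ {b s} → Bounded b → Null s → Null (λ m n → b m n * s m n)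
  null-* {b} {s} (B , M , bounded) s-null ε 0<ε = go (s-null δ 0<δ)
    where
    open ℚₚ.≤-Reasoning
    C : ℚ
    C = (B ⊔ 0ℚ) + 1ℚ
    B≤C : B ≤ C
    B≤C = begin
      B            ≤⟨ ℚₚ.p≤p⊔q B 0ℚ ⟩
      (B ⊔ 0ℚ)       ≡⟨ ℚₚ.+-identityʳ (B ⊔ 0ℚ) ⟨
      (B ⊔ 0ℚ) + 0ℚ  ≤⟨ ℚₚ.+-monoʳ-≤ (B ⊔ 0ℚ) (ℚₚ.nonNegative⁻¹ 1ℚ) ⟩
      C            ∎
    instance
      C-pos : ℚ.Positive C
      C-pos = ℚₚ.nonNeg+pos⇒pos (B ⊔ 0ℚ) {{ℚ.nonNegative (ℚₚ.p≤q⊔p B 0ℚ)}} 1ℚ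
      C≢0 : ℚ.NonZero C
      C≢0 = ℚₚ.pos⇒nonZero C
      1/C-pos : ℚ.Positive (ℚ.1/ C)
      1/C-pos = ℚₚ.1/pos⇒pos C
    δ : ℚ
    δ = ε * ℚ.1/ C
    0<δ : 0ℚ < δ
    0<δ = ℚₚ.positive⁻¹ δ {{ℚₚ.pos*pos⇒pos ε {{ℚ.positive 0<ε}} (ℚ.1/ C)}}
    C*δ≡ε : C * δ ≡ ε
    C*δ≡ε = trans (ℚₚ.*-comm C δ) (trans (ℚₚ.*-assoc ε (ℚ.1/ C) C)
              (trans (cong (ε *_) (ℚₚ.*-inverseˡ C)) (ℚₚ.*-identityʳ ε)))
    go : (∃ λ N → ∀ m n → N ℕ.≤ m → N ℕ.≤ n → ∥ s m n ∥ < δ) →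
         ∃ λ N → ∀ m n → N ℕ.≤ m → N ℕ.≤ n → ∥ b m n * s m n ∥ < ε
    go (N , small) = M ℕ.⊔ N , λ m n ≤m ≤n → begin-strict
      ∥ b m n * s m n ∥      ≡⟨ ∥xy∥≡∥x∥∥y∥ (b m n) (s m n) ⟩
      ∥ b m n ∥ * ∥ s m n ∥  ≤⟨ ℚₚ.*-monoʳ-≤-nonNeg ∥ s m n ∥ {{ℚ.nonNegative (nonNeg (s m n))}}
                                  (ℚₚ.≤-trans (bounded m n (ℕₚ.≤-trans (ℕₚ.m≤m⊔n M N) ≤m) (ℕₚ.≤-trans (ℕₚ.m≤m⊔n M N) ≤n)) B≤C) ⟩
      C * ∥ s m n ∥          <⟨ ℚₚ.*-monoʳ-<-pos C
                                  (small m n (ℕₚ.≤-trans (ℕₚ.m≤n⊔m M N) ≤m) (ℕₚ.≤-trans (ℕₚ.m≤n⊔m M N) ≤n)) ⟩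
      C * δ                  ≡⟨ C*δ≡ε ⟩
      ε                      ∎

  seq-bounded : ∀ x → ∃₂ λ B N → ∀ n → N ℕ.≤ n → ∥ seq x n ∥ ≤ B
  seq-bounded x = 1ℚ + ∥ seq x N ∥ , N , λ n N≤n → begin
    ∥ seq x n ∥                          ≡⟨ cong ∥_∥ (x≡x-y+y (seq x n) (seq x N)) ⟩
    ∥ seq x n - seq x N + seq x N ∥      ≤⟨ triangle (seq x n - seq x N) (seq x N) ⟩
    ∥ seq x n - seq x N ∥ + ∥ seq x N ∥  ≤⟨ ℚₚ.+-monoˡ-≤ ∥ seq x N ∥ (ℚₚ.<⇒≤ (proj₂ tail n N N≤n ℕₚ.≤-refl)) ⟩
    1ℚ + ∥ seq x N ∥                     ∎
    where
    open ℚₚ.≤-Reasoning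
    tail : ∃ λ N → ∀ m n → N ℕ.≤ m → N ℕ.≤ n → ∥ seq x m - seq x n ∥ < 1ℚ
    tail = cauchy x 1ℚ (ℚₚ.positive⁻¹ 1ℚ)
    N : ℕ
    N = proj₁ tail

  bounded₁ : ∀ x → Bounded (λ m _ → seq x m)
  bounded₁ x = let B , N , b = seq-bounded x in B , N , λ m n ≤m _ → b m ≤m

  bounded₂ : ∀ x → Bounded (λ _ n → seq x n)
  bounded₂ x = let B , N , b = seq-bounded x in B , N , λ m n _ ≤n → b n ≤n

  from-≈ : ∀ {x y} → x ≈ y → Null (λ m _ → seq x m - seq y m)
  from-≈ x≈y ε 0<ε = let N , small = close x≈y ε 0<ε in N , λ m _ ≤m _ → small m ≤m

  to-≈ : ∀ {x y} → Null (λ m _ → seq x m - seq y m) → x ≈ y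
  to-≈ null = mk≈ λ ε 0<ε → let N , small = null ε 0<ε in N , λ m ≤m → small m m ≤m ≤m

  pointwise : ∀ {x y} → (∀ n → seq x n ≡ seq y n) → x ≈ y
  pointwise {x} {y} x≡y = to-≈ (null-ext
    (λ m _ → sym (trans (cong (_- seq y m) (x≡y m)) (ℚₚ.+-inverseʳ (seq y m)))) null-0)

  -- Abstract, since these proofs are fields of the numbers below and would
  -- otherwise be unfolded whenever two numbers are compared.
  abstract
    ι-cauchy : ∀ q → IsCauchy (λ _ → q)
    ι-cauchy q = null-ext (λ _ _ → sym (ℚₚ.+-inverseʳ q)) null-0

    +-cauchy : ∀ x y → IsCauchy (λ n → seq x n + seq y n)
    +-cauchy x y = null-ext (λ m n → +-interchange (seq x m) (seq x n) (seq y m) (seq y n))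
      (null-+ (cauchy x) (cauchy y))

    neg-cauchy : ∀ x → IsCauchy (λ n → - seq x n)
    neg-cauchy x = null-ext (λ m n → difference-of-negs (seq x m) (seq x n)) (null-neg (cauchy x))

    *-cauchy : ∀ x y → IsCauchy (λ n → seq x n * seq y n)
    *-cauchy x y = null-ext (λ m n → product-difference (seq x m) (seq x n) (seq y m) (seq y n))
      (null-+ (null-* (bounded₁ x) (cauchy y)) (null-* (bounded₂ y) (cauchy x)))

  ι : ℚ → Carrier
  ι q = mkCauchy (λ _ → q) (ι-cauchy q)

  infixl 6 _+ᶜ_
  infixl 7 _*ᶜ_
  infix  8 -ᶜ_

  _+ᶜ_ : Carrier → Carrier → Carrier
  x +ᶜ y = mkCauchy (λ n → seq x n + seq y n) (+-cauchy x y)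

  -ᶜ_ : Carrier → Carrier
  -ᶜ x = mkCauchy (λ n → - seq x n) (neg-cauchy x)

  _*ᶜ_ : Carrier → Carrier → Carrier
  x *ᶜ y = mkCauchy (λ n → seq x n * seq y n) (*-cauchy x y)

  ≈-isEquivalence : IsEquivalence _≈_
  ≈-isEquivalence = record
    { refl  = λ {x} → pointwise (λ _ → refl)
    ; sym   = λ {x} {y} x≈y → to-≈ (null-ext
        (λ m _ → neg-difference (seq x m) (seq y m))
        (null-neg (from-≈ x≈y)))
    ; trans = λ {x} {y} {z} x≈y y≈z → to-≈ (null-ext
        (λ m _ → difference-trans (seq x m) (seq y m) (seq z m))
        (null-+ (from-≈ x≈y) (from-≈ y≈z)))
    }

  +-cong : ∀ {x x′ y y′} → x ≈ x′ → y ≈ y′ → x +ᶜ y ≈ x′ +ᶜ y′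
  +-cong {x} {x′} {y} {y′} x≈x′ y≈y′ = to-≈ (null-ext
    (λ m _ → +-interchange
      (seq x m) (seq x′ m) (seq y m) (seq y′ m))
    (null-+ (from-≈ x≈x′) (from-≈ y≈y′)))

  neg-cong : ∀ {x y} → x ≈ y → -ᶜ x ≈ -ᶜ y
  neg-cong {x} {y} x≈y = to-≈ (null-ext
    (λ m _ → difference-of-negs (seq x m) (seq y m))
    (null-neg (from-≈ x≈y)))

  *-cong : ∀ {x x′ y y′} → x ≈ x′ → y ≈ y′ → x *ᶜ y ≈ x′ *ᶜ y′
  *-cong {x} {x′} {y} {y′} x≈x′ y≈y′ = to-≈ (null-ext
    (λ m _ → product-difference
      (seq x m) (seq x′ m) (seq y m) (seq y′ m))
    (null-+ (null-* (bounded₁ x) (from-≈ y≈y′))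
            (null-* (bounded₁ y′) (from-≈ x≈x′))))

  commutativeRing : CommutativeRing 0ℓ 0ℓ
  commutativeRing = record
    { Carrier = Carrier
    ; _≈_     = _≈_
    ; _+_     = _+ᶜ_
    ; _*_     = _*ᶜ_
    ; -_      = -ᶜ_
    ; 0#      = ι 0ℚ
    ; 1#      = ι 1ℚ
    ; isCommutativeRing = record
      { isRing = record
        { +-isAbelianGroup = record
          { isGroup = record
            { isMonoid = record
              { isSemigroup = record
                { isMagma = record
                  { isEquivalence = ≈-isEquivalence
                  ; ∙-cong = λ {x} {x′} {y} {y′} → +-cong {x} {x′} {y} {y′}
                  }
                ; assoc = λ x y z → pointwise
                            (λ n → ℚₚ.+-assoc (seq x n) (seq y n) (seq z n))
                }
              ; identity = (λ x → pointwise (λ n → ℚₚ.+-identityˡ (seq x n)))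
                         , (λ x → pointwise (λ n → ℚₚ.+-identityʳ (seq x n)))
              }
            ; inverse = (λ x → pointwise (λ n → ℚₚ.+-inverseˡ (seq x n)))
                      , (λ x → pointwise (λ n → ℚₚ.+-inverseʳ (seq x n)))
            ; ⁻¹-cong = λ {x} {y} → neg-cong {x} {y}
            }
          ; comm = λ x y → pointwise (λ n → ℚₚ.+-comm (seq x n) (seq y n))
          }
        ; *-cong = λ {x} {x′} {y} {y′} → *-cong {x} {x′} {y} {y′}
        ; *-assoc = λ x y z → pointwise
                      (λ n → ℚₚ.*-assoc (seq x n) (seq y n) (seq z n))
        ; *-identity = (λ x → pointwise (λ n → ℚₚ.*-identityˡ (seq x n)))
                     , (λ x → pointwise (λ n → ℚₚ.*-identityʳ (seq x n)))
        ; distrib = (λ x y z → pointwise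
                      (λ n → ℚₚ.*-distribˡ-+ (seq x n) (seq y n) (seq z n)))
                  , (λ x y z → pointwise
                      (λ n → ℚₚ.*-distribʳ-+ (seq x n) (seq y n) (seq z n)))
        }
      ; *-comm = λ x y → pointwise (λ n → ℚₚ.*-comm (seq x n) (seq y n))
      }
    }

  ι-* : ∀ q r → ι (q * r) ≈ ι q *ᶜ ι r
  ι-* q r = pointwise (λ _ → refl)

  ι-cong : ∀ {q r} → q ≡ r → ι q ≈ ι r
  ι-cong {q} {r} q≡r = pointwise (λ _ → q≡r)

module Units (R : CommutativeRing 0ℓ 0ℓ) where

  open CommutativeRing R
    renaming (_*_ to _·_; _+_ to _⊕_; -_ to ⊖_; _-_ to _⊖₂_; refl to ≈-refl; sym to ≈-sym; trans to ≈-trans)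

  record Unit : Set where
    constructor mkUnit
    field
      val         : Carrier
      inv         : Carrier
      val·inv≈1   : val · inv ≈ 1#

  open Unit public

  infix 4 _≈ᵘ_

  record _≈ᵘ_ (u w : Unit) : Set where
    constructor mk≈ᵘ
    field
      val-≈ : val u ≈ val w

  open _≈ᵘ_ public

  open CommutativeSemigroupProperties *-commutativeSemigroup using (interchange)
  open import Relation.Binary.Reasoning.Setoid setoid

  private
    _⊙_ : Unit → Unit → Unit
    u ⊙ w = mkUnit (val u · val w) (inv u · inv w)
      (≈-trans (interchange (val u) (val w) (inv u) (inv w))
        (≈-trans (*-cong (val·inv≈1 u) (val·inv≈1 w)) (*-identityˡ 1#)))

    1ᵘ : Unit
    1ᵘ = mkUnit 1# 1# (*-identityˡ 1#)

    _⁻¹ᵘ : Unit → Unit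
    u ⁻¹ᵘ = mkUnit (inv u) (val u) (≈-trans (*-comm (inv u) (val u)) (val·inv≈1 u))

  inv-cong : ∀ {u w} → u ≈ᵘ w → inv u ≈ inv w
  inv-cong {u} {w} (mk≈ᵘ u≈w) = begin
    inv u                    ≈⟨ *-identityʳ (inv u) ⟨
    inv u · 1#               ≈⟨ *-congˡ (val·inv≈1 w) ⟨
    inv u · (val w · inv w)  ≈⟨ *-assoc (inv u) (val w) (inv w) ⟨
    inv u · val w · inv w    ≈⟨ *-congʳ (*-congˡ u≈w) ⟨
    inv u · val u · inv w    ≈⟨ *-congʳ (≈-trans (*-comm (inv u) (val u)) (val·inv≈1 u)) ⟩
    1# · inv w               ≈⟨ *-identityˡ (inv w) ⟩
    inv w                    ∎

  abelianGroup : AbelianGroup 0ℓ 0ℓ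
  abelianGroup = record
    { Carrier = Unit
    ; _≈_     = _≈ᵘ_
    ; _∙_     = _⊙_
    ; ε       = 1ᵘ
    ; _⁻¹     = _⁻¹ᵘ
    ; isAbelianGroup = record
      { isGroup = record
        { isMonoid = record
          { isSemigroup = record
            { isMagma = record
              { isEquivalence = record
                { refl  = mk≈ᵘ ≈-refl
                ; sym   = λ e → mk≈ᵘ (≈-sym (val-≈ e))
                ; trans = λ e f → mk≈ᵘ (≈-trans (val-≈ e) (val-≈ f))
                }
              ; ∙-cong = λ e f → mk≈ᵘ (*-cong (val-≈ e) (val-≈ f))
              }
            ; assoc = λ u v w → mk≈ᵘ (*-assoc (val u) (val v) (val w))
            }
          ; identity = (λ u → mk≈ᵘ (*-identityˡ (val u))) , (λ u → mk≈ᵘ (*-identityʳ (val u)))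
          }
        ; inverse = (λ u → mk≈ᵘ (≈-trans (*-comm (inv u) (val u)) (val·inv≈1 u)))
                  , (λ u → mk≈ᵘ (val·inv≈1 u))
        ; ⁻¹-cong = λ e → mk≈ᵘ (inv-cong e)
        }
      ; comm = λ u w → mk≈ᵘ (*-comm (val u) (val w))
      }
    }

module Cokernel (H : Group 0ℓ 0ℓ) (G : AbelianGroup 0ℓ 0ℓ) (φ : Group.Carrier H → AbelianGroup.Carrier G)
                (φ-hom : IsGroupHomomorphism (Group.rawGroup H) (AbelianGroup.rawGroup G) φ) where

  private
    module H = Group H
    module φ = IsGroupHomomorphism φ-hom
  open AbelianGroup G
    renaming (refl to ≈-refl; sym to ≈-sym; trans to ≈-trans)
  open AbelianGroupProperties G using (⁻¹-∙-comm)

  infix 4 _∼_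

  record _∼_ (x y : Carrier) : Set where
    constructor mk∼
    field
      shift   : H.Carrier
      x≈shift : x ≈ φ shift ∙ y

  open _∼_ public

  open CommutativeSemigroupProperties commutativeSemigroup using (interchange)
  open import Relation.Binary.Reasoning.Setoid setoid

  ≈⇒∼ : _≈_ ⇒ _∼_
  ≈⇒∼ {x} {y} x≈y = mk∼ H.ε (begin
    x          ≈⟨ x≈y ⟩
    y          ≈⟨ identityˡ y ⟨
    ε ∙ y      ≈⟨ ∙-congʳ φ.ε-homo ⟨
    φ H.ε ∙ y  ∎)

  ∼-isEquivalence : IsEquivalence _∼_
  ∼-isEquivalence = record
    { refl  = ≈⇒∼ ≈-refl
    ; sym   = λ { {x} {y} (mk∼ h x≈) → mk∼ (h H.⁻¹) (begin
        y                        ≈⟨ identityˡ y ⟨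
        ε ∙ y                    ≈⟨ ∙-congʳ (inverseˡ (φ h)) ⟨
        φ h ⁻¹ ∙ φ h ∙ y         ≈⟨ assoc (φ h ⁻¹) (φ h) y ⟩
        φ h ⁻¹ ∙ (φ h ∙ y)       ≈⟨ ∙-cong (φ.⁻¹-homo h) x≈ ⟨
        φ (h H.⁻¹) ∙ x           ∎) }
    ; trans = λ { {x} {y} {z} (mk∼ h x≈) (mk∼ k y≈) → mk∼ (h H.∙ k) (begin
        x                        ≈⟨ x≈ ⟩
        φ h ∙ y                  ≈⟨ ∙-congˡ y≈ ⟩
        φ h ∙ (φ k ∙ z)          ≈⟨ assoc (φ h) (φ k) z ⟨
        φ h ∙ φ k ∙ z            ≈⟨ ∙-congʳ (φ.homo h k) ⟨
        φ (h H.∙ k) ∙ z          ∎) }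
    }

  abelianGroup : AbelianGroup 0ℓ 0ℓ
  abelianGroup = record
    { Carrier = Carrier
    ; _≈_     = _∼_
    ; _∙_     = _∙_
    ; ε       = ε
    ; _⁻¹     = _⁻¹
    ; isAbelianGroup = record
      { isGroup = record
        { isMonoid = record
          { isSemigroup = record
            { isMagma = record
              { isEquivalence = ∼-isEquivalence
              ; ∙-cong = λ { {x} {y} {u} {v} (mk∼ h x≈) (mk∼ k u≈) → mk∼ (h H.∙ k) (begin
                  x ∙ u                  ≈⟨ ∙-cong x≈ u≈ ⟩
                  φ h ∙ y ∙ (φ k ∙ v)    ≈⟨ interchange (φ h) y (φ k) v ⟩
                  φ h ∙ φ k ∙ (y ∙ v)    ≈⟨ ∙-congʳ (φ.homo h k) ⟨
                  φ (h H.∙ k) ∙ (y ∙ v)  ∎) }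
              }
            ; assoc = λ x y z → ≈⇒∼ (assoc x y z)
            }
          ; identity = (λ x → ≈⇒∼ (identityˡ x)) , (λ x → ≈⇒∼ (identityʳ x))
          }
        ; inverse = (λ x → ≈⇒∼ (inverseˡ x)) , (λ x → ≈⇒∼ (inverseʳ x))
        ; ⁻¹-cong = λ { {x} {y} (mk∼ h x≈) → mk∼ (h H.⁻¹) (begin
            x ⁻¹                   ≈⟨ ⁻¹-cong x≈ ⟩
            (φ h ∙ y) ⁻¹           ≈⟨ ⁻¹-∙-comm (φ h) y ⟨
            φ h ⁻¹ ∙ y ⁻¹          ≈⟨ ∙-congʳ (φ.⁻¹-homo h) ⟨
            φ (h H.⁻¹) ∙ y ⁻¹      ∎) }
        }
      ; comm = λ x y → ≈⇒∼ (comm x y)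
      }
    }

record Topology (S : Setoid 0ℓ 0ℓ) (o : Level) : Set (lsuc 0ℓ ⊔ˡ lsuc o) where
  open Setoid S using (Carrier; _≈_)
  field
    Open          : Pred Carrier 0ℓ → Set o
    open-respects : ∀ {U} → Open U → U Respects _≈_
    open-ext      : ∀ {U V} → U ≐ V → Open U → Open V
    whole-open    : Open (λ _ → ⊤)
    ∩-open        : ∀ {U V} → Open U → Open V → Open (λ x → U x × V x)
    ⋃-open        : ∀ {I : Set} (U : I → Pred Carrier 0ℓ) → (∀ i → Open (U i)) →
                    Open (λ x → ∃ λ i → U i x)

open Topology public

private
  variable
    o o′ : Level
    S S′ : Setoid 0ℓ 0ℓ

record Continuous (T : Topology S o) (T′ : Topology S′ o′)
                  (f : Setoid.Carrier S → Setoid.Carrier S′) : Set (lsuc 0ℓ ⊔ˡ o ⊔ˡ o′) where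
  field
    congruent     : Congruent (Setoid._≈_ S) (Setoid._≈_ S′) f
    preimage-open : ∀ {U} → Open T′ U → Open T (U ∘ f)

inducedTopology : (f : Setoid.Carrier S → Setoid.Carrier S′) →
                  Congruent (Setoid._≈_ S) (Setoid._≈_ S′) f →
                  Topology S′ o → Topology S (lsuc 0ℓ ⊔ˡ o)
inducedTopology f f-cong T = record
  { Open          = λ U → ∃ λ V → Open T V × U ≐ V ∘ f
  ; open-respects = λ { (V , V-open , U⊆V , V⊆U) x≈y Ux → V⊆U (open-respects T V-open (f-cong x≈y) (U⊆V Ux)) }
  ; open-ext      = λ { (U⊆W , W⊆U) (V , V-open , U⊆V , V⊆U) → V , V-open , U⊆V ∘ W⊆U , U⊆W ∘ V⊆U }
  ; whole-open    = (λ _ → ⊤) , whole-open T , id , id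
  ; ∩-open        = λ { (V , V-open , U⊆V , V⊆U) (V′ , V′-open , U′⊆V′ , V′⊆U′) →
                        (λ y → V y × V′ y) , ∩-open T V-open V′-open
                        , (λ (u , u′) → U⊆V u , U′⊆V′ u′) , (λ (v , v′) → V⊆U v , V′⊆U′ v′) }
  ; ⋃-open        = λ U U-open → (λ y → ∃ λ i → proj₁ (U-open i) y)
                    , ⋃-open T (λ i → proj₁ (U-open i)) (λ i → proj₁ (proj₂ (U-open i)))
                    , (λ (i , u) → i , proj₁ (proj₂ (proj₂ (U-open i))) u)
                    , (λ (i , v) → i , proj₂ (proj₂ (proj₂ (U-open i))) v)
  }

-- The quotient map is the identity on carriers.
quotientTopology : (T : Topology S o) {_∼_ : Rel (Setoid.Carrier S) 0ℓ} (∼-isEquivalence : IsEquivalence _∼_) →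
                   Topology (record { isEquivalence = ∼-isEquivalence }) o
quotientTopology T {_∼_} _ = record
  { Open          = λ U → U Respects _∼_ × Open T U
  ; open-respects = proj₁
  ; open-ext      = λ { U≐V@(U⊆V , V⊆U) (U-resp , U-open) →
                        (λ x∼y → U⊆V ∘ U-resp x∼y ∘ V⊆U) , open-ext T U≐V U-open }
  ; whole-open    = (λ _ → id) , whole-open T
  ; ∩-open        = λ (U-resp , U-open) (V-resp , V-open) →
                      (λ x∼y (u , v) → U-resp x∼y u , V-resp x∼y v) , ∩-open T U-open V-open
  ; ⋃-open        = λ U U-open → (λ x∼y (i , u) → i , proj₁ (U-open i) x∼y u)
                      , ⋃-open T U (proj₂ ∘ U-open)
  }

infixr 2 _×ᵗ_

_×ᵗ_ : Topology S o → Topology S′ o′ → Topology (×-setoid S S′) (lsuc 0ℓ ⊔ˡ o ⊔ˡ o′)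
_×ᵗ_ {S = S} {o = o} {S′ = S′} {o′ = o′} T T′ = record
  { Open          = OpenRectangles
  ; open-respects = λ W-open (x≈x′ , y≈y′) w →
                      let U , V , U-open , V-open , u , v , UV⊆W = W-open w
                      in UV⊆W (open-respects T U-open x≈x′ u) (open-respects T′ V-open y≈y′ v)
  ; open-ext      = λ (W⊆W′ , W′⊆W) W-open w →
                      let U , V , U-open , V-open , u , v , UV⊆W = W-open (W′⊆W w)
                      in U , V , U-open , V-open , u , v , λ u v → W⊆W′ (UV⊆W u v)
  ; whole-open    = λ _ → (λ _ → ⊤) , (λ _ → ⊤) , whole-open T , whole-open T′ , tt , tt , λ _ _ → tt
  ; ∩-open        = λ W-open W′-open (w , w′) →
                      let U , V , U-open , V-open , u , v , UV⊆W = W-open w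
                          U′ , V′ , U′-open , V′-open , u′ , v′ , UV′⊆W′ = W′-open w′
                      in (λ x → U x × U′ x) , (λ y → V y × V′ y)
                         , ∩-open T U-open U′-open , ∩-open T′ V-open V′-open , (u , u′) , (v , v′)
                         , λ (u , u′) (v , v′) → UV⊆W u v , UV′⊆W′ u′ v′
  ; ⋃-open        = λ W W-open (i , w) →
                      let U , V , U-open , V-open , u , v , UV⊆W = W-open i w
                      in U , V , U-open , V-open , u , v , λ u v → i , UV⊆W u v
  }
  where
  OpenRectangles : Pred (Setoid.Carrier S × Setoid.Carrier S′) 0ℓ → Set (lsuc 0ℓ ⊔ˡ o ⊔ˡ o′)
  OpenRectangles W = ∀ {x y} → W (x , y) →
    ∃₂ λ U V → Open T U × Open T′ V × U x × V y × (∀ {x y} → U x → V y → W (x , y))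

record IsTopologicalGroup (G : Group 0ℓ 0ℓ) (T : Topology (Group.setoid G) o) : Set (lsuc 0ℓ ⊔ˡ o) where
  open Group G
  field
    ∙-continuous  : Continuous (T ×ᵗ T) T (uncurry _∙_)
    ⁻¹-continuous : Continuous T T _⁻¹

record TopologicalGroupIsomorphism
         (G : Group 0ℓ 0ℓ) (T : Topology (Group.setoid G) o)
         (H : Group 0ℓ 0ℓ) (T′ : Topology (Group.setoid H) o′) : Set (lsuc 0ℓ ⊔ˡ o ⊔ˡ o′) where
  private
    module G = Group G
    module H = Group H
  field
    to                 : G.Carrier → H.Carrier
    from               : H.Carrier → G.Carrier
    isGroupIsomorphism : IsGroupIsomorphism G.rawGroup H.rawGroup to
    inverse            : Inverseᵇ G._≈_ H._≈_ to from
    to-continuous      : Continuous T T′ to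
    from-continuous    : Continuous T′ T from

-- The primality proof is irrelevant, so that a prime number determines a
-- single place.
record FinitePlace : Set where
  constructor place
  field
    prime-number : ℕ
    .isPrime     : Prime prime-number

open FinitePlace using (prime-number)

prime-place : (v : FinitePlace) → Prime (prime-number v)
prime-place (place p p-prime) = recompute (prime? p) p-prime

data Place : Set where
  ∞      : Place
  finite : FinitePlace → Place

infix 4 _≟ᶠ_ _≟ᵖ_

_≟ᶠ_ : (v w : FinitePlace) → Dec (v ≡ w)
place p _ ≟ᶠ place q _ with p ℕ.≟ q
... | yes refl = yes refl
... | no  p≢q  = no λ { refl → p≢q refl }

_≟ᵖ_ : (v w : Place) → Dec (v ≡ w)
∞        ≟ᵖ ∞        = yes refl
∞        ≟ᵖ finite _ = no λ ()
finite _ ≟ᵖ ∞        = no λ ()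
finite v ≟ᵖ finite w with v ≟ᶠ w
... | yes refl = yes refl
... | no  v≢w  = no λ { refl → v≢w refl }

absoluteValue : Place → AbsoluteValue
absoluteValue ∞          = archimedean
absoluteValue (finite v) = PAdicProperties.absoluteValue (prime-number v) (prime-place v)

localField : Place → CommutativeRing 0ℓ 0ℓ
localField w = Completion.commutativeRing (absoluteValue w)

module K (w : Place) where
  open Completion (absoluteValue w) public using (seq; ι; ι-*; ι-cong; ∥_∥<_; mk≈)
  open CommutativeRing (localField w) public

  term : Carrier → ℕ → ℚ
  term = seq

-- 𝒪 v is the ring of v-adic integers, as a subset of the v-adic field.
-- By the ultrametric inequality |x| ≤ 1 holds iff it holds for the terms of a
-- tail of any Cauchy sequence representing x.
record 𝒪 (v : FinitePlace) (x : K.Carrier (finite v)) : Set where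
  constructor mk𝒪
  open AbsoluteValue (absoluteValue (finite v)) using (∥_∥)
  field
    ∥x∥≤1 : ∃ λ N → ∀ n → N ℕ.≤ n → ∥ K.term (finite v) x n ∥ ≤ 1ℚ

𝒪ˣ : (v : FinitePlace) → Pred (K.Carrier (finite v)) 0ℓ
𝒪ˣ v x = 𝒪 v x × ∃ λ y → 𝒪 v y × x · y ≈ 1#
  where open K (finite v) using (_≈_; 1#) renaming (_*_ to _·_)

module 𝒪-properties (v : FinitePlace) where
  open AbsoluteValue (absoluteValue (finite v))
  open PAdicProperties (prime-number v) (prime-place v) using (ultrametric)
  private
    module Kᵥ = K (finite v)

  ι∈𝒪 : ∀ {q} → ∥ q ∥ ≤ 1ℚ → 𝒪 v (Kᵥ.ι q)
  ι∈𝒪 ∥q∥≤1 = mk𝒪 (0 , λ _ _ → ∥q∥≤1)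

  0∈𝒪 : 𝒪 v Kᵥ.0#
  0∈𝒪 = ι∈𝒪 (ℚₚ.≤-trans (ℚₚ.≤-reflexive ∥0∥≡0) (ℚₚ.nonNegative⁻¹ 1ℚ))

  1∈𝒪 : 𝒪 v Kᵥ.1#
  1∈𝒪 = ι∈𝒪 (PAdicProperties.∥x∥≤1 (prime-number v) (prime-place v) 1ℚ p∤1)
    where
    p∤1 : prime-number v ∤ 1
    p∤1 p∣1 = ℕₚ.<⇒≱ (ℕ.nonTrivial⇒n>1 _ {{prime⇒nonTrivial (prime-place v)}}) (∣⇒≤ p∣1)

  +-closed : ∀ {x y} → 𝒪 v x → 𝒪 v y → 𝒪 v (x Kᵥ.+ y)
  +-closed {x} {y} (mk𝒪 (M , x≤1)) (mk𝒪 (N , y≤1)) = mk𝒪 (M ℕ.⊔ N , λ n ≤n →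
    ℚₚ.≤-trans (ultrametric (Kᵥ.term x n) (Kᵥ.term y n))
      (ℚₚ.⊔-lub (x≤1 n (ℕₚ.≤-trans (ℕₚ.m≤m⊔n M N) ≤n)) (y≤1 n (ℕₚ.≤-trans (ℕₚ.m≤n⊔m M N) ≤n))))

  neg-closed : ∀ {x} → 𝒪 v x → 𝒪 v (Kᵥ.- x)
  neg-closed {x} (mk𝒪 (N , x≤1)) = mk𝒪 (N , λ n ≤n →
    ℚₚ.≤-trans (ℚₚ.≤-reflexive (∥-x∥≡∥x∥ (Kᵥ.term x n))) (x≤1 n ≤n))

  *-closed : ∀ {x y} → 𝒪 v x → 𝒪 v y → 𝒪 v (x Kᵥ.* y)
  *-closed {x} {y} (mk𝒪 (M , x≤1)) (mk𝒪 (N , y≤1)) = mk𝒪 (M ℕ.⊔ N , λ n ≤n → begin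
    ∥ Kᵥ.term x n * Kᵥ.term y n ∥      ≡⟨ ∥xy∥≡∥x∥∥y∥ (Kᵥ.term x n) (Kᵥ.term y n) ⟩
    ∥ Kᵥ.term x n ∥ * ∥ Kᵥ.term y n ∥  ≤⟨ ℚₚ.*-monoʳ-≤-nonNeg ∥ Kᵥ.term y n ∥ {{ℚ.nonNegative (nonNeg (Kᵥ.term y n))}}
                                          (x≤1 n (ℕₚ.≤-trans (ℕₚ.m≤m⊔n M N) ≤n)) ⟩
    1ℚ * ∥ Kᵥ.term y n ∥              ≡⟨ ℚₚ.*-identityˡ ∥ Kᵥ.term y n ∥ ⟩
    ∥ Kᵥ.term y n ∥                   ≤⟨ y≤1 n (ℕₚ.≤-trans (ℕₚ.m≤n⊔m M N) ≤n) ⟩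
    1ℚ                               ∎)
    where open ℚₚ.≤-Reasoning

AlmostIntegral : Pred ((w : Place) → K.Carrier w) 0ℓ
AlmostIntegral a = ∃ λ (S : List FinitePlace) → ∀ v → v ∉ S → 𝒪 v (a (finite v))

record Adele : Set where
  constructor mkAdele
  infixl 9 _at_
  field
    _at_            : (w : Place) → K.Carrier w
    almost-integral : AlmostIntegral _at_

open Adele public

infix 4 _≈ᴬ_

record _≈ᴬ_ (a b : Adele) : Set where
  constructor mk≈ᴬ
  field
    at-≈ : ∀ w → K._≈_ w (a at w) (b at w)

open _≈ᴬ_ public

private
  abstract
    integral-everywhere : ∀ a → (∀ v → 𝒪 v (a (finite v))) → AlmostIntegral a
    integral-everywhere a a∈𝒪 = [] , λ v _ → a∈𝒪 v

    +-almost-integral : ∀ a b → AlmostIntegral (λ w → K._+_ w (a at w) (b at w))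
    +-almost-integral (mkAdele a (S , a∈𝒪)) (mkAdele b (T , b∈𝒪)) = S ++ T , λ v v∉ →
      𝒪-properties.+-closed v (a∈𝒪 v (v∉ ∘ ∈-++⁺ˡ)) (b∈𝒪 v (v∉ ∘ ∈-++⁺ʳ S))

    neg-almost-integral : ∀ a → AlmostIntegral (λ w → K.-_ w (a at w))
    neg-almost-integral (mkAdele a (S , a∈𝒪)) = S , λ v v∉ → 𝒪-properties.neg-closed v (a∈𝒪 v v∉)

    *-almost-integral : ∀ a b → AlmostIntegral (λ w → K._*_ w (a at w) (b at w))
    *-almost-integral (mkAdele a (S , a∈𝒪)) (mkAdele b (T , b∈𝒪)) = S ++ T , λ v v∉ →
      𝒪-properties.*-closed v (a∈𝒪 v (v∉ ∘ ∈-++⁺ˡ)) (b∈𝒪 v (v∉ ∘ ∈-++⁺ʳ S))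

infixl 6 _+ᴬ_
infixl 7 _*ᴬ_
infix  8 -ᴬ_

_+ᴬ_ _*ᴬ_ : Adele → Adele → Adele
a +ᴬ b = mkAdele (λ w → K._+_ w (a at w) (b at w)) (+-almost-integral a b)
a *ᴬ b = mkAdele (λ w → K._*_ w (a at w) (b at w)) (*-almost-integral a b)

-ᴬ_ : Adele → Adele
-ᴬ a = mkAdele (λ w → K.-_ w (a at w)) (neg-almost-integral a)

0ᴬ 1ᴬ : Adele
0ᴬ = mkAdele K.0# (integral-everywhere K.0# 𝒪-properties.0∈𝒪)
1ᴬ = mkAdele K.1# (integral-everywhere K.1# 𝒪-properties.1∈𝒪)

adeleRing : CommutativeRing 0ℓ 0ℓ
adeleRing = record
  { Carrier = Adele
  ; _≈_     = _≈ᴬ_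
  ; _+_     = _+ᴬ_
  ; _*_     = _*ᴬ_
  ; -_      = -ᴬ_
  ; 0#      = 0ᴬ
  ; 1#      = 1ᴬ
  ; isCommutativeRing = record
    { isRing = record
      { +-isAbelianGroup = record
        { isGroup = record
          { isMonoid = record
            { isSemigroup = record
              { isMagma = record
                { isEquivalence = record
                  { refl  = mk≈ᴬ λ w → K.refl w
                  ; sym   = λ e → mk≈ᴬ λ w → K.sym w (at-≈ e w)
                  ; trans = λ e f → mk≈ᴬ λ w → K.trans w (at-≈ e w) (at-≈ f w)
                  }
                ; ∙-cong = λ e f → mk≈ᴬ λ w → K.+-cong w (at-≈ e w) (at-≈ f w)
                }
              ; assoc = λ a b c → mk≈ᴬ λ w → K.+-assoc w (a at w) (b at w) (c at w)
              }
            ; identity = (λ a → mk≈ᴬ λ w → K.+-identityˡ w (a at w))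
                       , (λ a → mk≈ᴬ λ w → K.+-identityʳ w (a at w))
            }
          ; inverse = (λ a → mk≈ᴬ λ w → K.-‿inverseˡ w (a at w))
                    , (λ a → mk≈ᴬ λ w → K.-‿inverseʳ w (a at w))
          ; ⁻¹-cong = λ e → mk≈ᴬ λ w → K.-‿cong w (at-≈ e w)
          }
        ; comm = λ a b → mk≈ᴬ λ w → K.+-comm w (a at w) (b at w)
        }
      ; *-cong     = λ e f → mk≈ᴬ λ w → K.*-cong w (at-≈ e w) (at-≈ f w)
      ; *-assoc    = λ a b c → mk≈ᴬ λ w → K.*-assoc w (a at w) (b at w) (c at w)
      ; *-identity = (λ a → mk≈ᴬ λ w → K.*-identityˡ w (a at w))
                   , (λ a → mk≈ᴬ λ w → K.*-identityʳ w (a at w))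
      ; distrib    = (λ a b c → mk≈ᴬ λ w → K.distribˡ w (a at w) (b at w) (c at w))
                   , (λ a b c → mk≈ᴬ λ w → K.distribʳ w (a at w) (b at w) (c at w))
      }
    ; *-comm = λ a b → mk≈ᴬ λ w → K.*-comm w (a at w) (b at w)
    }
  }

private
  module 𝔸 = CommutativeRing adeleRing

-- The basic neighbourhoods of a in the restricted product topology
record Box (S : List FinitePlace) (ε : ℚ) (a b : Adele) : Set where
  field
    near-∞  : K.∥_∥<_ ∞ (K._-_ ∞ (b at ∞) (a at ∞)) ε
    near-S  : ∀ v → v ∈ S → K.∥_∥<_ (finite v) (K._-_ (finite v) (b at finite v) (a at finite v)) ε
    outside : ∀ v → v ∉ S → 𝒪 v (K._-_ (finite v) (b at finite v) (a at finite v))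

module Adelic where
  open import Data.List.Membership.DecPropositional _≟ᶠ_ using (_∈?_)
  open Box

  IsOpen : Pred Adele 0ℓ → Set
  IsOpen U = ∀ {a} → U a → ∃₂ λ S ε → 0ℚ < ε × (∀ {b} → Box S ε a b → U b)

  ≈⇒small : ∀ w {x y : K.Carrier w} → K._≈_ w x y → ∀ {ε} → 0ℚ < ε → K.∥_∥<_ w (K._-_ w x y) ε
  ≈⇒small w (K.mk≈ x≈y) {ε} 0<ε =
    let δ , 0<δ , δ<ε = ℚₚ.<-dense 0<ε
        N , small     = x≈y δ 0<δ
    in δ , δ<ε , N , λ n ≤n → ℚₚ.<⇒≤ (small n ≤n)

  small⇒𝒪 : ∀ v {x} → K.∥_∥<_ (finite v) x 1ℚ → 𝒪 v x
  small⇒𝒪 v (δ , δ<1 , N , small) = mk𝒪 (N , λ n ≤n → ℚₚ.≤-trans (small n ≤n) (ℚₚ.<⇒≤ δ<1))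

  enlarge : ∀ w {x ε ε′} → ε ≤ ε′ → K.∥_∥<_ w x ε → K.∥_∥<_ w x ε′
  enlarge w ε≤ε′ (δ , δ<ε , rest) = δ , ℚₚ.<-≤-trans δ<ε ε≤ε′ , rest

  ≈⇒Box : ∀ {S ε a b} → 0ℚ < ε → a ≈ᴬ b → Box S ε b a
  ≈⇒Box {S} {ε} {a} {b} 0<ε a≈b = record
    { near-∞  = ≈⇒small ∞ {a at ∞} {b at ∞} (at-≈ a≈b ∞) 0<ε
    ; near-S  = λ v _ → ≈⇒small (finite v) {a at finite v} {b at finite v} (at-≈ a≈b (finite v)) 0<ε
    ; outside = λ v _ → small⇒𝒪 v {K._-_ (finite v) (a at finite v) (b at finite v)}
                  (≈⇒small (finite v) {a at finite v} {b at finite v} (at-≈ a≈b (finite v)) (ℚₚ.positive⁻¹ 1ℚ))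
    }

  shrink : ∀ {S S′ ε ε′ a b} → (∀ {v} → v ∈ S → v ∈ S′) → ε′ ≤ ε → ε′ ≤ 1ℚ →
           Box S′ ε′ a b → Box S ε a b
  shrink {S} {S′} {ε} {ε′} {a} {b} S⊆S′ ε′≤ε ε′≤1 box = record
    { near-∞  = enlarge ∞ {K._-_ ∞ (b at ∞) (a at ∞)} ε′≤ε (near-∞ box)
    ; near-S  = λ v v∈S → enlarge (finite v) {diff v} ε′≤ε (near-S box v (S⊆S′ v∈S))
    ; outside = λ v _ → out v (v ∈? S′)
    }
    where
    diff : ∀ v → K.Carrier (finite v)
    diff v = K._-_ (finite v) (b at finite v) (a at finite v)
    out : ∀ v → Dec (v ∈ S′) → 𝒪 v (diff v)
    out v (yes v∈S′) = small⇒𝒪 v {diff v} (enlarge (finite v) {diff v} ε′≤1 (near-S box v v∈S′))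
    out v (no  v∉S′) = outside box v v∉S′

  ⊓-pos : ∀ {x y} → 0ℚ < x → 0ℚ < y → 0ℚ < x ⊓ y
  ⊓-pos {x} {y} 0<x 0<y with ℚₚ.⊓-sel x y
  ... | inj₁ eq = subst (0ℚ <_) (sym eq) 0<x
  ... | inj₂ eq = subst (0ℚ <_) (sym eq) 0<y

  ∩-isOpen : ∀ {U V} → IsOpen U → IsOpen V → IsOpen (λ a → U a × V a)
  ∩-isOpen U-open V-open (u , v) =
    let S , ε , 0<ε , box⊆U = U-open u
        T , η , 0<η , box⊆V = V-open v
    in S ++ T , (ε ⊓ η) ⊓ 1ℚ , ⊓-pos (⊓-pos 0<ε 0<η) (ℚₚ.positive⁻¹ 1ℚ)
       , λ box → box⊆U (shrink ∈-++⁺ˡ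
                   (ℚₚ.≤-trans (ℚₚ.p⊓q≤p (ε ⊓ η) 1ℚ) (ℚₚ.p⊓q≤p ε η)) (ℚₚ.p⊓q≤q (ε ⊓ η) 1ℚ) box)
               , box⊆V (shrink (∈-++⁺ʳ S)
                   (ℚₚ.≤-trans (ℚₚ.p⊓q≤p (ε ⊓ η) 1ℚ) (ℚₚ.p⊓q≤q ε η)) (ℚₚ.p⊓q≤q (ε ⊓ η) 1ℚ) box)

𝔸-topology : Topology 𝔸.setoid 0ℓ
𝔸-topology = record
  { Open          = λ U → ∀ {a} → U a → ∃₂ λ S ε → 0ℚ < ε × (∀ {b} → Box S ε a b → U b)
  ; open-respects = λ U-open a≈b u → let _ , _ , 0<ε , box⊆U = U-open u
                                     in box⊆U (Adelic.≈⇒Box 0<ε (𝔸.sym a≈b))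
  ; open-ext      = λ (U⊆V , V⊆U) U-open v → let S , ε , 0<ε , box⊆U = U-open (V⊆U v)
                                             in S , ε , 0<ε , λ box → U⊆V (box⊆U box)
  ; whole-open    = λ _ → [] , 1ℚ , ℚₚ.positive⁻¹ 1ℚ , λ _ → tt
  ; ∩-open        = Adelic.∩-isOpen
  ; ⋃-open        = λ U U-open (i , u) → let S , ε , 0<ε , box⊆U = U-open i u
                                         in S , ε , 0<ε , λ box → i , box⊆U box
  }

module ℚˣ = Units ℚₚ.+-*-commutativeRing
module 𝔸ˣ = Units adeleRing

Idele : Set
Idele = 𝔸ˣ.Unit

private
  primes≤ : ℕ → List FinitePlace
  primes≤ zero    = []
  primes≤ (suc n) with prime? (suc n)
  ... | yes n-prime = place (suc n) n-prime ∷ primes≤ n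
  ... | no  _       = primes≤ n

  ∈-primes≤ : ∀ n v → prime-number v ℕ.≤ n → v ∈ primes≤ n
  ∈-primes≤ zero    v p≤n = contradiction (ℕₚ.n≤0⇒n≡0 p≤n) (ℕ.≢-nonZero⁻¹ _ {{prime⇒nonZero (prime-place v)}})
  ∈-primes≤ (suc n) v p≤n with prime? (suc n) | prime-number v ℕ.≟ suc n
  ... | yes _      | yes refl = here refl
  ... | yes _      | no  p≢n  = there (∈-primes≤ n v (ℕ.s≤s⁻¹ (ℕₚ.≤∧≢⇒< p≤n p≢n)))
  ... | no ¬n-prime | yes p≡n = contradiction (subst Prime p≡n (prime-place v)) ¬n-prime
  ... | no  _      | no  p≢n  = ∈-primes≤ n v (ℕ.s≤s⁻¹ (ℕₚ.≤∧≢⇒< p≤n p≢n))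

  abstract
    diagonal-almost-integral : ∀ q → AlmostIntegral (λ w → K.ι w q)
    diagonal-almost-integral q = primes≤ (↧ₙ q) , λ v v∉ →
      𝒪-properties.ι∈𝒪 v (PAdicProperties.∥x∥≤1 (prime-number v) (prime-place v) q
        (λ p∣d → v∉ (∈-primes≤ (↧ₙ q) v (∣⇒≤ p∣d))))

diagonal : ℚ → Adele
diagonal q = mkAdele (λ w → K.ι w q) (diagonal-almost-integral q)

private
  diagonal-* : ∀ q r → diagonal (q * r) ≈ᴬ diagonal q *ᴬ diagonal r
  diagonal-* q r = mk≈ᴬ λ w → K.ι-* w q r

  diagonal-cong : ∀ {q r} → q ≡ r → diagonal q ≈ᴬ diagonal r
  diagonal-cong q≡r = mk≈ᴬ λ w → K.ι-cong w q≡r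

  diagonal-1 : diagonal 1ℚ ≈ᴬ 1ᴬ
  diagonal-1 = mk≈ᴬ λ w → K.refl w

principal : ℚˣ.Unit → Idele
principal (ℚˣ.mkUnit q q⁻¹ qq⁻¹≡1) = 𝔸ˣ.mkUnit (diagonal q) (diagonal q⁻¹)
  (𝔸.trans (𝔸.sym (diagonal-* q q⁻¹)) (𝔸.trans (diagonal-cong qq⁻¹≡1) diagonal-1))

private
  principal-homomorphism : IsGroupHomomorphism (AbelianGroup.rawGroup ℚˣ.abelianGroup)
                                               (AbelianGroup.rawGroup 𝔸ˣ.abelianGroup) principal
  principal-homomorphism = record
    { isMonoidHomomorphism = record
      { isMagmaHomomorphism = record
        { isRelHomomorphism = record { cong = λ e → 𝔸ˣ.mk≈ᵘ (diagonal-cong (ℚˣ.val-≈ e)) }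
        ; homo              = λ q r → 𝔸ˣ.mk≈ᵘ (diagonal-* (ℚˣ.val q) (ℚˣ.val r))
        }
      ; ε-homo = 𝔸ˣ.mk≈ᵘ diagonal-1
      }
    ; ⁻¹-homo = λ _ → 𝔸ˣ.mk≈ᵘ 𝔸.refl
    }

module C = Cokernel (AbelianGroup.group ℚˣ.abelianGroup) 𝔸ˣ.abelianGroup principal principal-homomorphism

C-ℚ : AbelianGroup 0ℓ 0ℓ
C-ℚ = C.abelianGroup

-- 𝔸ˣ embeds in 𝔸 × 𝔸 by u ↦ (u , u⁻¹).
𝔸ˣ-topology : Topology (AbelianGroup.setoid 𝔸ˣ.abelianGroup) (lsuc 0ℓ)
𝔸ˣ-topology = inducedTopology (λ u → 𝔸ˣ.val u , 𝔸ˣ.inv u)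
                (λ e → 𝔸ˣ.val-≈ e , 𝔸ˣ.inv-cong e) (𝔸-topology ×ᵗ 𝔸-topology)

C-ℚ-topology : Topology (AbelianGroup.setoid C-ℚ) (lsuc 0ℓ)
C-ℚ-topology = quotientTopology 𝔸ˣ-topology C.∼-isEquivalence

infix 4 _∼ʸ_

record _∼ʸ_ (a b : Adele) : Set where
  constructor mk∼ʸ
  field
    factor   : ℚˣ.Unit
    a≈factor : a ≈ᴬ diagonal (ℚˣ.val factor) *ᴬ b

open _∼ʸ_ public

private
  ≈⇒∼ʸ : _≈ᴬ_ ⇒ _∼ʸ_
  ≈⇒∼ʸ {a} {b} a≈b = mk∼ʸ (AbelianGroup.ε ℚˣ.abelianGroup)
    (𝔸.trans a≈b (𝔸.sym (𝔸.trans (𝔸.*-congʳ diagonal-1) (𝔸.*-identityˡ b))))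

  diagonal-inverse : ∀ q b → diagonal (ℚˣ.inv q) *ᴬ (diagonal (ℚˣ.val q) *ᴬ b) ≈ᴬ b
  diagonal-inverse q b = begin
    diagonal (ℚˣ.inv q) *ᴬ (diagonal (ℚˣ.val q) *ᴬ b)  ≈⟨ 𝔸.*-assoc _ _ b ⟨
    diagonal (ℚˣ.inv q) *ᴬ diagonal (ℚˣ.val q) *ᴬ b    ≈⟨ 𝔸.*-congʳ (𝔸.*-comm _ _) ⟩
    diagonal (ℚˣ.val q) *ᴬ diagonal (ℚˣ.inv q) *ᴬ b    ≈⟨ 𝔸.*-congʳ (𝔸ˣ.val·inv≈1 (principal q)) ⟩
    1ᴬ *ᴬ b                                            ≈⟨ 𝔸.*-identityˡ b ⟩
    b                                                  ∎
    where open import Relation.Binary.Reasoning.Setoid 𝔸.setoid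

  diagonal-action : ∀ q r b → diagonal q *ᴬ (diagonal r *ᴬ b) ≈ᴬ diagonal (q * r) *ᴬ b
  diagonal-action q r b =
    𝔸.trans (𝔸.sym (𝔸.*-assoc (diagonal q) (diagonal r) b)) (𝔸.*-congʳ (𝔸.sym (diagonal-* q r)))

∼ʸ-isEquivalence : IsEquivalence _∼ʸ_
∼ʸ-isEquivalence = record
  { refl  = ≈⇒∼ʸ 𝔸.refl
  ; sym   = λ { {a} {b} (mk∼ʸ q a≈) → mk∼ʸ (q ⁻¹)
                (𝔸.sym (𝔸.trans (𝔸.*-congˡ a≈) (diagonal-inverse q b))) }
  ; trans = λ { {a} {b} {c} (mk∼ʸ q a≈) (mk∼ʸ r b≈) → mk∼ʸ (q ∙ r)
                (𝔸.trans a≈ (𝔸.trans (𝔸.*-congˡ b≈) (diagonal-action (ℚˣ.val q) (ℚˣ.val r) c))) }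
  }
  where open AbelianGroup ℚˣ.abelianGroup using (_∙_; _⁻¹)

Y-ℚ : Setoid 0ℓ 0ℓ
Y-ℚ = record { isEquivalence = ∼ʸ-isEquivalence }

Y-ℚ-topology : Topology Y-ℚ 0ℓ
Y-ℚ-topology = quotientTopology 𝔸-topology ∼ʸ-isEquivalence

-- `patch P x f` is x at the place P and f elsewhere.
patch : (P : Place) → K.Carrier P → (∀ w → w ≢ P → K.Carrier w) → ∀ w → K.Carrier w
patch P x f w with w ≟ᵖ P
... | yes refl = x
... | no  w≢P  = f w w≢P

module _ (p : FinitePlace) where

  private
    P : Place
    P = finite p
    module Kₚ = K P
    module Kₚˣ = Units (localField P)

  ℚₚˣ : AbelianGroup 0ℓ 0ℓ
  ℚₚˣ = Kₚˣ.abelianGroup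

  private
    abstract
      local-almost-integral : ∀ x → AlmostIntegral (patch P x (λ w _ → K.1# w))
      local-almost-integral x = p ∷ [] , away
        where
        away : ∀ v → v ∉ p ∷ [] → 𝒪 v (patch P x (λ w _ → K.1# w) (finite v))
        away v v∉ with finite v ≟ᵖ P
        ... | yes refl = contradiction (here refl) v∉
        ... | no  _    = 𝒪-properties.1∈𝒪 v

  local : Kₚ.Carrier → Adele
  local x = mkAdele (patch P x (λ w _ → K.1# w)) (local-almost-integral x)

  private
    local-* : ∀ x y → local (x Kₚ.* y) ≈ᴬ local x *ᴬ local y
    local-* x y = mk≈ᴬ go
      where
      go : ∀ w → K._≈_ w (local (x Kₚ.* y) at w) (K._*_ w (local x at w) (local y at w))
      go w with w ≟ᵖ P
      ... | yes refl = Kₚ.refl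
      ... | no  _    = K.sym w (K.*-identityˡ w (K.1# w))

    local-cong : ∀ {x y} → x Kₚ.≈ y → local x ≈ᴬ local y
    local-cong {x} {y} x≈y = mk≈ᴬ go
      where
      go : ∀ w → K._≈_ w (local x at w) (local y at w)
      go w with w ≟ᵖ P
      ... | yes refl = x≈y
      ... | no  _    = K.refl w

    local-1 : local Kₚ.1# ≈ᴬ 1ᴬ
    local-1 = mk≈ᴬ go
      where
      go : ∀ w → K._≈_ w (local Kₚ.1# at w) (K.1# w)
      go w with w ≟ᵖ P
      ... | yes refl = Kₚ.refl
      ... | no  _    = K.refl w

  ιₚ : Kₚˣ.Unit → Idele
  ιₚ (Kₚˣ.mkUnit x x⁻¹ xx⁻¹≈1) = 𝔸ˣ.mkUnit (local x) (local x⁻¹)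
    (𝔸.trans (𝔸.sym (local-* x x⁻¹)) (𝔸.trans (local-cong xx⁻¹≈1) local-1))

  private
    ιₚ-homomorphism : IsGroupHomomorphism (AbelianGroup.rawGroup ℚₚˣ) (AbelianGroup.rawGroup C-ℚ) ιₚ
    ιₚ-homomorphism = record
      { isMonoidHomomorphism = record
        { isMagmaHomomorphism = record
          { isRelHomomorphism = record { cong = λ e → C.≈⇒∼ (𝔸ˣ.mk≈ᵘ (local-cong (Kₚˣ.val-≈ e))) }
          ; homo              = λ x y → C.≈⇒∼ (𝔸ˣ.mk≈ᵘ (local-* (Kₚˣ.val x) (Kₚˣ.val y)))
          }
        ; ε-homo = C.≈⇒∼ (𝔸ˣ.mk≈ᵘ local-1)
        }
      ; ⁻¹-homo = λ _ → C.≈⇒∼ (𝔸ˣ.mk≈ᵘ 𝔸.refl)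
      }

  module C/ι = Cokernel (AbelianGroup.group ℚₚˣ) C-ℚ ιₚ ιₚ-homomorphism

  C-ℚ/ιₚ : Group 0ℓ 0ℓ
  C-ℚ/ιₚ = AbelianGroup.group C/ι.abelianGroup

  C-ℚ/ιₚ-topology : Topology (Group.setoid C-ℚ/ιₚ) (lsuc 0ℓ)
  C-ℚ/ιₚ-topology = quotientTopology C-ℚ-topology C/ι.∼-isEquivalence

-- ℝˣ at the infinite place, ℤ_vˣ at a finite place v
UnitAt : (w : Place) → Pred (K.Carrier w) 0ℓ
UnitAt ∞          x = ∃ λ y → x · y ≈ 1#
  where open K ∞ using (_≈_; 1#) renaming (_*_ to _·_)
UnitAt (finite v) x = 𝒪ˣ v x

private
  inverse-at : ∀ w {x} → UnitAt w x → K.Carrier w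
  inverse-at ∞          (y , _)         = y
  inverse-at (finite v) (_ , y , _ , _) = y

  inverse-at-correct : ∀ w {x} (x-unit : UnitAt w x) → K._≈_ w (K._*_ w x (inverse-at w x-unit)) (K.1# w)
  inverse-at-correct ∞          (_ , xy≈1)         = xy≈1
  inverse-at-correct (finite v) (_ , _ , _ , xy≈1) = xy≈1

  inverse-unit : ∀ w {x} (x-unit : UnitAt w x) → UnitAt w (inverse-at w x-unit)
  inverse-unit ∞          {x} (y , xy≈1)             = x , K.trans ∞ (K.*-comm ∞ y x) xy≈1
  inverse-unit (finite v) {x} (x∈𝒪 , y , y∈𝒪 , xy≈1) =
    y∈𝒪 , x , x∈𝒪 , K.trans (finite v) (K.*-comm (finite v) y x) xy≈1

  product-inverse : ∀ w {x y x′ y′} → K._≈_ w (K._*_ w x x′) (K.1# w) → K._≈_ w (K._*_ w y y′) (K.1# w) →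
                    K._≈_ w (K._*_ w (K._*_ w x y) (K._*_ w x′ y′)) (K.1# w)
  product-inverse w {x} {y} {x′} {y′} xx′≈1 yy′≈1 =
    K.trans w (interchange x y x′ y′) (K.trans w (K.*-cong w xx′≈1 yy′≈1) (K.*-identityˡ w (K.1# w)))
    where open CommutativeSemigroupProperties (K.*-commutativeSemigroup w) using (interchange)

  unit-* : ∀ w {x y} → UnitAt w x → UnitAt w y → UnitAt w (K._*_ w x y)
  unit-* ∞          (x′ , xx′≈1) (y′ , yy′≈1) = K._*_ ∞ x′ y′ , product-inverse ∞ xx′≈1 yy′≈1
  unit-* (finite v) (x∈𝒪 , x′ , x′∈𝒪 , xx′≈1) (y∈𝒪 , y′ , y′∈𝒪 , yy′≈1) =
    𝒪-properties.*-closed v x∈𝒪 y∈𝒪 , K._*_ (finite v) x′ y′ , 𝒪-properties.*-closed v x′∈𝒪 y′∈𝒪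
    , product-inverse (finite v) xx′≈1 yy′≈1

  1-unit : ∀ w → UnitAt w (K.1# w)
  1-unit ∞          = K.1# ∞ , K.*-identityˡ ∞ (K.1# ∞)
  1-unit (finite v) = 𝒪-properties.1∈𝒪 v , K.1# (finite v) , 𝒪-properties.1∈𝒪 v
                      , K.*-identityˡ (finite v) (K.1# (finite v))

module _ (p : FinitePlace) where

  private
    P : Place
    P = finite p

  record Normalized : Set where
    constructor mkNormalized
    field
      adele  : Adele
      zero-p : K._≈_ P (adele at P) (K.0# P)
      unit   : ∀ w → w ≢ P → UnitAt w (adele at w)

  open Normalized

  private
    unit⇒𝒪 : ∀ v {x} → UnitAt (finite v) x → 𝒪 v x
    unit⇒𝒪 v = proj₁

    module _ (f : ∀ w → w ≢ P → K.Carrier w) (f-unit : ∀ w (w≢P : w ≢ P) → UnitAt w (f w w≢P)) where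

      abstract
        extend-almost-integral : AlmostIntegral (patch P (K.0# P) f)
        extend-almost-integral = [] , λ v _ → integral v
          where
          integral : ∀ v → 𝒪 v (patch P (K.0# P) f (finite v))
          integral v with finite v ≟ᵖ P
          ... | yes refl = 𝒪-properties.0∈𝒪 v
          ... | no  v≢P  = unit⇒𝒪 v (f-unit (finite v) v≢P)

      extend : Normalized
      extend = record
        { adele  = mkAdele (patch P (K.0# P) f) extend-almost-integral
        ; zero-p = at-P
        ; unit   = off-P
        }
        where
        at-P : K._≈_ P (patch P (K.0# P) f P) (K.0# P)
        at-P with P ≟ᵖ P
        ... | yes refl = K.refl P
        ... | no  P≢P  = contradiction refl P≢P
        off-P : ∀ w → w ≢ P → UnitAt w (patch P (K.0# P) f w)
        off-P w w≢P with w ≟ᵖ P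
        ... | yes w≡P = contradiction w≡P w≢P
        ... | no  ne  = f-unit w ne

  𝐞-normalized : Normalized
  𝐞-normalized = extend (λ w _ → K.1# w) (λ w _ → 1-unit w)

  𝐞 : Adele
  𝐞 = adele 𝐞-normalized

  _∙ᶠ_ : Normalized → Normalized → Normalized
  a ∙ᶠ b = record
    { adele  = adele a *ᴬ adele b
    ; zero-p = K.trans P (K.*-congʳ P (zero-p a)) (K.zeroˡ P (adele b at P))
    ; unit   = λ w w≢P → unit-* w (unit a w w≢P) (unit b w w≢P)
    }

  _⁻¹ᶠ : Normalized → Normalized
  a ⁻¹ᶠ = extend (λ w w≢P → inverse-at w (unit a w w≢P)) (λ w w≢P → inverse-unit w (unit a w w≢P))

  infix 4 _≈ᶠ_

  -- Equality of classes in Y-ℚ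
  _≈ᶠ_ : Rel Normalized 0ℓ
  a ≈ᶠ b = adele a ∼ʸ adele b

  private
    𝐞-identityˡ : ∀ a → 𝐞 *ᴬ adele a ≈ᴬ adele a
    𝐞-identityˡ a = mk≈ᴬ go
      where
      go : ∀ w → K._≈_ w (K._*_ w (𝐞 at w) (adele a at w)) (adele a at w)
      go w with w ≟ᵖ P
      ... | yes refl = K.trans P (K.zeroˡ P (adele a at P)) (K.sym P (zero-p a))
      ... | no  _    = K.*-identityˡ w (adele a at w)

    𝐞-identityʳ : ∀ a → adele a *ᴬ 𝐞 ≈ᴬ adele a
    𝐞-identityʳ a = 𝔸.trans (𝔸.*-comm (adele a) 𝐞) (𝐞-identityˡ a)

    ⁻¹ᶠ-inverseʳ : ∀ a → adele a *ᴬ adele (a ⁻¹ᶠ) ≈ᴬ 𝐞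
    ⁻¹ᶠ-inverseʳ a = mk≈ᴬ go
      where
      go : ∀ w → K._≈_ w (K._*_ w (adele a at w) (adele (a ⁻¹ᶠ) at w)) (𝐞 at w)
      go w with w ≟ᵖ P
      ... | yes refl = K.zeroʳ P (adele a at P)
      ... | no  w≢P  = inverse-at-correct w (unit a w w≢P)

    ⁻¹ᶠ-inverseˡ : ∀ a → adele (a ⁻¹ᶠ) *ᴬ adele a ≈ᴬ 𝐞
    ⁻¹ᶠ-inverseˡ a = 𝔸.trans (𝔸.*-comm (adele (a ⁻¹ᶠ)) (adele a)) (⁻¹ᶠ-inverseʳ a)

    ∙ᶠ-cong : ∀ {a a′ b b′} → a ≈ᶠ a′ → b ≈ᶠ b′ → (a ∙ᶠ b) ≈ᶠ (a′ ∙ᶠ b′)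
    ∙ᶠ-cong {a} {a′} {b} {b′} (mk∼ʸ q a≈) (mk∼ʸ r b≈) = mk∼ʸ (AbelianGroup._∙_ ℚˣ.abelianGroup q r)
      (𝔸.trans (𝔸.*-cong a≈ b≈)
        (𝔸.trans (interchange (diagonal (ℚˣ.val q)) (adele a′) (diagonal (ℚˣ.val r)) (adele b′))
          (𝔸.*-congʳ (𝔸.sym (diagonal-* (ℚˣ.val q) (ℚˣ.val r))))))
      where open CommutativeSemigroupProperties 𝔸.*-commutativeSemigroup using (interchange)

    ⁻¹ᶠ-cong : ∀ {a b} → a ≈ᶠ b → (a ⁻¹ᶠ) ≈ᶠ (b ⁻¹ᶠ)
    ⁻¹ᶠ-cong {a} {b} (mk∼ʸ q a≈) = IsEquivalence.sym ∼ʸ-isEquivalence (mk∼ʸ q (begin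
      b⁻¹                          ≈⟨ 𝐞-identityˡ (b ⁻¹ᶠ) ⟨
      𝐞 *ᴬ b⁻¹                     ≈⟨ 𝔸.*-congʳ (⁻¹ᶠ-inverseˡ a) ⟨
      a⁻¹ *ᴬ adele a *ᴬ b⁻¹        ≈⟨ 𝔸.*-congʳ (𝔸.*-congˡ a≈) ⟩
      a⁻¹ *ᴬ (δ *ᴬ adele b) *ᴬ b⁻¹ ≈⟨ 𝔸.*-congʳ (𝔸.*-assoc a⁻¹ δ (adele b)) ⟨
      a⁻¹ *ᴬ δ *ᴬ adele b *ᴬ b⁻¹   ≈⟨ 𝔸.*-assoc (a⁻¹ *ᴬ δ) (adele b) b⁻¹ ⟩
      a⁻¹ *ᴬ δ *ᴬ (adele b *ᴬ b⁻¹) ≈⟨ 𝔸.*-cong (𝔸.*-comm a⁻¹ δ) (⁻¹ᶠ-inverseʳ b) ⟩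
      δ *ᴬ a⁻¹ *ᴬ 𝐞                ≈⟨ 𝔸.*-assoc δ a⁻¹ 𝐞 ⟩
      δ *ᴬ (a⁻¹ *ᴬ 𝐞)              ≈⟨ 𝔸.*-congˡ (𝐞-identityʳ (a ⁻¹ᶠ)) ⟩
      δ *ᴬ a⁻¹                     ∎))
      where
      open import Relation.Binary.Reasoning.Setoid 𝔸.setoid
      a⁻¹ b⁻¹ δ : Adele
      a⁻¹ = adele (a ⁻¹ᶠ)
      b⁻¹ = adele (b ⁻¹ᶠ)
      δ   = diagonal (ℚˣ.val q)

  ≈ᶠ-isEquivalence : IsEquivalence _≈ᶠ_
  ≈ᶠ-isEquivalence = On.isEquivalence adele ∼ʸ-isEquivalence

  𝓕 : Group 0ℓ 0ℓ
  𝓕 = record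
    { Carrier = Normalized
    ; _≈_     = _≈ᶠ_
    ; _∙_     = _∙ᶠ_
    ; ε       = 𝐞-normalized
    ; _⁻¹     = _⁻¹ᶠ
    ; isGroup = record
      { isMonoid = record
        { isSemigroup = record
          { isMagma = record
            { isEquivalence = ≈ᶠ-isEquivalence
            ; ∙-cong        = λ {a} {a′} {b} {b′} → ∙ᶠ-cong {a} {a′} {b} {b′}
            }
          ; assoc = λ a b c → ≈⇒∼ʸ (𝔸.*-assoc (adele a) (adele b) (adele c))
          }
        ; identity = (λ a → ≈⇒∼ʸ (𝐞-identityˡ a)) , (λ a → ≈⇒∼ʸ (𝐞-identityʳ a))
        }
      ; inverse = (λ a → ≈⇒∼ʸ (⁻¹ᶠ-inverseˡ a)) , (λ a → ≈⇒∼ʸ (⁻¹ᶠ-inverseʳ a))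
      ; ⁻¹-cong = λ {a} {b} → ⁻¹ᶠ-cong {a} {b}
      }
    }

  normalized-setoid : Setoid 0ℓ 0ℓ
  normalized-setoid = On.setoid 𝔸.setoid adele

  normalized-topology : Topology normalized-setoid (lsuc 0ℓ)
  normalized-topology = inducedTopology adele id 𝔸-topology

  -- 𝓕 carries the quotient topology of the space of normalized adeles, a
  -- subspace of 𝔸. This is finer than the topology induced by the inclusion
  -- into Y-ℚ: the latter is indiscrete, since by strong approximation away
  -- from p the ℚˣ-orbit of every normalized adele meets every non-empty open
  -- subset of 𝔸 that contains a normalized adele.
  𝓕-topology : Topology (Group.setoid 𝓕) (lsuc 0ℓ)
  𝓕-topology = quotientTopology normalized-topology ≈ᶠ-isEquivalence

  𝓕⊂Y-continuous : Continuous 𝓕-topology Y-ℚ-topology adele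
  𝓕⊂Y-continuous = record
    { congruent     = id
    ; preimage-open = λ {U} (U-resp , U-open) → U-resp , U , U-open , id , id
    }

{-# OPTIONS --safe #-}

-- Every idele u has a rational multiple q u that is a unit at all finite
-- places: multiply by |t|ᵥ for each of the finitely many v at which u is not
-- yet a unit, t being a rational approximation of uᵥ. So u ↦ q u eₚ maps to
-- normalized adeles. Its inverse is a ↦ a + (1 − eₚ), which replaces the zero
-- at p by 1: if a = q u eₚ, then the ideles a + (1 − eₚ) and q u differ only
-- at p, so they agree modulo ℚₚˣ. Continuity is checked on the basic
-- neighbourhoods of 𝔸. For inversion of normalized adeles one uses
-- b⁻¹ − a⁻¹ = − a⁻¹ b⁻¹ (b − a), where a⁻¹ and b⁻¹ are integral at every
-- finite place. A rational multiple of u remains integral in a neighbourhood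
-- of u, with the same multiplier.

module Submission where

open import Defs
open import Algebra.Bundles using (CommutativeRing; AbelianGroup; Group)
import Algebra.Definitions.RawSemiring as RawExp
open import Algebra.Morphism.Structures using (IsGroupIsomorphism)
import Algebra.Properties.CommutativeSemigroup as CommutativeSemigroupProperties
import Algebra.Properties.Group as GroupProperties
import Data.Integer as ℤ
import Data.Integer.Properties as ℤₚ
open import Data.List using (List; []; _∷_; _++_)
open import Data.List.Membership.Propositional using (_∈_; _∉_)
open import Data.List.Membership.Propositional.Properties using (∈-++⁺ˡ; ∈-++⁺ʳ)
open import Data.List.Relation.Unary.Any using (here; there)
import Data.Nat as ℕ
open import Data.Nat.Divisibility using (_∤_; ∣⇒≤)
open import Data.Nat.Primality using (prime⇒irreducible; prime⇒nonTrivial)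
import Data.Nat.Properties as ℕₚ
open import Data.Product using (_×_; ∃; ∃₂; _,_; proj₁; proj₂; uncurry)
open import Data.Rational using (ℚ; 0ℚ; 1ℚ; ½; _+_; _*_; _-_; -_; _<_; _≤_; _⊔_; _⊓_; ↥_; ↧ₙ_)
import Data.Rational as ℚ
import Data.Rational.Properties as ℚₚ
open import Data.Rational.Solver using (module +-*-Solver)
import Data.Rational.Unnormalised as ℚᵘ
open import Data.Sum using (inj₁; inj₂)
open import Function using (_∘_; id)
open import Level using (0ℓ)
open import Relation.Binary using (IsEquivalence; _Respects_)
open import Relation.Binary.PropositionalEquality
  using (_≡_; _≢_; refl; sym; trans; cong; cong₂; subst; module ≡-Reasoning)
open import Relation.Nullary using (yes; no; contradiction)
open import Relation.Unary using (Pred)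

open RawExp ℚ.+-*-rawSemiring using () renaming (_^_ to _^ℚ_)
open FinitePlace using (prime-number)

-- The multiplier q is not canonical: it depends on the Cauchy sequences and the lists of places
-- that represent u. As a map to adeles `φ` therefore respects equality only up to ℚˣ, and its
-- algebraic properties are all deduced from the one relation `φ-∼`. The topology poses two
-- difficulties. A product of quotient maps need not be a quotient map, so continuity of the product
-- on 𝓕 cannot simply be read off from normalized adeles; it rests on saturations of open sets being
-- open (`saturation-open`). Moreover, a neighbourhood of an idele restricts its inverse as well.
-- For `φ` this is a help, as it keeps q u′ a unit at the finite places for u′ near u. For `ψ` it is
-- an obligation, met by the estimate `⁻¹-near` that also gives continuity of inversion on 𝓕. In
-- that estimate only the real place requires work, since inverses of normalized adeles are not
-- bounded there in advance. Real numbers being Cauchy sequences, the bound is obtained for rational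
-- terms that are inverse to each other only up to an error.

-- Rational inequalities and polynomial identities

*-pos : ∀ {x y} → 0ℚ < x → 0ℚ < y → 0ℚ < x * y
*-pos {x} {y} 0<x 0<y =
  ℚₚ.positive⁻¹ (x * y) {{ℚₚ.pos*pos⇒pos x {{ℚ.positive 0<x}} y {{ℚ.positive 0<y}}}}

*-mono-≤ : ∀ {x x′ y y′} → 0ℚ ≤ x → 0ℚ ≤ y′ → x ≤ x′ → y ≤ y′ → x * y ≤ x′ * y′
*-mono-≤ {x} {y′ = y′} 0≤x 0≤y′ x≤x′ y≤y′ = ℚₚ.≤-trans
  (ℚₚ.*-monoˡ-≤-nonNeg x {{ℚ.nonNegative 0≤x}} y≤y′)
  (ℚₚ.*-monoʳ-≤-nonNeg y′ {{ℚ.nonNegative 0≤y′}} x≤x′)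

positive-quotient : ∀ {ε B} → 0ℚ < ε → 0ℚ < B → ∃ λ δ → 0ℚ < δ × B * δ ≡ ε
positive-quotient {ε} {B} 0<ε 0<B = ε * ℚ.1/ B , *-pos 0<ε (ℚₚ.positive⁻¹ (ℚ.1/ B) {{ℚₚ.1/pos⇒pos B}}) ,
  trans (ℚₚ.*-comm B (ε * ℚ.1/ B)) (trans (ℚₚ.*-assoc ε (ℚ.1/ B) B)
    (trans (cong (ε *_) (ℚₚ.*-inverseˡ B)) (ℚₚ.*-identityʳ ε)))
  where
  instance
    B-pos : ℚ.Positive B
    B-pos = ℚ.positive 0<B
    B≢0 : ℚ.NonZero B
    B≢0 = ℚₚ.pos⇒nonZero B

-- For exact inverses this is y′ = y - y (x′ - x) y′. The two further terms account for terms of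
-- Cauchy sequences being inverse to each other only approximately.
perturbed-inverse : ∀ x y x′ y′ →
  y′ ≡ - y′ * (x * y - 1ℚ) + y * (x′ * y′ - 1ℚ) + y + y * (- (x′ - x)) * y′
perturbed-inverse = solve 4 (λ x y x′ y′ → y′ :=
  (:- y′) :* (x :* y :- con 1ℚ) :+ y :* (x′ :* y′ :- con 1ℚ) :+ y :+ y :* (:- (x′ :- x)) :* y′) refl
  where open +-*-Solver

¼ : ℚ
¼ = ½ * ½

0<¼ : 0ℚ < ¼
0<¼ = ℚₚ.positive⁻¹ ¼

≤-half : ∀ {y m} → y ≤ ½ * y + m → y ≤ m + m
≤-half {y} {m} y≤ = begin
  y              ≡⟨ Completion.½+½ archimedean y ⟨
  ½ * y + ½ * y  ≤⟨ ℚₚ.+-mono-≤ ½y≤m ½y≤m ⟩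
  m + m          ∎
  where
  open ℚₚ.≤-Reasoning
  ½y≤m : ½ * y ≤ m
  ½y≤m = begin
    ½ * y                      ≡⟨ ℚₚ.+-identityˡ (½ * y) ⟨
    0ℚ + ½ * y                 ≡⟨ cong (_+ ½ * y) (ℚₚ.+-inverseˡ (½ * y)) ⟨
    - (½ * y) + ½ * y + ½ * y  ≡⟨ ℚₚ.+-assoc (- (½ * y)) (½ * y) (½ * y) ⟩
    - (½ * y) + (½ * y + ½ * y) ≡⟨ cong (- (½ * y) +_) (Completion.½+½ archimedean y) ⟩
    - (½ * y) + y              ≤⟨ ℚₚ.+-monoʳ-≤ (- (½ * y)) y≤ ⟩
    - (½ * y) + (½ * y + m)    ≡⟨ ℚₚ.+-assoc (- (½ * y)) (½ * y) m ⟨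
    - (½ * y) + ½ * y + m      ≡⟨ cong (_+ m) (ℚₚ.+-inverseˡ (½ * y)) ⟩
    0ℚ + m                     ≡⟨ ℚₚ.+-identityˡ m ⟩
    m                          ∎

telescope : ∀ a b c → b - a + (c - b) ≡ c - a
telescope = solve 3 (λ a b c → b :- a :+ (c :- b) := c :- a) refl
  where open +-*-Solver

product-increment : ∀ a b c d → (c - a) * (d - b) + a * (d - b) + (c - a) * b ≡ c * d - a * b
product-increment = solve 4 (λ a b c d →
  (c :- a) :* (d :- b) :+ a :* (d :- b) :+ (c :- a) :* b := c :* d :- a :* b) refl
  where open +-*-Solver

-- Estimates in a completion of ℚ

module Estimates (A : AbsoluteValue) where

  open AbsoluteValue A
  open Completion A

  Eventually : (ℕ.ℕ → Set) → Set
  Eventually Q = ∃ λ N → ∀ n → N ℕ.≤ n → Q n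

  both : ∀ {Q R} → Eventually Q → Eventually R → Eventually (λ n → Q n × R n)
  both (M , q) (N , r) = M ℕ.⊔ N , λ n ≤n →
    q n (ℕₚ.≤-trans (ℕₚ.m≤m⊔n M N) ≤n) , r n (ℕₚ.≤-trans (ℕₚ.m≤n⊔m M N) ≤n)

  weaken : ∀ {Q R} → (∀ n → Q n → R n) → Eventually Q → Eventually R
  weaken f (N , q) = N , λ n ≤n → f n (q n ≤n)

  positive-radius : ∀ x {r} → ∥ x ∥< r → 0ℚ < r
  positive-radius x (δ , δ<r , N , ≤δ) =
    ℚₚ.≤-<-trans (ℚₚ.≤-trans (nonNeg (seq x N)) (≤δ N ℕₚ.≤-refl)) δ<r

  +-small : ∀ x y {r s} → ∥ x ∥< r → ∥ y ∥< s → ∥ x +ᶜ y ∥< (r + s)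
  +-small x y (δ , δ<r , x≤δ) (η , η<s , y≤η) = δ + η , ℚₚ.+-mono-< δ<r η<s ,
    weaken (λ n (x≤ , y≤) → ℚₚ.≤-trans (triangle (seq x n) (seq y n)) (ℚₚ.+-mono-≤ x≤ y≤)) (both x≤δ y≤η)

  *-small : ∀ x y {r s} → ∥ x ∥< r → ∥ y ∥< s → ∥ x *ᶜ y ∥< (r * s)
  *-small x y {r} {s} (δ , δ<r , N , x≤δ) ∥y∥<s@(η , η<s , y≤η) = δ * η , δη<rs ,
    weaken (λ n (x≤ , y≤) → ℚₚ.≤-trans (ℚₚ.≤-reflexive (∥xy∥≡∥x∥∥y∥ (seq x n) (seq y n)))
      (*-mono-≤ (nonNeg (seq x n)) (ℚₚ.≤-trans (nonNeg (seq y n)) y≤) x≤ y≤)) (both (N , x≤δ) y≤η)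
    where
    0≤δ : 0ℚ ≤ δ
    0≤δ = ℚₚ.≤-trans (nonNeg (seq x N)) (x≤δ N ℕₚ.≤-refl)
    -- Since δ may be 0, strictness comes from the step δ s < r s, where s is positive.
    δη<rs : δ * η < r * s
    δη<rs = ℚₚ.≤-<-trans (ℚₚ.*-monoˡ-≤-nonNeg δ {{ℚ.nonNegative 0≤δ}} (ℚₚ.<⇒≤ η<s))
      (ℚₚ.*-monoˡ-<-pos s {{ℚ.positive (positive-radius y ∥y∥<s)}} δ<r)

  neg-small : ∀ x {r} → ∥ x ∥< r → ∥ -ᶜ x ∥< r
  neg-small x (δ , δ<r , x≤δ) = δ , δ<r ,
    weaken (λ n → subst (_≤ δ) (sym (∥-x∥≡∥x∥ (seq x n)))) x≤δ

  enlarge : ∀ x {r s} → r ≤ s → ∥ x ∥< r → ∥ x ∥< s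
  enlarge x r≤s (δ , δ<r , x≤δ) = δ , ℚₚ.<-≤-trans δ<r r≤s , x≤δ

  -- The terms of x are bounded by some δ strictly below r, and the gap up to a δ′ between them
  -- absorbs the difference from y.
  small-respects : ∀ {x y r} → x ≈ y → ∥ x ∥< r → ∥ y ∥< r
  small-respects {x} {y} {r} x≈y (δ , δ<r , x≤δ) =
    let δ′ , δ<δ′ , δ′<r = ℚₚ.<-dense δ<r
        0<gap = subst (_< δ′ - δ) (ℚₚ.+-inverseʳ δ) (ℚₚ.+-monoˡ-< (- δ) δ<δ′)
    in δ′ , δ′<r , weaken (λ n (x≤ , y-x<) → bound n δ′ x≤ y-x<)
                     (both x≤δ (close (CommutativeRing.sym commutativeRing {x} {y} x≈y) (δ′ - δ) 0<gap))
    where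
    open +-*-Solver
    bound : ∀ n δ′ → ∥ seq x n ∥ ≤ δ → ∥ seq y n - seq x n ∥ < δ′ - δ → ∥ seq y n ∥ ≤ δ′
    bound n δ′ x≤ y-x< = begin
      ∥ seq y n ∥                            ≡⟨ cong ∥_∥ (solve 2 (λ a b → b := a :+ (b :- a)) refl (seq x n) (seq y n)) ⟩
      ∥ seq x n + (seq y n - seq x n) ∥      ≤⟨ triangle (seq x n) _ ⟩
      ∥ seq x n ∥ + ∥ seq y n - seq x n ∥    ≤⟨ ℚₚ.+-mono-≤ x≤ (ℚₚ.<⇒≤ y-x<) ⟩
      δ + (δ′ - δ)                           ≡⟨ solve 2 (λ a b → a :+ (b :- a) := b) refl δ δ′ ⟩
      δ′                                     ∎
      where open ℚₚ.≤-Reasoning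

  bounded : ∀ x → ∃ λ B → ∥ x ∥< B
  bounded x = let B , N , b = seq-bounded x in
    B + 1ℚ , B , subst (_< B + 1ℚ) (ℚₚ.+-identityʳ B) (ℚₚ.+-monoʳ-< B (ℚₚ.positive⁻¹ 1ℚ)) , N , b

  ∥*∥≤ : ∀ a b {c d} → ∥ a ∥ ≤ c → ∥ b ∥ ≤ d → 0ℚ ≤ d → ∥ a * b ∥ ≤ c * d
  ∥*∥≤ a b a≤ b≤ 0≤d = ℚₚ.≤-trans (ℚₚ.≤-reflexive (∥xy∥≡∥x∥∥y∥ a b)) (*-mono-≤ (nonNeg a) 0≤d a≤ b≤)

  -- Of the four terms of perturbed-inverse, the first and the last are at most
  -- ¼ ∥ y′ ∥ each and are absorbed by the left-hand side.
  inverse-bound : ∀ {M η} → 0ℚ ≤ M → M * η ≡ ¼ → 0ℚ ≤ η → ∀ x y x′ y′ →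
    ∥ y ∥ ≤ M → ∥ x * y - 1ℚ ∥ ≤ ¼ → ∥ x′ * y′ - 1ℚ ∥ ≤ ¼ → ∥ x′ - x ∥ ≤ η → ∥ y′ ∥ ≤ (M * ¼ + M) + (M * ¼ + M)
  inverse-bound {M} {η} 0≤M Mη≡¼ 0≤η x y x′ y′ y≤M xy≤ x′y′≤ x′-x≤ = ≤-half (begin
    Y ≡⟨ cong ∥_∥ (perturbed-inverse x y x′ y′) ⟩
    ∥ - y′ * (x * y - 1ℚ) + y * (x′ * y′ - 1ℚ) + y + y * (- (x′ - x)) * y′ ∥
      ≤⟨ triangle (- y′ * (x * y - 1ℚ) + y * (x′ * y′ - 1ℚ) + y) (y * (- (x′ - x)) * y′) ⟩
    ∥ - y′ * (x * y - 1ℚ) + y * (x′ * y′ - 1ℚ) + y ∥ + ∥ y * (- (x′ - x)) * y′ ∥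
      ≤⟨ ℚₚ.+-mono-≤
           (ℚₚ.≤-trans (triangle (- y′ * (x * y - 1ℚ) + y * (x′ * y′ - 1ℚ)) y)
             (ℚₚ.+-mono-≤ (ℚₚ.≤-trans (triangle (- y′ * (x * y - 1ℚ)) (y * (x′ * y′ - 1ℚ)))
               (ℚₚ.+-mono-≤
                 (∥*∥≤ (- y′) (x * y - 1ℚ) (ℚₚ.≤-reflexive (∥-x∥≡∥x∥ y′)) xy≤ (ℚₚ.<⇒≤ 0<¼))
                 (∥*∥≤ y (x′ * y′ - 1ℚ) y≤M x′y′≤ (ℚₚ.<⇒≤ 0<¼))))
               y≤M))
           (∥*∥≤ (y * (- (x′ - x))) y′ (∥*∥≤ y (- (x′ - x)) y≤M
             (subst (_≤ η) (sym (∥-x∥≡∥x∥ (x′ - x))) x′-x≤) 0≤η) ℚₚ.≤-refl (nonNeg y′)) ⟩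
    Y * ¼ + M * ¼ + M + M * η * Y  ≡⟨ cong (λ c → Y * ¼ + M * ¼ + M + c * Y) Mη≡¼ ⟩
    Y * ¼ + M * ¼ + M + ¼ * Y      ≡⟨ cong (_+ ¼ * Y) (ℚₚ.+-assoc (Y * ¼) (M * ¼) M) ⟩
    Y * ¼ + (M * ¼ + M) + ¼ * Y    ≡⟨ ℚₚ.+-comm (Y * ¼ + (M * ¼ + M)) (¼ * Y) ⟩
    ¼ * Y + (Y * ¼ + (M * ¼ + M))  ≡⟨ ℚₚ.+-assoc (¼ * Y) (Y * ¼) (M * ¼ + M) ⟨
    ¼ * Y + Y * ¼ + (M * ¼ + M)    ≡⟨ cong (λ c → ¼ * Y + c + (M * ¼ + M)) (ℚₚ.*-comm Y ¼) ⟩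
    ¼ * Y + ¼ * Y + (M * ¼ + M)    ≡⟨ cong (_+ (M * ¼ + M)) (ℚₚ.*-distribʳ-+ Y ¼ ¼) ⟨
    ½ * Y + (M * ¼ + M)            ∎)
    where
    open ℚₚ.≤-Reasoning
    Y : ℚ
    Y = ∥ y′ ∥

  -- The point is uniformity: `R` serves for every x′ within η of x. The factor M in M η = ¼ bounds
  -- the terms of y, and the final 1 only makes the inequality strict.
  inverse-bounded : ∀ x y → x *ᶜ y ≈ ι 1ℚ →
    ∃₂ λ η R → 0ℚ < η × (∀ x′ y′ → x′ *ᶜ y′ ≈ ι 1ℚ → ∥ x′ +ᶜ -ᶜ x ∥< η → ∥ y′ ∥< R)
  inverse-bounded x y xy≈1 =
    let M , ∥y∥<M@(δ , δ<M , y≤δ) = bounded y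
        0<M = positive-radius y ∥y∥<M
        η , 0<η , Mη≡¼ = positive-quotient {¼} {M} 0<¼ 0<M
        C = (M * ¼ + M) + (M * ¼ + M)
    in η , C + 1ℚ , 0<η , λ x′ y′ x′y′≈1 (γ , γ<η , x′-x≤γ) →
      C , subst (_< C + 1ℚ) (ℚₚ.+-identityʳ C) (ℚₚ.+-monoʳ-< C (ℚₚ.positive⁻¹ 1ℚ)) ,
      weaken (λ n ((y≤ , xy<) , (x′y′< , x′-x≤)) →
        inverse-bound (ℚₚ.<⇒≤ 0<M) Mη≡¼ (ℚₚ.<⇒≤ 0<η) (seq x n) (seq y n) (seq x′ n) (seq y′ n)
          (ℚₚ.≤-trans y≤ (ℚₚ.<⇒≤ δ<M)) (ℚₚ.<⇒≤ xy<) (ℚₚ.<⇒≤ x′y′<) (ℚₚ.≤-trans x′-x≤ (ℚₚ.<⇒≤ γ<η)))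
        (both (both y≤δ (close xy≈1 ¼ 0<¼)) (both (close x′y′≈1 ¼ 0<¼) x′-x≤γ))

  near-trans : ∀ x y z {r s} → ∥ y +ᶜ -ᶜ x ∥< r → ∥ z +ᶜ -ᶜ y ∥< s → ∥ z +ᶜ -ᶜ x ∥< (r + s)
  near-trans x y z x~y y~z = small-respects
    {(y +ᶜ -ᶜ x) +ᶜ (z +ᶜ -ᶜ y)} {z +ᶜ -ᶜ x}
    (pointwise (λ n → telescope (seq x n) (seq y n) (seq z n)))
    (+-small (y +ᶜ -ᶜ x) (z +ᶜ -ᶜ y) x~y y~z)

  *-increment : ∀ a b c d →
    (c +ᶜ -ᶜ a) *ᶜ (d +ᶜ -ᶜ b) +ᶜ a *ᶜ (d +ᶜ -ᶜ b) +ᶜ (c +ᶜ -ᶜ a) *ᶜ b ≈ c *ᶜ d +ᶜ -ᶜ (a *ᶜ b)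
  *-increment a b c d = pointwise (λ n → product-increment (seq a n) (seq b n) (seq c n) (seq d n))

  -- Thanks to δ ≤ 1 the quadratic summand of `*-increment` is bounded by 1 · δ, which makes the
  -- whole bound linear in δ.
  *-near : ∀ a b c d {B δ} → δ ≤ 1ℚ → ∥ a ∥< B → ∥ b ∥< B → ∥ c +ᶜ -ᶜ a ∥< δ → ∥ d +ᶜ -ᶜ b ∥< δ →
           ∥ c *ᶜ d +ᶜ -ᶜ (a *ᶜ b) ∥< ((1ℚ + B + B) * δ)
  *-near a b c d {B} {δ} δ≤1 a<B b<B c~a d~b = small-respects
    {x *ᶜ y +ᶜ a *ᶜ y +ᶜ x *ᶜ b} {c *ᶜ d +ᶜ -ᶜ (a *ᶜ b)}
    (*-increment a b c d)
    (subst (∥ x *ᶜ y +ᶜ a *ᶜ y +ᶜ x *ᶜ b ∥<_) expand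
      (+-small (x *ᶜ y +ᶜ a *ᶜ y) (x *ᶜ b)
        (+-small (x *ᶜ y) (a *ᶜ y)
          (*-small x y (enlarge x δ≤1 c~a) d~b) (*-small a y a<B d~b))
        (*-small x b c~a b<B)))
    where
    x y : Carrier
    x = c +ᶜ -ᶜ a
    y = d +ᶜ -ᶜ b
    expand : 1ℚ * δ + B * δ + δ * B ≡ (1ℚ + B + B) * δ
    expand = trans (cong (1ℚ * δ + B * δ +_) (ℚₚ.*-comm δ B))
      (trans (cong (_+ B * δ) (sym (ℚₚ.*-distribʳ-+ δ 1ℚ B))) (sym (ℚₚ.*-distribʳ-+ δ (1ℚ + B) B)))

-- Integrality and boxes of adeles

module 𝔸 = CommutativeRing adeleRing

𝒪-near : ∀ v {x y} → 𝒪 v x → 𝒪 v (K._-_ (finite v) y x) → 𝒪 v y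
𝒪-near v {x} {y} x∈𝒪 y-x∈𝒪 =
  let N , b = 𝒪.∥x∥≤1 (𝒪-properties.+-closed v x∈𝒪 y-x∈𝒪)
  in mk𝒪 (N , λ n N≤n → subst (λ q → AbsoluteValue.∥_∥ (absoluteValue (finite v)) q ≤ 1ℚ)
       (cancel (K.term (finite v) x n) (K.term (finite v) y n)) (b n N≤n))
  where
  cancel : ∀ a b → a + (b - a) ≡ b
  cancel = solve 2 (λ a b → a :+ (b :- a) := b) refl
    where open +-*-Solver

-- Integrality refers to the terms of one representing sequence. Passing to an equal element adds a
-- null difference, which is itself integral.
𝒪-respects : ∀ v {x y} → K._≈_ (finite v) x y → 𝒪 v x → 𝒪 v y
𝒪-respects v {x} {y} x≈y x∈𝒪 = 𝒪-near v {x} {y} x∈𝒪 (Adelic.small⇒𝒪 v {y Kᵥ.- x}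
  (Adelic.≈⇒small (finite v) {y} {x} (Kᵥ.sym {x} {y} x≈y) (ℚₚ.positive⁻¹ 1ℚ)))
  where module Kᵥ = K (finite v)

difference : (w : Place) (a b : Adele) → K.Carrier w
difference w a b = K._-_ w (b at w) (a at w)

Box-refl : ∀ {S ε} → 0ℚ < ε → ∀ a → Box S ε a a
Box-refl 0<ε a = Adelic.≈⇒Box 0<ε (𝔸.refl {a})

Box-trans : ∀ {S r s a b c} → Box S r a b → Box S s b c → Box S (r + s) a c
Box-trans {S} {r} {s} {a} {b} {c} ab bc = record
  { near-∞  = E.near-trans ∞ (a at ∞) (b at ∞) (c at ∞) (near-∞ ab) (near-∞ bc)
  ; near-S  = λ v v∈ → E.near-trans (finite v) (a at finite v) (b at finite v) (c at finite v)
                (near-S ab v v∈) (near-S bc v v∈)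
  ; outside = λ v v∉ → 𝒪-respects v
      {K._+_ (finite v) (difference (finite v) a b) (difference (finite v) b c)} {difference (finite v) a c}
      (Completion.pointwise (absoluteValue (finite v))
        (λ n → telescope (K.term (finite v) (a at finite v) n) (K.term (finite v) (b at finite v) n)
                         (K.term (finite v) (c at finite v) n)))
      (𝒪-properties.+-closed v (outside ab v v∉) (outside bc v v∉))
  }
  where
  open Box
  module E w = Estimates (absoluteValue w)

difference-cong : ∀ {a a′ b b′} → a ≈ᴬ a′ → b ≈ᴬ b′ →
                  ∀ w → K._≈_ w (difference w a b) (difference w a′ b′)
difference-cong {a} {a′} {b} {b′} a≈ b≈ w =
  K.+-cong w {b at w} {b′ at w} (at-≈ b≈ w) (K.-‿cong w {a at w} {a′ at w} (at-≈ a≈ w))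

-- A box sees its centre and its point only through their difference. This covers replacement by
-- equal adeles as well as translation.
Box-transport : ∀ {S ε a b a′ b′} → (∀ w → K._≈_ w (difference w a b) (difference w a′ b′)) →
                Box S ε a b → Box S ε a′ b′
Box-transport {a = a} {b} {a′} {b′} d≈ box = record
  { near-∞  = E.small-respects ∞ {difference ∞ a b} {difference ∞ a′ b′} (d≈ ∞) (near-∞ box)
  ; near-S  = λ v v∈ → E.small-respects (finite v) {difference (finite v) a b} {difference (finite v) a′ b′}
                (d≈ (finite v)) (near-S box v v∈)
  ; outside = λ v v∉ → 𝒪-respects v {difference (finite v) a b} {difference (finite v) a′ b′}
                (d≈ (finite v)) (outside box v v∉)
  }
  where
  open Box
  module E w = Estimates (absoluteValue w)

Box-respects : ∀ {S ε a b a′ b′} → a ≈ᴬ a′ → b ≈ᴬ b′ → Box S ε a b → Box S ε a′ b′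
Box-respects {S} {ε} {a} {b} {a′} {b′} a≈ b≈ =
  Box-transport {S} {ε} {a} {b} {a′} {b′} (difference-cong {a} {a′} {b} {b′} a≈ b≈)

Box-enlarge : ∀ {S r s a b} → r ≤ s → Box S r a b → Box S s a b
Box-enlarge {a = a} {b} r≤s box = record
  { near-∞  = Adelic.enlarge ∞ {difference ∞ a b} r≤s (near-∞ box)
  ; near-S  = λ v v∈ → Adelic.enlarge (finite v) {difference (finite v) a b} r≤s (near-S box v v∈)
  ; outside = outside box
  }
  where open Box

-- With radius at most 1 the list S can be shrunk to the empty one, after which every finite place
-- falls under `outside`.
Box-difference∈𝒪 : ∀ {S ε a b} → ε ≤ 1ℚ → Box S ε a b → ∀ v → 𝒪 v (difference (finite v) a b)
Box-difference∈𝒪 {a = a} {b} ε≤1 box =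
  λ v → Box.outside (Adelic.shrink {[]} (λ ()) ℚₚ.≤-refl ε≤1 box) v (λ ())

-- Continuity of multiplication of adeles

BoundedBy : ℚ → List FinitePlace → Pred Adele 0ℓ
BoundedBy B S a = K.∥_∥<_ ∞ (a at ∞) B × (∀ v → v ∈ S → K.∥_∥<_ (finite v) (a at finite v) B)

BoundedBy-enlarge : ∀ {B C S} a → B ≤ C → BoundedBy B S a → BoundedBy C S a
BoundedBy-enlarge a B≤C (a∞ , aS) = Adelic.enlarge ∞ {a at ∞} B≤C a∞ ,
  λ v v∈ → Adelic.enlarge (finite v) {a at finite v} B≤C (aS v v∈)

bounded-on : ∀ S a → ∃ λ B → BoundedBy B S a
bounded-on []      a = let B , a∞ = Estimates.bounded (absoluteValue ∞) (a at ∞) in B , a∞ , λ _ ()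
bounded-on (v ∷ S) a =
  let B , bound  = bounded-on S a
      C , av     = Estimates.bounded (absoluteValue (finite v)) (a at finite v)
      a∞ , aS    = BoundedBy-enlarge {B} {B ⊔ C} {S} a (ℚₚ.p≤p⊔q B C) bound
  in B ⊔ C , a∞ , λ { w (here refl) → Adelic.enlarge (finite v) {a at finite v} (ℚₚ.p≤q⊔p B C) av
                    ; w (there w∈)  → aS w w∈ }

BoundedBy-positive : ∀ {B S} a → BoundedBy B S a → 0ℚ < B
BoundedBy-positive a (a∞ , _) = Estimates.positive-radius (absoluteValue ∞) (a at ∞) a∞

*-near-𝒪 : ∀ v a b c d → let open K (finite v) using () renaming (_*_ to _·_; _-_ to _⊝_) in
  𝒪 v a → 𝒪 v b → 𝒪 v (c ⊝ a) → 𝒪 v (d ⊝ b) → 𝒪 v (c · d ⊝ a · b)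
*-near-𝒪 v a b c d a∈ b∈ x∈ y∈ = 𝒪-respects v
  (Estimates.*-increment (absoluteValue (finite v)) a b c d)
  (+-closed (+-closed (*-closed x∈ y∈) (*-closed a∈ y∈)) (*-closed x∈ b∈))
  where open 𝒪-properties v

unit-interval : ∀ {ε} → 0ℚ < ε → 0ℚ < ε ⊓ 1ℚ
unit-interval 0<ε = Adelic.⊓-pos 0<ε (ℚₚ.positive⁻¹ 1ℚ)

-- Off T both a and b are integral, so integral increments of the factors give an integral increment
-- of the product. At ∞ and at the places of T, `*-near` applies with one common bound C.
*-continuous : ∀ a b S {ε} → 0ℚ < ε → ∃₂ λ T δ → 0ℚ < δ ×
  (∀ {c d} → Box T δ a c → Box T δ b d → Box S ε (a *ᴬ b) (c *ᴬ d))
*-continuous a b S {ε} 0<ε =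
  let Sa , a∈    = almost-integral a
      Sb , b∈    = almost-integral b
      T          = S ++ Sa ++ Sb
      A , a<A    = bounded-on T a
      B , b<B    = bounded-on T b
      C          = A ⊔ B
      a<C        = BoundedBy-enlarge {A} {C} {T} a (ℚₚ.p≤p⊔q A B) a<A
      b<C        = BoundedBy-enlarge {B} {C} {T} b (ℚₚ.p≤q⊔p A B) b<B
      0<C        = BoundedBy-positive {C} {T} a a<C
      0<1+2C     = ℚₚ.+-mono-< (ℚₚ.+-mono-< (ℚₚ.positive⁻¹ 1ℚ) 0<C) 0<C
      -- Aiming at ε ⊓ 1 rather than ε keeps the increment integral at the places of T outside S, as
      -- `shrink` requires.
      γ , 0<γ , eq = positive-quotient {ε ⊓ 1ℚ} {1ℚ + C + C} (unit-interval 0<ε) 0<1+2C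
  in T , γ ⊓ 1ℚ , unit-interval 0<γ , λ {c} {d} ac bd →
     Adelic.shrink {S} {T} {ε} {ε ⊓ 1ℚ} {a *ᴬ b} {c *ᴬ d} ∈-++⁺ˡ (ℚₚ.p⊓q≤p ε 1ℚ) (ℚₚ.p⊓q≤q ε 1ℚ)
       (Box-enlarge {T} {(1ℚ + C + C) * (γ ⊓ 1ℚ)} {ε ⊓ 1ℚ} {a *ᴬ b} {c *ᴬ d}
         (ℚₚ.≤-trans (ℚₚ.*-monoˡ-≤-nonNeg (1ℚ + C + C) {{ℚ.nonNegative (ℚₚ.<⇒≤ 0<1+2C)}} (ℚₚ.p⊓q≤p γ 1ℚ))
                     (ℚₚ.≤-reflexive eq))
         (record
           { near-∞  = Estimates.*-near (absoluteValue ∞) (a at ∞) (b at ∞) (c at ∞) (d at ∞)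
                         (ℚₚ.p⊓q≤q γ 1ℚ) (proj₁ a<C) (proj₁ b<C) (near-∞ ac) (near-∞ bd)
           ; near-S  = λ v v∈ → Estimates.*-near (absoluteValue (finite v))
                         (a at finite v) (b at finite v) (c at finite v) (d at finite v)
                         (ℚₚ.p⊓q≤q γ 1ℚ) (proj₂ a<C v v∈) (proj₂ b<C v v∈) (near-S ac v v∈) (near-S bd v v∈)
           ; outside = λ v v∉ → *-near-𝒪 v (a at finite v) (b at finite v) (c at finite v) (d at finite v)
                         (a∈ v (v∉ ∘ ∈-++⁺ʳ S ∘ ∈-++⁺ˡ)) (b∈ v (v∉ ∘ ∈-++⁺ʳ S ∘ ∈-++⁺ʳ Sa))
                         (outside ac v v∉) (outside bd v v∉)
           }))
  where open Box

shrink-left : ∀ S T ε η {a b} → Box (S ++ T) ((ε ⊓ η) ⊓ 1ℚ) a b → Box S ε a b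
shrink-left S T ε η = Adelic.shrink {S} {S ++ T} ∈-++⁺ˡ
  (ℚₚ.≤-trans (ℚₚ.p⊓q≤p (ε ⊓ η) 1ℚ) (ℚₚ.p⊓q≤p ε η)) (ℚₚ.p⊓q≤q (ε ⊓ η) 1ℚ)

shrink-right : ∀ S T ε η {a b} → Box (S ++ T) ((ε ⊓ η) ⊓ 1ℚ) a b → Box T η a b
shrink-right S T ε η = Adelic.shrink {T} {S ++ T} (∈-++⁺ʳ S)
  (ℚₚ.≤-trans (ℚₚ.p⊓q≤p (ε ⊓ η) 1ℚ) (ℚₚ.p⊓q≤q ε η)) (ℚₚ.p⊓q≤q (ε ⊓ η) 1ℚ)

+-translate : ∀ {S ε} a b c → Box S ε a b → Box S ε (a +ᴬ c) (b +ᴬ c)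
+-translate {S} {ε} a b c = Box-transport {S} {ε} {a} {b} {a +ᴬ c} {b +ᴬ c}
  (λ w → Completion.pointwise (absoluteValue w) (λ n →
    cancel (K.term w (a at w) n) (K.term w (b at w) n) (K.term w (c at w) n)))
  where
  cancel : ∀ a b c → b - a ≡ b + c - (a + c)
  cancel = solve 3 (λ a b c → b :- a := b :+ c :- (a :+ c)) refl
    where open +-*-Solver

-- Open sets of adeles and ideles

interior : Pred Adele 0ℓ → Pred Adele 0ℓ
interior Q a = ∃₂ λ S ε → 0ℚ < ε × (∀ {b} → Box S ε a b → Q b)

halve : ∀ {S ε a b c} → Box S (½ * ε) a b → Box S (½ * ε) b c → Box S ε a c
halve {S} {ε} {a} {b} {c} ab bc =
  subst (λ r → Box S r a c) (Completion.½+½ archimedean ε) (Box-trans {a = a} {b} {c} ab bc)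

½-positive : ∀ {ε} → 0ℚ < ε → 0ℚ < ½ * ε
½-positive = Completion.½-pos archimedean

interior-open : ∀ Q → Open 𝔸-topology (interior Q)
interior-open Q {a} (S , ε , 0<ε , box⊆Q) = S , ½ * ε , ½-positive 0<ε ,
  λ {b} ab → S , ½ * ε , ½-positive 0<ε , λ {c} bc → box⊆Q {c} (halve {S} {ε} {a} {b} {c} ab bc)

-- The induced topology asks for an open subset of 𝔸 × 𝔸 that cuts out U. It is taken to consist of
-- all pairs, whether or not of the form (u , u⁻¹), around which some box contains only ideles of U.
idele-open : (U : Pred Idele 0ℓ) →
  (∀ {u} → U u → ∃₂ λ S ε → 0ℚ < ε × (∀ {u′} →
    Box S ε (𝔸ˣ.val u) (𝔸ˣ.val u′) → Box S ε (𝔸ˣ.inv u) (𝔸ˣ.inv u′) → U u′)) →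
  Open 𝔸ˣ-topology U
idele-open U nbhd = V , V-open , (λ u → nbhd u) ,
  λ { {u} (S , ε , 0<ε , box⊆U) → box⊆U {u} (Box-refl 0<ε (𝔸ˣ.val u)) (Box-refl 0<ε (𝔸ˣ.inv u)) }
  where
  V : Pred (Adele × Adele) 0ℓ
  V (a , b) = ∃₂ λ S ε → 0ℚ < ε × (∀ {u} → Box S ε a (𝔸ˣ.val u) → Box S ε b (𝔸ˣ.inv u) → U u)
  V-open : Open (𝔸-topology ×ᵗ 𝔸-topology) V
  V-open {a} {b} (S , ε , 0<ε , box⊆U) =
    -- Interiors are open by `interior-open`. One half of ε moves the centre from (a , b) to (c ,
    -- d), the other half is the radius left there.
    interior (Box S (½ * ε) a) , interior (Box S (½ * ε) b) ,
    interior-open (Box S (½ * ε) a) , interior-open (Box S (½ * ε) b) ,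
    (S , ½ * ε , ½-positive 0<ε , id) , (S , ½ * ε , ½-positive 0<ε , id) ,
    λ { {c} {d} (T , η , 0<η , c⊆) (T′ , η′ , 0<η′ , d⊆) → S , ½ * ε , ½-positive 0<ε ,
        λ {u} cu du → box⊆U {u} (halve {S} {ε} {a} {c} {𝔸ˣ.val u} (c⊆ {c} (Box-refl 0<η c)) cu)
                                (halve {S} {ε} {b} {d} {𝔸ˣ.inv u} (d⊆ {d} (Box-refl 0<η′ d)) du) }

idele-open⁻¹ : ∀ {U} → Open 𝔸ˣ-topology U → ∀ {u} → U u → ∃₂ λ S ε → 0ℚ < ε × (∀ {u′} →
  Box S ε (𝔸ˣ.val u) (𝔸ˣ.val u′) → Box S ε (𝔸ˣ.inv u) (𝔸ˣ.inv u′) → U u′)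
idele-open⁻¹ (V , V-open , U⊆V , V⊆U) {u} Uu =
  let A , B , A-open , B-open , a , b , AB⊆V = V-open (U⊆V Uu)
      S , ε , 0<ε , box⊆A = A-open a
      T , η , 0<η , box⊆B = B-open b
  in S ++ T , (ε ⊓ η) ⊓ 1ℚ , unit-interval (Adelic.⊓-pos 0<ε 0<η) , λ {u′} near-val near-inv → V⊆U (AB⊆V
       (box⊆A {𝔸ˣ.val u′} (shrink-left S T ε η near-val))
       (box⊆B {𝔸ˣ.inv u′} (shrink-right S T ε η near-inv)))

-- Rational multiples of ideles that are units at all finite places

prime-number-injective : ∀ {v w} → prime-number v ≡ prime-number w → v ≡ w
prime-number-injective {place _ _} {place _ _} refl = refl

1<prime : ∀ v → 1 ℕ.< prime-number v
1<prime v = ℕ.nonTrivial⇒n>1 (prime-number v) {{prime⇒nonTrivial (prime-place v)}}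

prime∤prime : ∀ {v w} → w ≢ v → prime-number w ∤ prime-number v
prime∤prime {v} {w} w≢v p∣q with prime⇒irreducible (prime-place v) p∣q
... | inj₁ p≡1 = ℕₚ.<⇒≢ (1<prime w) (sym p≡1)
... | inj₂ p≡q = w≢v (prime-number-injective p≡q)

*-exchange : ∀ a b c d → a * b * (c * d) ≡ a * c * (b * d)
*-exchange = solve 4 (λ a b c d → a :* b :* (c :* d) := a :* c :* (b :* d)) refl
  where open +-*-Solver

unit≢0 : ∀ (t : ℚˣ.Unit) → ℚˣ.val t ≢ 0ℚ
unit≢0 (ℚˣ.mkUnit .0ℚ t⁻¹ tt⁻¹≡1) refl = contradiction (trans (sym (ℚₚ.*-zeroˡ t⁻¹)) tt⁻¹≡1) λ ()

norm : FinitePlace → ℚ → ℚ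
norm v = AbsoluteValue.∥_∥ (absoluteValue (finite v))

module _ (v : FinitePlace) where

  open PAdicProperties (prime-number v) (prime-place v) hiding (absoluteValue)
  open AbsoluteValue (absoluteValue (finite v)) using (∥_∥)

  norm-unit-ℕ : ∀ n → prime-number v ∤ n → N n ≡ 1ℚ
  norm-unit-ℕ n p∤n = trans (cong N (sym (ℕₚ.*-identityˡ n))) (N-p^ 0 n p∤n)

  p∤1 : prime-number v ∤ 1
  p∤1 p∣1 = ℕₚ.<⇒≱ (1<prime v) (∣⇒≤ p∣1)

  norm-fromℕ : ∀ n → ∥ fromℕ n ∥ ≡ N n
  norm-fromℕ n = trans (sym (ℚₚ.*-identityʳ _)) (trans (cong (∥ fromℕ n ∥ *_) (sym (norm-unit-ℕ 1 p∤1)))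
    (∥∥-fraction (fromℕ n) (ℤ.+ n) 1 (↥↧-toℚᵘ (fromℕ n) (ℚₚ.toℚᵘ-fromℚᵘ (ℚᵘ.mkℚᵘ (ℤ.+ n) 0)))))

  norm-1 : ∥ 1ℚ ∥ ≡ 1ℚ
  norm-1 = trans (norm-fromℕ 1) (norm-unit-ℕ 1 p∤1)

module _ (v : FinitePlace) where

  open PAdicProperties (prime-number v) (prime-place v) hiding (absoluteValue)
  open AbsoluteValue (absoluteValue (finite v)) using (∥_∥; nonNeg; ∥0∥≡0; ∥-x∥≡∥x∥; ∥xy∥≡∥x∥∥y∥)

  norm-P : ∥ P ∥ ≡ π
  norm-P = trans (norm-fromℕ v (prime-number v)) (trans
    (cong N (sym (trans (ℕₚ.*-identityʳ (prime-number v ℕ.* 1)) (ℕₚ.*-identityʳ (prime-number v)))))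
    (trans (N-p^ 1 1 (p∤1 v)) (ℚₚ.*-identityʳ π)))

  -- |t|ᵥ is itself a power of v, which makes it a convenient scaling factor.
  norm-induction : (Q : ℚ → Set) → Q 1ℚ → (∀ {a b} → Q a → Q b → Q (a * b)) → Q π → Q P →
                   ∀ t → t ≢ 0ℚ → Q ∥ t ∥
  norm-induction Q Q1 Q* Qπ QP t t≢0 = Q* (on-N ℤ.∣ ↥ t ∣ (t≢0 ∘ ℚₚ.↥p≡0⇒p≡0 t ∘ ℤₚ.∣i∣≡0⇒i≡0))
    (powers QP (ord (prime-number v) (↧ₙ t)))
    where
    powers : ∀ {a} → Q a → ∀ k → Q (a ^ℚ k)
    powers Qa ℕ.zero    = Q1
    powers Qa (ℕ.suc k) = Q* Qa (powers Qa k)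
    on-N : ∀ n → n ≢ 0 → Q (N n)
    on-N ℕ.zero    n≢0 = contradiction refl n≢0
    on-N (ℕ.suc n) _   = powers Qπ (ord (prime-number v) (ℕ.suc n))

  -- On powers of v the v-adic absolute value is inversion, and |t|ᵥ is such a power.
  norm-norm : ∀ t → t ≢ 0ℚ → ∥ ∥ t ∥ ∥ * ∥ t ∥ ≡ 1ℚ
  norm-norm = norm-induction (λ q → ∥ q ∥ * q ≡ 1ℚ)
    (trans (ℚₚ.*-identityʳ ∥ 1ℚ ∥) (norm-1 v))
    (λ {a} {b} a≡ b≡ → trans (cong (_* (a * b)) (∥xy∥≡∥x∥∥y∥ a b))
      (trans (*-exchange (∥ a ∥) (∥ b ∥) a b) (cong₂ _*_ a≡ b≡)))
    (begin
      ∥ π ∥ * π      ≡⟨ cong (∥ π ∥ *_) norm-P ⟨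
      ∥ π ∥ * ∥ P ∥  ≡⟨ ∥xy∥≡∥x∥∥y∥ π P ⟨
      ∥ π * P ∥      ≡⟨ cong ∥_∥ π·P≡1 ⟩
      ∥ 1ℚ ∥         ≡⟨ norm-1 v ⟩
      1ℚ             ∎)
    (trans (cong (_* P) norm-P) π·P≡1)
    where open ≡-Reasoning

  -- A power of v is a unit at every other prime. Scaling by |t|ᵥ thus leaves integrality at w as it
  -- was, which lets the finitely many bad places be treated one after another.
  norm-norm-away : ∀ {w} → w ≢ v → ∀ t → t ≢ 0ℚ → norm w ∥ t ∥ ≡ 1ℚ
  norm-norm-away {w} w≢v = norm-induction (λ q → norm w q ≡ 1ℚ) norm-w-1
    (λ {a} {b} a≡ b≡ → trans (norm-w-* a b) (cong₂ _*_ a≡ b≡))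
    (begin
      norm w π             ≡⟨ ℚₚ.*-identityʳ (norm w π) ⟨
      norm w π * 1ℚ        ≡⟨ cong (norm w π *_) norm-w-P ⟨
      norm w π * norm w P  ≡⟨ norm-w-* π P ⟨
      norm w (π * P)       ≡⟨ cong (norm w) π·P≡1 ⟩
      norm w 1ℚ            ≡⟨ norm-w-1 ⟩
      1ℚ                   ∎)
    norm-w-P
    where
    open ≡-Reasoning
    norm-w-1 : norm w 1ℚ ≡ 1ℚ
    norm-w-1 = trans (norm-fromℕ w 1) (norm-unit-ℕ w 1 (p∤1 w))
    norm-w-P : norm w P ≡ 1ℚ
    norm-w-P = trans (norm-fromℕ w (prime-number v)) (norm-unit-ℕ w (prime-number v) (prime∤prime w≢v))
    norm-w-* : ∀ a b → norm w (a * b) ≡ norm w a * norm w b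
    norm-w-* = AbsoluteValue.∥xy∥≡∥x∥∥y∥ (absoluteValue (finite w))

  -- The ultrametric inequality gives |z| ≤ 1, and also 1 ≤ |z| because the maximum of |z| and |z -
  -- 1| cannot be the latter.
  close-to-1⇒norm-1 : ∀ z → ∥ z - 1ℚ ∥ < 1ℚ → ∥ z ∥ ≡ 1ℚ
  close-to-1⇒norm-1 z z~1 = ℚₚ.≤-antisym z≤1 1≤z
    where
    open ℚₚ.≤-Reasoning
    z≤1 : ∥ z ∥ ≤ 1ℚ
    z≤1 = begin
      ∥ z ∥                  ≡⟨ cong ∥_∥ (solve 2 (λ z o → z := o :+ (z :- o)) refl z 1ℚ) ⟩
      ∥ 1ℚ + (z - 1ℚ) ∥      ≤⟨ ultrametric 1ℚ (z - 1ℚ) ⟩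
      ∥ 1ℚ ∥ ⊔ ∥ z - 1ℚ ∥    ≤⟨ ℚₚ.⊔-lub (ℚₚ.≤-reflexive (norm-1 v)) (ℚₚ.<⇒≤ z~1) ⟩
      1ℚ                     ∎
      where open +-*-Solver
    1≤⊔ : 1ℚ ≤ ∥ z ∥ ⊔ ∥ z - 1ℚ ∥
    1≤⊔ = begin
      1ℚ                       ≡⟨ norm-1 v ⟨
      ∥ 1ℚ ∥                   ≡⟨ cong ∥_∥ (solve 2 (λ z o → o := z :+ (:- (z :- o))) refl z 1ℚ) ⟩
      ∥ z + - (z - 1ℚ) ∥       ≤⟨ ultrametric z (- (z - 1ℚ)) ⟩
      ∥ z ∥ ⊔ ∥ - (z - 1ℚ) ∥   ≡⟨ cong (∥ z ∥ ⊔_) (∥-x∥≡∥x∥ (z - 1ℚ)) ⟩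
      ∥ z ∥ ⊔ ∥ z - 1ℚ ∥       ∎
      where open +-*-Solver
    1≤z : 1ℚ ≤ ∥ z ∥
    1≤z with ℚₚ.⊔-sel (∥ z ∥) (∥ z - 1ℚ ∥)
    ... | inj₁ eq = subst (1ℚ ≤_) eq 1≤⊔
    ... | inj₂ eq = contradiction (ℚₚ.<-≤-trans z~1 (subst (1ℚ ≤_) eq 1≤⊔)) (ℚₚ.<-irrefl refl)

  norm-unit : ℚˣ.Unit → ℚˣ.Unit
  norm-unit (ℚˣ.mkUnit t t⁻¹ tt⁻¹≡1) = ℚˣ.mkUnit (∥ t ∥) (∥ t⁻¹ ∥)
    (trans (sym (∥xy∥≡∥x∥∥y∥ t t⁻¹)) (trans (cong ∥_∥ tt⁻¹≡1) (norm-1 v)))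

  -- A v-adic unit multiple of x is |t|ᵥ x, where t is a term of x so far out
  -- that |x|ᵥ = |t|ᵥ.
  local-scaling : ∀ x y → K._≈_ (finite v) (K._*_ (finite v) x y) (K.1# (finite v)) →
    ∃ λ t → 𝒪 v (K._*_ (finite v) (K.ι (finite v) (ℚˣ.val (norm-unit t))) x)
          × 𝒪 v (K._*_ (finite v) (K.ι (finite v) (ℚˣ.inv (norm-unit t))) y)
  local-scaling x y xy≈1 =
    let B , ∥y∥<B@(β , β<B , y≤β) = bounded y
        0<B = positive-radius y ∥y∥<B
        -- B bounds the terms of y, so with B δ = 1 replacing a term of x by t₀ changes its product
        -- with a term of y by less than 1. Both products then have absolute value 1.
        δ , 0<δ , Bδ≡1 = positive-quotient {1ℚ} {B} (ℚₚ.positive⁻¹ 1ℚ) 0<B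
        M , cauchy-x = cauchy x δ 0<δ
        L , close-xy = both y≤β (close xy≈1 1ℚ (ℚₚ.positive⁻¹ 1ℚ))
        N₀ = M ℕ.⊔ L
        t₀ = seq x N₀
        M≤N₀ = ℕₚ.m≤m⊔n M L
        L≤N₀ = ℕₚ.m≤n⊔m M L
        tail : ∀ n → N₀ ℕ.≤ n → ∥ t₀ * seq y n ∥ ≡ 1ℚ × ∥ seq x n * seq y n ∥ ≡ 1ℚ
        tail n N₀≤n =
          let y≤ , xy< = close-xy n (ℕₚ.≤-trans L≤N₀ N₀≤n)
          in close-to-1⇒norm-1 (t₀ * seq y n) (perturb (seq x n) (seq y n) t₀ (ℚₚ.≤-trans y≤ (ℚₚ.<⇒≤ β<B)) 0<B Bδ≡1
               (cauchy-x N₀ n M≤N₀ (ℕₚ.≤-trans M≤N₀ N₀≤n)) xy<) , close-to-1⇒norm-1 (seq x n * seq y n) xy<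
        t = unit t₀ (seq y N₀) (proj₁ (tail N₀ ℕₚ.≤-refl))
        val-norm : ∥ ℚˣ.val (norm-unit t) ∥ * ∥ t₀ ∥ ≡ 1ℚ
        val-norm = norm-norm t₀ (unit≢0 t)
    in t ,
       mk𝒪 (N₀ , λ n ≤n → let ty , xy = tail n ≤n in
         ℚₚ.≤-reflexive (val-bound (seq x n) (seq y n) t₀ (ℚˣ.val (norm-unit t)) ty xy val-norm)) ,
       mk𝒪 (N₀ , λ n ≤n → let ty , _ = tail n ≤n in
         ℚₚ.≤-reflexive (inv-bound (seq y n) t ty val-norm))
    where
    open Completion (absoluteValue (finite v)) using (seq; cauchy; close)
    open Estimates (absoluteValue (finite v))
    unit : ∀ t₀ y → ∥ t₀ * y ∥ ≡ 1ℚ → ℚˣ.Unit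
    unit t₀ y ty = ℚˣ.mkUnit t₀ (ℚ.1/ t₀) (ℚₚ.*-inverseʳ t₀)
      where
      instance
        t₀≢0 : ℚ.NonZero t₀
        t₀≢0 = ℚ.≢-nonZero {t₀} λ { refl → contradiction
          (trans (sym ty) (trans (cong ∥_∥ (ℚₚ.*-zeroˡ y)) ∥0∥≡0)) λ () }
    perturb : ∀ a b t {B δ} → ∥ b ∥ ≤ B → 0ℚ < B → B * δ ≡ 1ℚ → ∥ t - a ∥ < δ → ∥ a * b - 1ℚ ∥ < 1ℚ → ∥ t * b - 1ℚ ∥ < 1ℚ
    perturb a b t {B} {δ} b≤B 0<B Bδ≡1 t~a ab~1 = begin-strict
      ∥ t * b - 1ℚ ∥                          ≡⟨ cong ∥_∥ (solve 4 (λ a b t o →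
                                                   t :* b :- o := b :* (t :- a) :+ (a :* b :- o)) refl a b t 1ℚ) ⟩
      ∥ b * (t - a) + (a * b - 1ℚ) ∥          ≤⟨ ultrametric (b * (t - a)) (a * b - 1ℚ) ⟩
      ∥ b * (t - a) ∥ ⊔ ∥ a * b - 1ℚ ∥        <⟨ ⊔-lub-< (begin-strict
        ∥ b * (t - a) ∥      ≡⟨ ∥xy∥≡∥x∥∥y∥ b (t - a) ⟩
        ∥ b ∥ * ∥ t - a ∥    ≤⟨ ℚₚ.*-monoʳ-≤-nonNeg ∥ t - a ∥ {{ℚ.nonNegative (nonNeg (t - a))}} b≤B ⟩
        B * ∥ t - a ∥        <⟨ ℚₚ.*-monoʳ-<-pos B {{ℚ.positive 0<B}} t~a ⟩
        B * δ                ≡⟨ Bδ≡1 ⟩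
        1ℚ                   ∎) ab~1 ⟩
      1ℚ                                      ∎
      where
      open ℚₚ.≤-Reasoning
      open +-*-Solver
      ⊔-lub-< : ∀ {a b c} → a < c → b < c → a ⊔ b < c
      ⊔-lub-< {a} {b} {c} a<c b<c with ℚₚ.⊔-sel a b
      ... | inj₁ eq = subst (_< c) (sym eq) a<c
      ... | inj₂ eq = subst (_< c) (sym eq) b<c
    val-bound : ∀ a b t s → ∥ t * b ∥ ≡ 1ℚ → ∥ a * b ∥ ≡ 1ℚ → ∥ s ∥ * ∥ t ∥ ≡ 1ℚ → ∥ s * a ∥ ≡ 1ℚ
    val-bound a b t s tb ab st = begin
      ∥ s * a ∥                          ≡⟨ ℚₚ.*-identityʳ ∥ s * a ∥ ⟨
      ∥ s * a ∥ * 1ℚ                     ≡⟨ cong (∥ s * a ∥ *_) tb ⟨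
      ∥ s * a ∥ * ∥ t * b ∥              ≡⟨ cong₂ _*_ (∥xy∥≡∥x∥∥y∥ s a) (∥xy∥≡∥x∥∥y∥ t b) ⟩
      ∥ s ∥ * ∥ a ∥ * (∥ t ∥ * ∥ b ∥)    ≡⟨ *-exchange (∥ s ∥) (∥ a ∥) (∥ t ∥) (∥ b ∥) ⟩
      ∥ s ∥ * ∥ t ∥ * (∥ a ∥ * ∥ b ∥)    ≡⟨ cong₂ _*_ st (trans (sym (∥xy∥≡∥x∥∥y∥ a b)) ab) ⟩
      1ℚ                                 ∎
      where open ≡-Reasoning
    inv-bound : ∀ b t → ∥ ℚˣ.val t * b ∥ ≡ 1ℚ → ∥ ℚˣ.val (norm-unit t) ∥ * ∥ ℚˣ.val t ∥ ≡ 1ℚ →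
                ∥ ℚˣ.inv (norm-unit t) * b ∥ ≡ 1ℚ
    inv-bound b t@(ℚˣ.mkUnit τ τ⁻¹ ττ⁻¹≡1) tb st = begin
      ∥ s⁻¹ * b ∥                          ≡⟨ ∥xy∥≡∥x∥∥y∥ s⁻¹ b ⟩
      ∥ s⁻¹ ∥ * ∥ b ∥                      ≡⟨ ℚₚ.*-identityˡ (∥ s⁻¹ ∥ * ∥ b ∥) ⟨
      1ℚ * (∥ s⁻¹ ∥ * ∥ b ∥)               ≡⟨ cong (_* (∥ s⁻¹ ∥ * ∥ b ∥)) st ⟨
      ∥ s ∥ * ∥ τ ∥ * (∥ s⁻¹ ∥ * ∥ b ∥)    ≡⟨ *-exchange (∥ s ∥) (∥ τ ∥) (∥ s⁻¹ ∥) (∥ b ∥) ⟩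
      ∥ s ∥ * ∥ s⁻¹ ∥ * (∥ τ ∥ * ∥ b ∥)    ≡⟨ cong₂ _*_ (trans (sym (∥xy∥≡∥x∥∥y∥ s s⁻¹))
                                                (trans (cong ∥_∥ (ℚˣ.val·inv≈1 (norm-unit t))) (norm-1 v)))
                                                (trans (sym (∥xy∥≡∥x∥∥y∥ τ b)) tb) ⟩
      1ℚ                                   ∎
      where
      open ≡-Reasoning
      s s⁻¹ : ℚ
      s   = ℚˣ.val (norm-unit t)
      s⁻¹ = ℚˣ.inv (norm-unit t)

inverse-unit : ℚˣ.Unit → ℚˣ.Unit
inverse-unit = AbelianGroup._⁻¹ ℚˣ.abelianGroup

infixr 7 _•_

_•_ : ℚˣ.Unit → Idele → Idele
q • u = AbelianGroup._∙_ 𝔸ˣ.abelianGroup (principal q) u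

-- Equivalently, the component of u at v lies in ℤᵥˣ. Two separate conditions on adeles are
-- convenient because each is preserved under small perturbations.
IntegralAt : FinitePlace → Pred Idele 0ℓ
IntegralAt v u = 𝒪 v (𝔸ˣ.val u at finite v) × 𝒪 v (𝔸ˣ.inv u at finite v)

IntegralAt-respects : ∀ v u u′ → u 𝔸ˣ.≈ᵘ u′ → IntegralAt v u → IntegralAt v u′
IntegralAt-respects v u u′ u≈u′ (u∈ , u⁻¹∈) =
  𝒪-respects v {𝔸ˣ.val u at finite v} (at-≈ (𝔸ˣ.val-≈ u≈u′) (finite v)) u∈ ,
  𝒪-respects v {𝔸ˣ.inv u at finite v} (at-≈ (𝔸ˣ.inv-cong {u} {u′} u≈u′) (finite v)) u⁻¹∈

integral-at-v : ∀ v u → ∃ λ q → IntegralAt v (q • u) × (∀ w → w ≢ v → IntegralAt w u → IntegralAt w (q • u))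
integral-at-v v u =
  let x = 𝔸ˣ.val u at finite v
      y = 𝔸ˣ.inv u at finite v
      t , sx∈𝒪 , s⁻¹y∈𝒪 = local-scaling v x y (at-≈ (𝔸ˣ.val·inv≈1 u) (finite v))
  in norm-unit v t , (sx∈𝒪 , s⁻¹y∈𝒪) , λ w w≢v (u∈ , u⁻¹∈) →
     𝒪-properties.*-closed w (𝒪-properties.ι∈𝒪 w (ℚₚ.≤-reflexive
       (norm-norm-away v w≢v (ℚˣ.val t) (unit≢0 t)))) u∈ ,
     𝒪-properties.*-closed w (𝒪-properties.ι∈𝒪 w (ℚₚ.≤-reflexive
       (norm-norm-away v w≢v (ℚˣ.inv t) (unit≢0 (inverse-unit t))))) u⁻¹∈

integral-multiple-off : ∀ S u → (∀ v → v ∉ S → IntegralAt v u) → ∃ λ q → ∀ v → IntegralAt v (q • u)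
integral-multiple-off []      u u∈ = AbelianGroup.ε ℚˣ.abelianGroup , λ v →
  IntegralAt-respects v u (AbelianGroup.ε ℚˣ.abelianGroup • u)
    (𝔸ˣ.mk≈ᵘ (mk≈ᴬ λ w → K.sym w {K._*_ w (K.1# w) (𝔸ˣ.val u at w)} (K.*-identityˡ w (𝔸ˣ.val u at w))))
    (u∈ v λ ())
integral-multiple-off (v ∷ S) u u∈ =
  let q , at-v , off-v = integral-at-v v u
      r , rqu∈ = integral-multiple-off S (q • u) λ w → scaled w {q} at-v off-v
      rq = AbelianGroup._∙_ ℚˣ.abelianGroup r q
  in rq , λ w → IntegralAt-respects w (r • q • u) (rq • u)
       (𝔸ˣ.mk≈ᵘ (mk≈ᴬ λ z → Completion.pointwise (absoluteValue z)
         (λ n → sym (ℚₚ.*-assoc (ℚˣ.val r) (ℚˣ.val q) (K.term z (𝔸ˣ.val u at z) n)))))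
       (rqu∈ w)
  where
  scaled : ∀ w {q} → IntegralAt v (q • u) → (∀ w → w ≢ v → IntegralAt w u → IntegralAt w (q • u)) →
             w ∉ S → IntegralAt w (q • u)
  scaled w at-v off-v w∉S with w ≟ᶠ v
  ... | yes refl = at-v
  ... | no  w≢v  = off-v w w≢v (u∈ w λ { (here w≡v) → w≢v w≡v ; (there w∈S) → w∉S w∈S })

integral-multiple : ∀ u → ∃ λ q → ∀ v → IntegralAt v (q • u)
integral-multiple u =
  let S , u∈ = almost-integral (𝔸ˣ.val u)
      T , u⁻¹∈ = almost-integral (𝔸ˣ.inv u)
  in integral-multiple-off (S ++ T) u λ v v∉ → u∈ v (v∉ ∘ ∈-++⁺ˡ) , u⁻¹∈ v (v∉ ∘ ∈-++⁺ʳ S)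

-- Adeles modulo ℚˣ

module ∼ʸ = IsEquivalence ∼ʸ-isEquivalence

1ℚˣ : ℚˣ.Unit
1ℚˣ = AbelianGroup.ε ℚˣ.abelianGroup

diagonal-1-* : ∀ a → diagonal 1ℚ *ᴬ a ≈ᴬ a
diagonal-1-* a = mk≈ᴬ λ w → K.*-identityˡ w (a at w)

≈⇒∼ʸ : ∀ {a b} → a ≈ᴬ b → a ∼ʸ b
≈⇒∼ʸ {a} {b} a≈b = mk∼ʸ 1ℚˣ (𝔸.trans {a} {b} a≈b (𝔸.sym {diagonal 1ℚ *ᴬ b} {b} (diagonal-1-* b)))

interchange : ∀ a b c d → (a *ᴬ b) *ᴬ (c *ᴬ d) ≈ᴬ (a *ᴬ c) *ᴬ (b *ᴬ d)
interchange = CommutativeSemigroupProperties.interchange 𝔸.*-commutativeSemigroup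

diagonal-* : ∀ q r → diagonal (q * r) ≈ᴬ diagonal q *ᴬ diagonal r
diagonal-* q r = mk≈ᴬ λ w → K.ι-* w q r

∼ʸ-* : ∀ {a a′ b b′} → a ∼ʸ a′ → b ∼ʸ b′ → a *ᴬ b ∼ʸ a′ *ᴬ b′
∼ʸ-* {a} {a′} {b} {b′} (mk∼ʸ q a≈) (mk∼ʸ r b≈) = mk∼ʸ (AbelianGroup._∙_ ℚˣ.abelianGroup q r) (begin
  a *ᴬ b                     ≈⟨ 𝔸.*-cong a≈ b≈ ⟩
  δq *ᴬ a′ *ᴬ (δr *ᴬ b′)     ≈⟨ interchange δq a′ δr b′ ⟩
  δq *ᴬ δr *ᴬ (a′ *ᴬ b′)     ≈⟨ 𝔸.*-congʳ (diagonal-* (ℚˣ.val q) (ℚˣ.val r)) ⟨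
  diagonal (ℚˣ.val q * ℚˣ.val r) *ᴬ (a′ *ᴬ b′) ∎)
  where
  open import Relation.Binary.Reasoning.Setoid 𝔸.setoid
  δq δr : Adele
  δq = diagonal (ℚˣ.val q)
  δr = diagonal (ℚˣ.val r)

-- The mutually inverse homomorphisms between ideles and normalized adeles

module _ (p : FinitePlace) where

  P : Place
  P = finite p

  open Normalized

  e f : Adele
  e = 𝐞 p
  f = 1ᴬ +ᴬ -ᴬ e

  by-places : ∀ {a b} → K._≈_ P (a at P) (b at P) → (∀ w → w ≢ P → K._≈_ w (a at w) (b at w)) → a ≈ᴬ b
  by-places {a} {b} at-P off-P = mk≈ᴬ go
    where
    go : ∀ w → K._≈_ w (a at w) (b at w)
    go w with w ≟ᵖ P
    ... | yes refl = at-P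
    ... | no  w≢P  = off-P w w≢P

  e-off : ∀ w → w ≢ P → K._≈_ w (e at w) (K.1# w)
  e-off w w≢P with w ≟ᵖ P
  ... | yes w≡P = contradiction w≡P w≢P
  ... | no  _   = K.refl w {K.1# w}

  local-at : ∀ x → K._≈_ P (local p x at P) x
  local-at x with P ≟ᵖ P
  ... | yes refl = K.refl P {x}
  ... | no  P≢P  = contradiction refl P≢P

  local-off : ∀ x w → w ≢ P → K._≈_ w (local p x at w) (K.1# w)
  local-off x w w≢P with w ≟ᵖ P
  ... | yes w≡P = contradiction w≡P w≢P
  ... | no  _   = K.refl w {K.1# w}

  *e-at : ∀ a → K._≈_ P ((a *ᴬ e) at P) (K.0# P)
  *e-at a = K.trans P {(a *ᴬ e) at P} {K._*_ P (a at P) (K.0# P)} {K.0# P}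
    (K.*-cong P {a at P} {a at P} {e at P} {K.0# P} (K.refl P {a at P}) (zero-p (𝐞-normalized p)))
    (K.zeroʳ P (a at P))

  *e-off : ∀ a w → w ≢ P → K._≈_ w ((a *ᴬ e) at w) (a at w)
  *e-off a w w≢P = K.trans w {(a *ᴬ e) at w} {K._*_ w (a at w) (K.1# w)} {a at w}
    (K.*-cong w {a at w} {a at w} {e at w} {K.1# w} (K.refl w {a at w}) (e-off w w≢P))
    (K.*-identityʳ w (a at w))

  +f-at : ∀ n → K._≈_ P ((adele n +ᴬ f) at P) (K.1# P)
  +f-at n = begin
    (adele n at P) ⊕ (1# ⊕ (⊖ (e at P)))  ≈⟨ +-cong {adele n at P} {0#} (zero-p n)
                                              (+-cong {1#} {1#} (Kₚ.refl {1#}) (-‿cong {e at P} {0#} (zero-p (𝐞-normalized p)))) ⟩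
    0# ⊕ (1# ⊕ (⊖ 0#))                    ≈⟨ pointwise (λ _ → refl) ⟩
    1#                                    ∎
    where
    module Kₚ = K P
    open Kₚ using (1#; 0#; +-cong; -‿cong) renaming (_+_ to _⊕_; -_ to ⊖_)
    open Completion (absoluteValue P) using (pointwise)
    open import Relation.Binary.Reasoning.Setoid Kₚ.setoid

  +f-off : ∀ a w → w ≢ P → K._≈_ w ((a +ᴬ f) at w) (a at w)
  +f-off a w w≢P = begin
    (a at w) ⊕ (1# ⊕ (⊖ (e at w)))  ≈⟨ +-cong {a at w} {a at w} (K_w.refl {a at w})
                                        (+-cong {1#} {1#} (K_w.refl {1#}) (-‿cong {e at w} {1#} (e-off w w≢P))) ⟩
    (a at w) ⊕ (1# ⊕ (⊖ 1#))        ≈⟨ +-cong {a at w} {a at w} (K_w.refl {a at w}) (-‿inverseʳ 1#) ⟩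
    (a at w) ⊕ 0#                   ≈⟨ +-identityʳ (a at w) ⟩
    (a at w)                        ∎
    where
    module K_w = K w
    open K_w using (1#; 0#; +-cong; -‿cong; -‿inverseʳ; +-identityʳ) renaming (_+_ to _⊕_; -_ to ⊖_)
    open import Relation.Binary.Reasoning.Setoid K_w.setoid

  -- The inverse law of 𝓕 holds up to a rational factor, which is 1.
  *-inverse-≈ : ∀ n → adele n *ᴬ adele (_⁻¹ᶠ p n) ≈ᴬ e
  *-inverse-≈ n = 𝔸.trans {adele n *ᴬ adele (_⁻¹ᶠ p n)} {diagonal 1ℚ *ᴬ e} {e}
    (a≈factor (Group.inverseʳ (𝓕 p) n)) (diagonal-1-* e)

  adele-*e : ∀ n → adele n *ᴬ e ≈ᴬ adele n
  adele-*e n = by-places {adele n *ᴬ e} {adele n}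
    (K.trans P {(adele n *ᴬ e) at P} {K.0# P} {adele n at P} (*e-at (adele n))
      (K.sym P {adele n at P} {K.0# P} (zero-p n)))
    (*e-off (adele n))

  normalized-integral : ∀ n v → 𝒪 v (adele n at finite v)
  normalized-integral n v with finite v ≟ᵖ P
  ... | yes refl = 𝒪-respects v {K.0# P} {adele n at P} (K.sym P {adele n at P} {K.0# P} (zero-p n)) (𝒪-properties.0∈𝒪 v)
  ... | no  v≢P  = proj₁ (unit n (finite v) v≢P)

  -- Integrality is an argument so that, in the proof of continuity, an idele u′ near u can be
  -- restricted with the multiplier belonging to u.
  restrict : (u : Idele) → (∀ v → IntegralAt v u) → Normalized p
  restrict u u∈ = mkNormalized (𝔸ˣ.val u *ᴬ e) (*e-at (𝔸ˣ.val u)) units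
    where
    inverse : ∀ w → w ≢ P → K._≈_ w (K._*_ w ((𝔸ˣ.val u *ᴬ e) at w) (𝔸ˣ.inv u at w)) (K.1# w)
    inverse w w≢P = K.trans w {K._*_ w ((𝔸ˣ.val u *ᴬ e) at w) (𝔸ˣ.inv u at w)} {(𝔸ˣ.val u *ᴬ 𝔸ˣ.inv u) at w} {K.1# w}
      (K.*-cong w {(𝔸ˣ.val u *ᴬ e) at w} {𝔸ˣ.val u at w} {𝔸ˣ.inv u at w} {𝔸ˣ.inv u at w}
        (*e-off (𝔸ˣ.val u) w w≢P) (K.refl w {𝔸ˣ.inv u at w}))
      (at-≈ (𝔸ˣ.val·inv≈1 u) w)
    units : ∀ w → w ≢ P → UnitAt w ((𝔸ˣ.val u *ᴬ e) at w)
    units ∞          ∞≢P = 𝔸ˣ.inv u at ∞ , inverse ∞ ∞≢P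
    units (finite v) v≢P = 𝒪-properties.*-closed v (proj₁ (u∈ v)) (normalized-integral (𝐞-normalized p) v)
      , 𝔸ˣ.inv u at finite v , proj₂ (u∈ v) , inverse (finite v) v≢P

  restrict-∼ : ∀ q u qu∈ → adele (restrict (q • u) qu∈) ∼ʸ 𝔸ˣ.val u *ᴬ e
  restrict-∼ q u _ = mk∼ʸ q (𝔸.*-assoc (diagonal (ℚˣ.val q)) (𝔸ˣ.val u) e)

  φ : Idele → Normalized p
  φ u = let q , qu∈ = integral-multiple u in restrict (q • u) qu∈

  φ-∼ : ∀ u → adele (φ u) ∼ʸ 𝔸ˣ.val u *ᴬ e
  φ-∼ u = let q , qu∈ = integral-multiple u in restrict-∼ q u qu∈

  ψ : Normalized p → Idele
  ψ n = 𝔸ˣ.mkUnit (adele n +ᴬ f) (adele (_⁻¹ᶠ p n) +ᴬ f) (by-places at-P off-P)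
    where
    x y : Adele
    x = adele n
    y = adele (_⁻¹ᶠ p n)
    at-P : K._≈_ P (((x +ᴬ f) *ᴬ (y +ᴬ f)) at P) (K.1# P)
    at-P = K.trans P {((x +ᴬ f) *ᴬ (y +ᴬ f)) at P} {K._*_ P (K.1# P) (K.1# P)} {K.1# P}
      (K.*-cong P {(x +ᴬ f) at P} {K.1# P} {(y +ᴬ f) at P} {K.1# P} (+f-at n) (+f-at (_⁻¹ᶠ p n)))
      (K.*-identityˡ P (K.1# P))
    off-P : ∀ w → w ≢ P → K._≈_ w (((x +ᴬ f) *ᴬ (y +ᴬ f)) at w) (K.1# w)
    off-P w w≢P = K.trans w {((x +ᴬ f) *ᴬ (y +ᴬ f)) at w} {(x *ᴬ y) at w} {K.1# w}
      (K.*-cong w {(x +ᴬ f) at w} {x at w} {(y +ᴬ f) at w} {y at w} (+f-off x w w≢P) (+f-off y w w≢P))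
      (K.trans w {(x *ᴬ y) at w} {e at w} {K.1# w} (at-≈ (*-inverse-≈ n) w) (e-off w w≢P))

  ψ-*e : ∀ n → 𝔸ˣ.val (ψ n) *ᴬ e ≈ᴬ adele n
  ψ-*e n = by-places {𝔸ˣ.val (ψ n) *ᴬ e} {adele n}
    (K.trans P {(𝔸ˣ.val (ψ n) *ᴬ e) at P} {K.0# P} {adele n at P} (*e-at (𝔸ˣ.val (ψ n)))
      (K.sym P {adele n at P} {K.0# P} (zero-p n)))
    (λ w w≢P → K.trans w {(𝔸ˣ.val (ψ n) *ᴬ e) at w} {𝔸ˣ.val (ψ n) at w} {adele n at w}
      (*e-off (𝔸ˣ.val (ψ n)) w w≢P) (+f-off (adele n) w w≢P))

  module C/ιₚ = Group (C-ℚ/ιₚ p)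
  module C/ιᵖ = C/ι p
  module 𝓕ₚ = Group (𝓕 p)

  -- The right-hand side has the shape of the two nested quotients: a rational factor outside, a
  -- local factor at p inside. At p both sides are 1; elsewhere f and the local factor have no
  -- effect.
  +f-≈ : ∀ n δ x y → adele n ≈ᴬ δ *ᴬ (x *ᴬ e) → K._≈_ P (K._*_ P ((δ *ᴬ x) at P) y) (K.1# P) →
         adele n +ᴬ f ≈ᴬ δ *ᴬ (local p y *ᴬ x)
  +f-≈ n δ x y n≈ δxy≈1 = by-places at-P off-P
    where
    l : Adele
    l = local p y
    at-P : K._≈_ P ((adele n +ᴬ f) at P) ((δ *ᴬ (l *ᴬ x)) at P)
    at-P = begin
      (adele n +ᴬ f) at P                ≈⟨ +f-at n ⟩
      1#                                 ≈⟨ δxy≈1 ⟨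
      (δ at P) · (x at P) · y     ≈⟨ *-assoc (δ at P) (x at P) y ⟩
      (δ at P) · ((x at P) · y)   ≈⟨ *-cong {δ at P} {δ at P} (Kₚ.refl {δ at P}) (begin
        (x at P) · y   ≈⟨ *-comm (x at P) y ⟩
        y · (x at P)   ≈⟨ *-cong {y} {l at P} {x at P} {x at P}
                                  (Kₚ.sym {l at P} {y} (local-at y)) (Kₚ.refl {x at P}) ⟩
        (l at P) · (x at P)   ∎) ⟩
      (δ at P) · ((l at P) · (x at P))   ∎
      where
      module Kₚ = K P
      open Kₚ using (1#; *-cong; *-comm; *-assoc) renaming (_*_ to _·_)
      open import Relation.Binary.Reasoning.Setoid Kₚ.setoid
    off-P : ∀ w → w ≢ P → K._≈_ w ((adele n +ᴬ f) at w) ((δ *ᴬ (l *ᴬ x)) at w)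
    off-P w w≢P = begin
      (adele n +ᴬ f) at w               ≈⟨ +f-off (adele n) w w≢P ⟩
      adele n at w                      ≈⟨ at-≈ n≈ w ⟩
      (δ at w) · ((x *ᴬ e) at w)        ≈⟨ *-cong {δ at w} {δ at w} (K_w.refl {δ at w}) (begin
        (x *ᴬ e) at w         ≈⟨ *e-off x w w≢P ⟩
        x at w                ≈⟨ *-identityˡ (x at w) ⟨
        1# · (x at w)         ≈⟨ *-cong {1#} {l at w} {x at w} {x at w}
                                  (K_w.sym {l at w} {1#} (local-off y w w≢P)) (K_w.refl {x at w}) ⟩
        (l at w) · (x at w)   ∎) ⟩
      (δ at w) · ((l at w) · (x at w))  ∎
      where
      module K_w = K w
      open K_w using (1#; *-cong; *-identityˡ) renaming (_*_ to _·_)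
      open import Relation.Binary.Reasoning.Setoid K_w.setoid

  -- Only h contributes at p, and it is chosen to make that component 1.
  ψ-∼-via : ∀ n u (h : AbelianGroup.Carrier (ℚₚˣ p)) q → adele n ≈ᴬ diagonal (ℚˣ.val q) *ᴬ (𝔸ˣ.val u *ᴬ e) →
            K._≈_ P (K._*_ P (𝔸ˣ.val (q • u) at P) (Units.val h)) (K.1# P) → ψ n C/ιₚ.≈ u
  ψ-∼-via n u h q n≈ quh≈1 = C/ιᵖ.mk∼ h (C.mk∼ q (𝔸ˣ.mk≈ᵘ
    (+f-≈ n (diagonal (ℚˣ.val q)) (𝔸ˣ.val u) (Units.val h) n≈ quh≈1)))

  inverse-component : Idele → AbelianGroup.Carrier (ℚₚˣ p)
  inverse-component u = Units.mkUnit (𝔸ˣ.inv u at P) (𝔸ˣ.val u at P)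
    (K.trans P {K._*_ P (𝔸ˣ.inv u at P) (𝔸ˣ.val u at P)} {K._*_ P (𝔸ˣ.val u at P) (𝔸ˣ.inv u at P)} {K.1# P}
      (K.*-comm P (𝔸ˣ.inv u at P) (𝔸ˣ.val u at P)) (at-≈ (𝔸ˣ.val·inv≈1 u) P))

  ψ-∼ : ∀ n u → adele n ∼ʸ 𝔸ˣ.val u *ᴬ e → ψ n C/ιₚ.≈ u
  ψ-∼ n u (mk∼ʸ q n≈) = ψ-∼-via n u (inverse-component (q • u)) q n≈ (at-≈ (𝔸ˣ.val·inv≈1 (q • u)) P)

  local-*e : ∀ x → local p x *ᴬ e ≈ᴬ e
  local-*e x = by-places {local p x *ᴬ e} {e}
    (K.trans P {(local p x *ᴬ e) at P} {K.0# P} {e at P} (*e-at (local p x))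
      (K.sym P {e at P} {K.0# P} (zero-p (𝐞-normalized p))))
    (λ w w≢P → K.trans w {(local p x *ᴬ e) at w} {K.1# w} {e at w}
      (K.trans w {(local p x *ᴬ e) at w} {local p x at w} {K.1# w} (*e-off (local p x) w w≢P) (local-off x w w≢P))
      (K.sym w {e at w} {K.1# w} (e-off w w≢P)))

  -- The factor from ℚₚˣ differs from 1 only at p, where e vanishes. The rational factor remains and
  -- is what `∼ʸ` allows.
  *e-cong : ∀ u u′ → u C/ιₚ.≈ u′ → 𝔸ˣ.val u *ᴬ e ∼ʸ 𝔸ˣ.val u′ *ᴬ e
  *e-cong u u′ (C/ιᵖ.mk∼ h (C.mk∼ q u≈)) = mk∼ʸ q (begin
    x *ᴬ e                  ≈⟨ 𝔸.*-congʳ {e} {x} {δ *ᴬ (l *ᴬ x′)} (𝔸ˣ.val-≈ u≈) ⟩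
    δ *ᴬ (l *ᴬ x′) *ᴬ e     ≈⟨ 𝔸.*-assoc δ (l *ᴬ x′) e ⟩
    δ *ᴬ (l *ᴬ x′ *ᴬ e)     ≈⟨ 𝔸.*-congˡ {δ} {l *ᴬ x′ *ᴬ e} {x′ *ᴬ e} (begin
      l *ᴬ x′ *ᴬ e    ≈⟨ 𝔸.*-congʳ {e} {l *ᴬ x′} {x′ *ᴬ l} (𝔸.*-comm l x′) ⟩
      x′ *ᴬ l *ᴬ e    ≈⟨ 𝔸.*-assoc x′ l e ⟩
      x′ *ᴬ (l *ᴬ e)  ≈⟨ 𝔸.*-congˡ {x′} {l *ᴬ e} {e} (local-*e (Units.val h)) ⟩
      x′ *ᴬ e         ∎) ⟩
    δ *ᴬ (x′ *ᴬ e)          ∎)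
    where
    open import Relation.Binary.Reasoning.Setoid 𝔸.setoid
    x x′ l δ : Adele
    x  = 𝔸ˣ.val u
    x′ = 𝔸ˣ.val u′
    l  = local p (Units.val h)
    δ  = diagonal (ℚˣ.val q)

  φ-cong : ∀ u u′ → u C/ιₚ.≈ u′ → φ u 𝓕ₚ.≈ φ u′
  φ-cong u u′ u∼u′ = ∼ʸ.trans (φ-∼ u) (∼ʸ.trans (*e-cong u u′ u∼u′) (∼ʸ.sym (φ-∼ u′)))

  φ-ψ : ∀ n → φ (ψ n) 𝓕ₚ.≈ n
  φ-ψ n = ∼ʸ.trans (φ-∼ (ψ n)) (≈⇒∼ʸ (ψ-*e n))

  -- Allowing any n in the class of φ u, and not φ u alone, yields the inverse law in the form
  -- needed, injectivity of `φ` and congruence of `ψ` at once.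
  ψ-φ : ∀ n u → n 𝓕ₚ.≈ φ u → ψ n C/ιₚ.≈ u
  ψ-φ n u n∼φu = ψ-∼ n u (∼ʸ.trans n∼φu (φ-∼ u))

  ψ-cong : ∀ n m → n 𝓕ₚ.≈ m → ψ n C/ιₚ.≈ ψ m
  ψ-cong n m n∼m = ψ-φ n (ψ m) (∼ʸ.trans n∼m (∼ʸ.sym (φ-ψ m)))

  φ-homo : ∀ u u′ → φ (u C/ιₚ.∙ u′) 𝓕ₚ.≈ (φ u 𝓕ₚ.∙ φ u′)
  φ-homo u u′ = ∼ʸ.trans (φ-∼ (u C/ιₚ.∙ u′)) (∼ʸ.trans
    (≈⇒∼ʸ (begin
      -- The idempotent e is doubled so that each factor receives its own copy.
      x *ᴬ x′ *ᴬ e              ≈⟨ 𝔸.*-congˡ {x *ᴬ x′} {e *ᴬ e} {e} (adele-*e (𝐞-normalized p)) ⟨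
      x *ᴬ x′ *ᴬ (e *ᴬ e)       ≈⟨ interchange x x′ e e ⟩
      x *ᴬ e *ᴬ (x′ *ᴬ e)       ∎))
    (∼ʸ.sym (∼ʸ-* (φ-∼ u) (φ-∼ u′))))
    where
    open import Relation.Binary.Reasoning.Setoid 𝔸.setoid
    x x′ : Adele
    x  = 𝔸ˣ.val u
    x′ = 𝔸ˣ.val u′

  φ-ε : φ C/ιₚ.ε 𝓕ₚ.≈ 𝓕ₚ.ε
  φ-ε = ∼ʸ.trans (φ-∼ C/ιₚ.ε) (≈⇒∼ʸ (𝔸.*-identityˡ e))

  -- The multipliers chosen for u and u⁻¹ need not be inverse to each other; uniqueness of inverses
  -- in 𝓕 avoids comparing them.
  φ-⁻¹ : ∀ u → φ (u C/ιₚ.⁻¹) 𝓕ₚ.≈ (φ u 𝓕ₚ.⁻¹)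
  φ-⁻¹ u = GroupProperties.inverseˡ-unique (𝓕 p) (φ (u C/ιₚ.⁻¹)) (φ u)
    (∼ʸ.trans (∼ʸ.sym (φ-homo (u C/ιₚ.⁻¹) u))
      (∼ʸ.trans (φ-cong (u C/ιₚ.⁻¹ C/ιₚ.∙ u) C/ιₚ.ε (C/ιₚ.inverseˡ u)) φ-ε))

  φ-isGroupIsomorphism : IsGroupIsomorphism C/ιₚ.rawGroup 𝓕ₚ.rawGroup φ
  φ-isGroupIsomorphism = record
    { isGroupMonomorphism = record
      { isGroupHomomorphism = record
        { isMonoidHomomorphism = record
          { isMagmaHomomorphism = record
            { isRelHomomorphism = record { cong = λ {u} {u′} → φ-cong u u′ }
            ; homo = φ-homo
            }
          ; ε-homo = φ-ε
          }
        ; ⁻¹-homo = φ-⁻¹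
        }
      ; injective = λ {u} {u′} φu∼φu′ → C/ιₚ.trans {u} {ψ (φ u)} {u′}
          (C/ιₚ.sym {ψ (φ u)} {u} (ψ-φ (φ u) u ∼ʸ.refl)) (ψ-φ (φ u) u′ φu∼φu′)
      }
    ; surjective = λ n → ψ n , λ {u} u∼ψn → ∼ʸ.trans (φ-cong u (ψ n) u∼ψn) (φ-ψ n)
    }

-- The topological group 𝓕 and continuity of the two maps

-- The formula for a difference of inverses, before x x′ and y y′ are cancelled. In this form it is
-- a polynomial identity and holds term by term; the cancellation is valid only up to equality of
-- adeles.
inverse-increment : ∀ x y x′ y′ → x * x′ * y′ + - (y * y′ * x′) ≡ x′ * y′ * - (y - x)
inverse-increment = solve 4 (λ x y x′ y′ → x :* x′ :* y′ :+ :- (y :* y′ :* x′) := x′ :* y′ :* (:- (y :- x))) refl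
  where open +-*-Solver

-- The bound |x| ≤ 1 is not strict while `∥_∥<_` is; 2 is just a convenient radius above 1.
𝒪⇒small : ∀ v x → 𝒪 v x → K.∥_∥<_ (finite v) x (1ℚ + 1ℚ)
𝒪⇒small v x (mk𝒪 x≤1) = 1ℚ , ℚₚ.+-monoʳ-< 1ℚ (ℚₚ.positive⁻¹ 1ℚ) , x≤1

module _ (p : FinitePlace) where

  open Normalized

  -- The predicate `V` holds vacuously at adeles equal to no normalized one, so its interior is the
  -- largest open subset of 𝔸 whose normalized members all lie in U.
  normalized-open : (U : Pred (Normalized p) 0ℓ) →
    (∀ {n} → U n → ∃₂ λ S ε → 0ℚ < ε × (∀ {m} → Box S ε (adele n) (adele m) → U m)) →
    Open (normalized-topology p) U
  normalized-open U nbhd = interior V , interior-open V , U⊆V , V⊆U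
    where
    V : Pred Adele 0ℓ
    V a = ∀ m → a ≈ᴬ adele m → U m
    U⊆V : ∀ {n} → U n → interior V (adele n)
    U⊆V {n} Un = let S , ε , 0<ε , box⊆U = nbhd Un in S , ε , 0<ε , λ {a} box m a≈m →
      box⊆U {m} (Box-respects {S} {ε} {adele n} {a} {adele n} {adele m} (𝔸.refl {adele n}) a≈m box)
    V⊆U : ∀ {n} → interior V (adele n) → U n
    V⊆U {n} (S , ε , 0<ε , box⊆V) = box⊆V {adele n} (Box-refl 0<ε (adele n)) n (𝔸.refl {adele n})

  normalized-open⁻¹ : ∀ {U} → Open (normalized-topology p) U → ∀ {n} → U n →
    ∃₂ λ S ε → 0ℚ < ε × (∀ {m} → Box S ε (adele n) (adele m) → U m)
  normalized-open⁻¹ (V , V-open , U⊆V , V⊆U) {n} Un =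
    let S , ε , 0<ε , box⊆V = V-open (U⊆V Un) in S , ε , 0<ε , λ {m} box → V⊆U (box⊆V {adele m} box)

  -- Saturations of open sets are open: if n ∼ m, then b ↦ m n⁻¹ b stays in the
  -- class of b and moves a neighbourhood of n to a neighbourhood of m.
  saturation-open : (V : Pred Adele 0ℓ) →
    Open (𝓕-topology p) (λ n → ∃ λ m → adele n ∼ʸ adele m × interior V (adele m))
  saturation-open V = (λ { n∼n′ (m , n∼m , Vm) → m , ∼ʸ.trans (∼ʸ.sym n∼n′) n∼m , Vm }) ,
    normalized-open (λ n → ∃ λ m → adele n ∼ʸ adele m × interior V (adele m)) λ {n} → nbhd {n}
    where
    nbhd : ∀ {n} → (∃ λ m → adele n ∼ʸ adele m × interior V (adele m)) →
      ∃₂ λ S ε → 0ℚ < ε × (∀ {b} → Box S ε (adele n) (adele b) → ∃ λ m → adele b ∼ʸ adele m × interior V (adele m))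
    nbhd {n} (m , n∼m , Vm) =
      let S , ε , 0<ε , box⊆V = interior-open V {adele m} Vm
          T , δ , 0<δ , near  = *-continuous (adele c) (adele n) S 0<ε
      in T , δ , 0<δ , λ {b} box → F._∙_ c b , b∼cb b , box⊆V {adele c *ᴬ adele b}
           (Box-respects {S} {ε} {adele c *ᴬ adele n} {adele c *ᴬ adele b} {adele m} {adele c *ᴬ adele b}
             cn≈m (𝔸.refl {adele c *ᴬ adele b})
             (near {adele c} {adele b} (Box-refl 0<δ (adele c)) box))
      where
      module F = Group (𝓕 p)
      n⁻¹ : Normalized p
      n⁻¹ = F._⁻¹ n
      -- Products of normalized adeles are normalized by construction. For multiplication by the
      -- rational factor relating n and m this would have to be proved first.
      c : Normalized p
      c = F._∙_ m n⁻¹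
      cn≈m : adele c *ᴬ adele n ≈ᴬ adele m
      cn≈m = begin
        adele m *ᴬ adele n⁻¹ *ᴬ adele n    ≈⟨ 𝔸.*-assoc (adele m) (adele n⁻¹) (adele n) ⟩
        adele m *ᴬ (adele n⁻¹ *ᴬ adele n)  ≈⟨ 𝔸.*-congˡ {adele m} {adele n⁻¹ *ᴬ adele n} {𝐞 p} (begin
          adele n⁻¹ *ᴬ adele n   ≈⟨ 𝔸.*-comm (adele n⁻¹) (adele n) ⟩
          adele n *ᴬ adele n⁻¹   ≈⟨ *-inverse-≈ p n ⟩
          𝐞 p                    ∎) ⟩
        adele m *ᴬ 𝐞 p                     ≈⟨ adele-*e p m ⟩
        adele m                            ∎
        where open import Relation.Binary.Reasoning.Setoid 𝔸.setoid
      c∼ε : adele c ∼ʸ 𝐞 p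
      c∼ε = ∼ʸ.trans (∼ʸ-* (∼ʸ.sym n∼m) (∼ʸ.refl {adele n⁻¹})) (≈⇒∼ʸ (*-inverse-≈ p n))
      b∼cb : ∀ b → adele b ∼ʸ adele c *ᴬ adele b
      b∼cb b = ∼ʸ.sym (∼ʸ.trans (∼ʸ-* c∼ε (∼ʸ.refl {adele b})) (F.identityˡ b))

  ∙-continuousᶠ : Continuous (𝓕-topology p ×ᵗ 𝓕-topology p) (𝓕-topology p) (uncurry (Group._∙_ (𝓕 p)))
  ∙-continuousᶠ = record
    { congruent     = λ { {n , m} {n′ , m′} (n∼n′ , m∼m′) → ∼ʸ-* n∼n′ m∼m′ }
    ; preimage-open = λ { {U} (U-resp , U-open) {n} {m} Unm →
        let S , ε , 0<ε , box⊆U = normalized-open⁻¹ U-open {F._∙_ n m} Unm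
            T , δ , 0<δ , near  = *-continuous (adele n) (adele m) S 0<ε
            VN = Box T δ (adele n)
            VM = Box T δ (adele m)
        in (λ a → ∃ λ b → adele a ∼ʸ adele b × interior VN (adele b)) ,
           (λ a → ∃ λ b → adele a ∼ʸ adele b × interior VM (adele b)) ,
           saturation-open VN , saturation-open VM ,
           (n , ∼ʸ.refl , T , δ , 0<δ , id) , (m , ∼ʸ.refl , T , δ , 0<δ , id) ,
           -- The points a and a′ lie only in the saturations; they are exchanged for members b and
           -- b′ of their classes inside the boxes, which is harmless as U respects classes.
           λ { {a} {a′} (b , a∼b , _ , _ , 0<r , b∈) (b′ , a′∼b′ , _ , _ , 0<r′ , b′∈) →
               U-resp {F._∙_ b b′} {F._∙_ a a′} (∼ʸ-* (∼ʸ.sym a∼b) (∼ʸ.sym a′∼b′)) (box⊆U {F._∙_ b b′}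
                 (near {adele b} {adele b′} (b∈ {adele b} (Box-refl 0<r (adele b)))
                                            (b′∈ {adele b′} (Box-refl 0<r′ (adele b′))))) } }
    }
    where module F = Group (𝓕 p)

  inverse-difference : ∀ n m w → let open K w using () renaming (_*_ to _·_; _-_ to _⊝_; -_ to ⊖_) in
    K._≈_ w (((adele (_⁻¹ᶠ p n) at w) · (adele (_⁻¹ᶠ p m) at w)) · (⊖ difference w (adele n) (adele m)))
            (difference w (adele (_⁻¹ᶠ p n)) (adele (_⁻¹ᶠ p m)))
  inverse-difference n m w = K.trans w
    {((x′ at w) · (y′ at w)) · (⊖ difference w x y)} {(x *ᴬ x′ *ᴬ y′ +ᴬ -ᴬ (y *ᴬ y′ *ᴬ x′)) at w} {difference w x′ y′}
    (Completion.pointwise (absoluteValue w) λ i → sym (inverse-increment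
      (K.term w (x at w) i) (K.term w (y at w) i) (K.term w (x′ at w) i) (K.term w (y′ at w) i)))
    (at-≈ (𝔸.+-cong {x *ᴬ x′ *ᴬ y′} {y′} { -ᴬ (y *ᴬ y′ *ᴬ x′)} { -ᴬ x′} (cancel n m)
      (𝔸.-‿cong {y *ᴬ y′ *ᴬ x′} {x′} (cancel m n))) w)
    where
    open K w using () renaming (_*_ to _·_; -_ to ⊖_)
    x y x′ y′ : Adele
    x  = adele n
    y  = adele m
    x′ = adele (_⁻¹ᶠ p n)
    y′ = adele (_⁻¹ᶠ p m)
    cancel : ∀ n m → adele n *ᴬ adele (_⁻¹ᶠ p n) *ᴬ adele (_⁻¹ᶠ p m) ≈ᴬ adele (_⁻¹ᶠ p m)
    cancel n m = begin
      adele n *ᴬ adele (_⁻¹ᶠ p n) *ᴬ adele (_⁻¹ᶠ p m)  ≈⟨ 𝔸.*-congʳ {adele (_⁻¹ᶠ p m)} {adele n *ᴬ adele (_⁻¹ᶠ p n)} {𝐞 p} (*-inverse-≈ p n) ⟩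
      𝐞 p *ᴬ adele (_⁻¹ᶠ p m)                          ≈⟨ 𝔸.*-comm (𝐞 p) (adele (_⁻¹ᶠ p m)) ⟩
      adele (_⁻¹ᶠ p m) *ᴬ 𝐞 p                          ≈⟨ adele-*e p (_⁻¹ᶠ p m) ⟩
      adele (_⁻¹ᶠ p m)                                 ∎
      where open import Relation.Binary.Reasoning.Setoid 𝔸.setoid

  inverse-at-∞ : ∀ n → K._≈_ ∞ (K._*_ ∞ (adele n at ∞) (adele (_⁻¹ᶠ p n) at ∞)) (K.1# ∞)
  inverse-at-∞ n = K.trans ∞ {(adele n *ᴬ adele (_⁻¹ᶠ p n)) at ∞} {𝐞 p at ∞} {K.1# ∞}
    (at-≈ (*-inverse-≈ p n) ∞) (e-off p ∞ λ ())

  inverse-near : ∀ n m w {B δ} →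
    K.∥_∥<_ w (adele (_⁻¹ᶠ p n) at w) B → K.∥_∥<_ w (adele (_⁻¹ᶠ p m) at w) B →
    K.∥_∥<_ w (difference w (adele n) (adele m)) δ →
    K.∥_∥<_ w (difference w (adele (_⁻¹ᶠ p n)) (adele (_⁻¹ᶠ p m))) (B * B * δ)
  inverse-near n m w {B} {δ} x′<B y′<B d<δ = E.small-respects
    {K._*_ w (K._*_ w x′ y′) (K.-_ w d)} {difference w (adele (_⁻¹ᶠ p n)) (adele (_⁻¹ᶠ p m))}
    (inverse-difference n m w)
    (E.*-small (K._*_ w x′ y′) (K.-_ w d) (E.*-small x′ y′ x′<B y′<B) (E.neg-small d d<δ))
    where
    module E = Estimates (absoluteValue w)
    x′ y′ d : K.Carrier w
    x′ = adele (_⁻¹ᶠ p n) at w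
    y′ = adele (_⁻¹ᶠ p m) at w
    d  = difference w (adele n) (adele m)

  -- In contrast to `*-continuous` the list S need not grow: inverses of normalized adeles are
  -- integral at every finite place, so off S the increment of the inverse is integral as soon as
  -- that of n is.
  ⁻¹-near : ∀ n S {ε} → 0ℚ < ε → ∃ λ δ → 0ℚ < δ × (∀ {m} → Box S δ (adele n) (adele m) →
              Box S ε (adele (_⁻¹ᶠ p n)) (adele (_⁻¹ᶠ p m)))
  ⁻¹-near n S {ε} 0<ε =
    let M , x′<M             = Estimates.bounded (absoluteValue ∞) x′∞
        η , R , 0<η , y′<R   = Estimates.inverse-bounded (absoluteValue ∞) (adele n at ∞) x′∞ (inverse-at-∞ n)
        -- One bound for all inverses involved: M for that of n and R for that of m at ∞, and 2 for
        -- both at the finite places.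
        B                    = M ⊔ R ⊔ (1ℚ + 1ℚ)
        2≤B                  = ℚₚ.p≤q⊔p (M ⊔ R) (1ℚ + 1ℚ)
        M≤B                  = ℚₚ.≤-trans (ℚₚ.p≤p⊔q M R) (ℚₚ.p≤p⊔q (M ⊔ R) (1ℚ + 1ℚ))
        R≤B                  = ℚₚ.≤-trans (ℚₚ.p≤q⊔p M R) (ℚₚ.p≤p⊔q (M ⊔ R) (1ℚ + 1ℚ))
        0<B                  = ℚₚ.<-≤-trans (ℚₚ.positive⁻¹ (1ℚ + 1ℚ)) 2≤B
        0<BB                 = *-pos 0<B 0<B
        γ , 0<γ , BBγ≡ε      = positive-quotient {ε} {B * B} 0<ε 0<BB
        δ                    = γ ⊓ η
        BBδ≤ε                = ℚₚ.≤-trans (ℚₚ.*-monoˡ-≤-nonNeg (B * B) {{ℚ.nonNegative (ℚₚ.<⇒≤ 0<BB)}} (ℚₚ.p⊓q≤p γ η))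
                                 (ℚₚ.≤-reflexive BBγ≡ε)
    in δ , Adelic.⊓-pos 0<γ 0<η , λ {m} box →
       Box-enlarge {S} {B * B * δ} {ε} {adele (_⁻¹ᶠ p n)} {adele (_⁻¹ᶠ p m)} BBδ≤ε (record
         { near-∞  = inverse-near n m ∞ {B} {δ}
             (Adelic.enlarge ∞ {x′∞} M≤B x′<M)
             (Adelic.enlarge ∞ {adele (_⁻¹ᶠ p m) at ∞} R≤B
               (y′<R (adele m at ∞) (adele (_⁻¹ᶠ p m) at ∞) (inverse-at-∞ m)
                 (Adelic.enlarge ∞ {difference ∞ (adele n) (adele m)} (ℚₚ.p⊓q≤q γ η) (near-∞ box))))
             (near-∞ box)
         ; near-S  = λ v v∈ → inverse-near n m (finite v) {B} {δ} (bound 2≤B v n) (bound 2≤B v m) (near-S box v v∈)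
         ; outside = λ v v∉ → 𝒪-respects v {K._*_ (finite v) (K._*_ (finite v) (adele (_⁻¹ᶠ p n) at finite v) (adele (_⁻¹ᶠ p m) at finite v))
                                               (K.-_ (finite v) (difference (finite v) (adele n) (adele m)))}
                                            {difference (finite v) (adele (_⁻¹ᶠ p n)) (adele (_⁻¹ᶠ p m))}
             (inverse-difference n m (finite v))
             (𝒪-properties.*-closed v
               (𝒪-properties.*-closed v (normalized-integral p (_⁻¹ᶠ p n) v) (normalized-integral p (_⁻¹ᶠ p m) v))
               (𝒪-properties.neg-closed v (outside box v v∉)))
         })
    where
    open Box
    x′∞ : K.Carrier ∞
    x′∞ = adele (_⁻¹ᶠ p n) at ∞
    bound : ∀ {B} → 1ℚ + 1ℚ ≤ B → ∀ v m → K.∥_∥<_ (finite v) (adele (_⁻¹ᶠ p m) at finite v) B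
    bound 2≤B v m = Adelic.enlarge (finite v) {adele (_⁻¹ᶠ p m) at finite v} 2≤B
      (𝒪⇒small v (adele (_⁻¹ᶠ p m) at finite v) (normalized-integral p (_⁻¹ᶠ p m) v))

  ⁻¹-continuousᶠ : Continuous (𝓕-topology p) (𝓕-topology p) (_⁻¹ᶠ p)
  ⁻¹-continuousᶠ = record
    { congruent     = λ {n} {m} → F.⁻¹-cong {n} {m}
    ; preimage-open = λ { {U} (U-resp , U-open) →
        (λ {n} {m} n∼m → U-resp (F.⁻¹-cong {n} {m} n∼m)) ,
        normalized-open (U ∘ _⁻¹ᶠ p) λ {n} Un⁻¹ →
          let S , ε , 0<ε , box⊆U = normalized-open⁻¹ U-open {_⁻¹ᶠ p n} Un⁻¹
              δ , 0<δ , near      = ⁻¹-near n S 0<ε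
          in S , δ , 0<δ , λ {m} box → box⊆U {_⁻¹ᶠ p m} (near {m} box) }
    }
    where module F = Group (𝓕 p)

  𝓕-isTopologicalGroup : IsTopologicalGroup (𝓕 p) (𝓕-topology p)
  𝓕-isTopologicalGroup = record { ∙-continuous = ∙-continuousᶠ ; ⁻¹-continuous = ⁻¹-continuousᶠ }

  φ-continuous : Continuous (C-ℚ/ιₚ-topology p) (𝓕-topology p) (φ p)
  φ-continuous = record
    { congruent     = λ {u} {u′} → φ-cong p u u′
    ; preimage-open = λ { {U} (U-resp , U-open) →
        (λ {u} {u′} u∼u′ → U-resp (φ-cong p u u′ u∼u′)) ,
        (λ {u} {u′} u∼u′ → U-resp (φ-cong p u u′ (C/ιᵖ.≈⇒∼ p u∼u′))) ,
        idele-open (U ∘ φ p) λ {u} Uφu → nbhd U (λ {n} {m} → U-resp {n} {m}) U-open u Uφu }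
    }
    where
    nbhd : ∀ U → U Respects (Group._≈_ (𝓕 p)) → Open (normalized-topology p) U → ∀ u → U (φ p u) →
      ∃₂ λ S ε → 0ℚ < ε × (∀ {u′} → Box S ε (𝔸ˣ.val u) (𝔸ˣ.val u′) → Box S ε (𝔸ˣ.inv u) (𝔸ˣ.inv u′) → U (φ p u′))
    nbhd U U-resp U-open u Uφu =
      let q , qu∈                = integral-multiple u
          S , ε , 0<ε , box⊆U    = normalized-open⁻¹ U-open {φ p u} Uφu
          S₁ , ε₁ , 0<ε₁ , near₁ = *-continuous (𝔸ˣ.val (q • u)) (𝐞 p) S 0<ε
          -- The radius is cut down to 1 so that q u′ - q u is integral at every finite place, which
          -- makes q u′ integral along with q u.
          S₂ , ε₂ , 0<ε₂ , near₂ = *-continuous (diagonal (ℚˣ.val q)) (𝔸ˣ.val u) S₁ (unit-interval 0<ε₁)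
          -- Of the inverse of q u′ only integrality is wanted, hence the empty list and radius 1.
          S₃ , ε₃ , 0<ε₃ , near₃ = *-continuous (diagonal (ℚˣ.inv q)) (𝔸ˣ.inv u) [] (ℚₚ.positive⁻¹ 1ℚ)
      in S₂ ++ S₃ , (ε₂ ⊓ ε₃) ⊓ 1ℚ , unit-interval (Adelic.⊓-pos 0<ε₂ 0<ε₃) , λ {u′} val-near inv-near →
         let val-box = near₂ {diagonal (ℚˣ.val q)} {𝔸ˣ.val u′} (Box-refl 0<ε₂ (diagonal (ℚˣ.val q))) (shrink-left S₂ S₃ ε₂ ε₃ val-near)
             inv-box = near₃ {diagonal (ℚˣ.inv q)} {𝔸ˣ.inv u′} (Box-refl 0<ε₃ (diagonal (ℚˣ.inv q))) (shrink-right S₂ S₃ ε₂ ε₃ inv-near)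
             qu′∈ : ∀ v → IntegralAt v (q • u′)
             qu′∈ v =
               𝒪-near v {𝔸ˣ.val (q • u) at finite v} {𝔸ˣ.val (q • u′) at finite v} (proj₁ (qu∈ v))
                 (Box-difference∈𝒪 {S₁} {ε₁ ⊓ 1ℚ} {𝔸ˣ.val (q • u)} {𝔸ˣ.val (q • u′)} (ℚₚ.p⊓q≤q ε₁ 1ℚ) val-box v) ,
               𝒪-near v {𝔸ˣ.inv (q • u) at finite v} {𝔸ˣ.inv (q • u′) at finite v} (proj₂ (qu∈ v))
                 (Box-difference∈𝒪 {[]} {1ℚ} {𝔸ˣ.inv (q • u)} {𝔸ˣ.inv (q • u′)} ℚₚ.≤-refl inv-box v)
             -- The multiplier in `φ p u′` may differ from q and need not put that adele near
             -- `φ p u`; n′ is near it and has the class of `φ p u′`.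
             n′ = restrict p (q • u′) qu′∈
         in U-resp {n′} {φ p u′} (∼ʸ.trans (restrict-∼ p q u′ qu′∈) (∼ʸ.sym (φ-∼ p u′)))
              (box⊆U {n′} (near₁ {𝔸ˣ.val (q • u′)} {𝐞 p}
                (Box-enlarge {S₁} {ε₁ ⊓ 1ℚ} {ε₁} {𝔸ˣ.val (q • u)} {𝔸ˣ.val (q • u′)} (ℚₚ.p⊓q≤p ε₁ 1ℚ) val-box)
                (Box-refl 0<ε₁ (𝐞 p))))

  ψ-continuous : Continuous (𝓕-topology p) (C-ℚ/ιₚ-topology p) (ψ p)
  ψ-continuous = record
    { congruent     = λ {n} {m} → ψ-cong p n m
    ; preimage-open = λ { {U} (U-resp , _ , U-open) →
        (λ {n} {m} n∼m → U-resp (ψ-cong p n m n∼m)) ,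
        normalized-open (U ∘ ψ p) λ {n} Uψn →
          let S , ε , 0<ε , box⊆U = idele-open⁻¹ U-open {ψ p n} Uψn
              δ , 0<δ , near      = ⁻¹-near n S 0<ε
          in S , δ ⊓ ε , Adelic.⊓-pos 0<δ 0<ε , λ {m} box → box⊆U {ψ p m}
               (+-translate (adele n) (adele m) (f p)
                 (Box-enlarge {S} {δ ⊓ ε} {ε} {adele n} {adele m} (ℚₚ.p⊓q≤q δ ε) box))
               (+-translate (adele (_⁻¹ᶠ p n)) (adele (_⁻¹ᶠ p m)) (f p)
                 (near {m} (Box-enlarge {S} {δ ⊓ ε} {δ} {adele n} {adele m} (ℚₚ.p⊓q≤p δ ε) box))) }
    }

theorem7p4 : (p : FinitePlace) →
    IsTopologicalGroup (𝓕 p) (𝓕-topology p) ×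
    ∃ λ (φ : TopologicalGroupIsomorphism (C-ℚ/ιₚ p) (C-ℚ/ιₚ-topology p) (𝓕 p) (𝓕-topology p)) →
    (u : Idele) →
    Normalized.adele (TopologicalGroupIsomorphism.to φ u) ∼ʸ 𝔸ˣ.val u *ᴬ 𝐞 p
theorem7p4 p = 𝓕-isTopologicalGroup p , record
  { to                 = φ p
  ; from               = ψ p
  ; isGroupIsomorphism = φ-isGroupIsomorphism p
  ; inverse            = (λ {n} {u} u∼ψn → ∼ʸ.trans (φ-cong p u (ψ p n) u∼ψn) (φ-ψ p n)) ,
                         (λ {u} {n} n∼φu → ψ-φ p n u n∼φu)
  ; to-continuous      = φ-continuous p
  ; from-continuous    = ψ-continuous p
  } , φ-∼ p
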